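{- Let $m\ge1$ and $\kappa_m=\sqrt{\ln(4m)/\pi}$. The average number of edges of the minimal dag of an $m$-labeled binary tree of size $n$, taken uniformly at random, satisfies $$\bar E^{\mathcal B}_{m,n}=3\kappa_m\frac{n}{\sqrt{\ln n}}\left(1+O\!\left(\frac1{\ln n}\right)\right)\quad(n\to\infty).$$
   Context: An $m$-labeled binary tree is a non-empty finite rooted tree with node labels in $\{1,\dots,m\}$ in which every node has an optional left and an optional right child (distinguished); its size is its number of edges. Its minimal dag has one node per distinct subtree (subtree = a node with all its descendants) and, from the node of each distinct subtree, one edge to the node of each of its non-empty left/right subtrees; so its number of edges is the sum over distinct subtrees of the number of children of their root. $\bar E^{\mathcal B}_{m,n}$ is the average of this number over all $m$-labeled binary trees of size $n$. -}

module Defs where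

open import Data.Bool.Base using (true; false; if_then_else_; T)
open import Data.Empty using (⊥-elim)
open import Data.Fin.Base as Fin using (Fin)
import Data.Fin.Properties as Fin
open import Data.Integer.Base as ℤ using (+_; -[1+_]; +≤+; +<+)
import Data.Integer.Properties as ℤ
open import Data.List.Base
  using (List; []; _∷_; _++_; map; concatMap; length; allFin; upTo;
         cartesianProduct; cartesianProductWith; deduplicate; fromMaybe)
open import Data.List.Membership.Propositional using (_∈_; find; lose)
open import Data.List.Membership.Propositional.Properties
  using (∈-map⁺; ∈-map⁻; ∈-concatMap⁺; ∈-concatMap⁻; ∈-cartesianProductWith⁺; ∈-cartesianProductWith⁻;
         ∈-cartesianProduct⁺; ∈-cartesianProduct⁻; ∈-upTo⁺; ∈-upTo⁻; ∈-allFin; ∈-length)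
open import Data.List.Relation.Unary.All as All using ()
import Data.List.Relation.Unary.All.Properties as All
open import Data.List.Relation.Unary.AllPairs as AllPairs using ()
import Data.List.Relation.Unary.AllPairs.Properties as AllPairs
open import Data.List.Relation.Unary.Any using (here)
open import Data.List.Relation.Unary.Unique.Propositional using (Unique)
import Data.List.Relation.Unary.Unique.Propositional.Properties as Unique
open import Data.Maybe.Base using (Maybe; just; nothing)
open import Data.Nat.Base as ℕ using (ℕ; zero; suc; z≤n; s≤s; NonTrivial)
open import Data.Nat.Coprimality using (Coprime)
open import Data.Nat.ListAction using (sum)
import Data.Nat.Properties as ℕ
open import Data.Nat.Tactic.RingSolver using (solve-∀)
open import Data.Product.Base using (∃-syntax; _×_; _,_; proj₁; proj₂)
open import Data.Rational.Base as ℚ using (ℚ; mkℚ; 0ℚ; 1ℚ; ½)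
open import Data.Rational.Solver using (module +-*-Solver)
open import Data.Rational.Unnormalised.Base as ℚᵘ using (mkℚᵘ; *≡*)
import Data.Rational.Unnormalised.Properties as ℚᵘ
open import Data.Sum.Base using (_⊎_; inj₁; inj₂)
open import Function.Base using (_∘_)
open import Relation.Binary.Definitions using (DecidableEquality)
open import Relation.Binary.PropositionalEquality
  using (_≡_; _≢_; refl; sym; trans; cong; cong₂; subst; subst₂; module ≡-Reasoning)
open import Relation.Nullary using (¬_; yes; no)
open import Relation.Nullary.Decidable using (toWitness)

data Tree (m : ℕ) : Set where
  node : (label : Fin m) (left right : Maybe (Tree m)) → Tree m

data Side : Set where
  left right : Side

module _ {m : ℕ} where

  -- The number of edges; `size?` also counts the edge leading to the subtree.
  size  : Tree m → ℕ
  size? : Maybe (Tree m) → ℕ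
  size (node _ l r) = size? l ℕ.+ size? r
  size? nothing  = 0
  size? (just t) = suc (size t)

  subtrees  : Tree m → List (Tree m)
  subtrees? : Maybe (Tree m) → List (Tree m)
  subtrees t@(node _ l r) = t ∷ subtrees? l ++ subtrees? r
  subtrees? nothing  = []
  subtrees? (just t) = subtrees t

  infix 4 _≟_ _≟?_
  _≟_  : DecidableEquality (Tree m)
  _≟?_ : DecidableEquality (Maybe (Tree m))
  node a l r ≟ node a′ l′ r′ with a Fin.≟ a′ | l ≟? l′ | r ≟? r′
  ... | yes refl | yes refl | yes refl = yes refl
  ... | no a≢a′  | _        | _        = no λ where refl → a≢a′ refl
  ... | _        | no l≢l′  | _        = no λ where refl → l≢l′ refl
  ... | _        | _        | no r≢r′  = no λ where refl → r≢r′ refl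
  nothing ≟? nothing = yes refl
  nothing ≟? just _  = no λ ()
  just _  ≟? nothing = no λ ()
  just t  ≟? just u with t ≟ u
  ... | yes refl = yes refl
  ... | no t≢u   = no λ where refl → t≢u refl

  -- The minimal dag of t: its nodes are the distinct subtrees of t, and an edge
  -- is given by its source, its side and its target.

  dagNodes : Tree m → List (Tree m)
  dagNodes t = deduplicate _≟_ (subtrees t)

  outEdges : Tree m → List (Tree m × Side × Tree m)
  outEdges t@(node _ l r) =
    map (λ u → t , left , u) (fromMaybe l) ++ map (λ u → t , right , u) (fromMaybe r)

  dagEdges : Tree m → List (Tree m × Side × Tree m)
  dagEdges t = concatMap outEdges (dagNodes t)

  join : Fin m → Maybe (Tree m) × Maybe (Tree m) → Tree m
  join a (l , r) = node a l r

module _ (m : ℕ) where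

  -- Trees of height at most h with n edges; with `size?` i on the left and j on the right.
  treesOfHeight≤  : (h n : ℕ) → List (Tree m)
  treesSplit      : (h i j : ℕ) → List (Tree m)
  treesOfHeight≤? : (h n : ℕ) → List (Maybe (Tree m))
  treesOfHeight≤ h n = concatMap (λ i → treesSplit h i (n ℕ.∸ i)) (upTo (suc n))
  treesSplit h i j = cartesianProductWith join (allFin m)
    (cartesianProduct (treesOfHeight≤? h i) (treesOfHeight≤? h j))
  treesOfHeight≤? h       zero    = nothing ∷ []
  treesOfHeight≤? zero    (suc n) = []
  treesOfHeight≤? (suc h) (suc n) = map just (treesOfHeight≤ h n)

  -- A tree with n edges has height at most n. By ∈-trees⁺, ∈-trees⁻ and trees-unique
  -- every tree of size n is listed exactly once.
  trees : ℕ → List (Tree m)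
  trees n = treesOfHeight≤ n n

module _ {m : ℕ} where

  private
    ∈-split : ∀ h i j {a : Fin m} {l r} → node a l r ∈ treesSplit m h i j →
              l ∈ treesOfHeight≤? m h i × r ∈ treesOfHeight≤? m h j
    ∈-split h i j t∈
      with _ , _ , _ , lr∈ , refl ← ∈-cartesianProductWith⁻ join (allFin m)
             (cartesianProduct (treesOfHeight≤? m h i) (treesOfHeight≤? m h j)) t∈
      = ∈-cartesianProduct⁻ (treesOfHeight≤? m h i) (treesOfHeight≤? m h j) lr∈

    sound  : ∀ h n (t : Tree m) → t ∈ treesOfHeight≤ m h n → size t ≡ n
    sound? : ∀ h n (t : Maybe (Tree m)) → t ∈ treesOfHeight≤? m h n → size? t ≡ n

    sound h n (node a l r) t∈
      with i , i∈ , t∈′ ← find (∈-concatMap⁻ (λ i → treesSplit m h i (n ℕ.∸ i)) {xs = upTo (suc n)} t∈)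
      with l∈ , r∈ ← ∈-split h i (n ℕ.∸ i) t∈′
      = trans (cong₂ ℕ._+_ (sound? h i l l∈) (sound? h (n ℕ.∸ i) r r∈))
              (ℕ.m+[n∸m]≡n (ℕ.≤-pred (∈-upTo⁻ i∈)))
    sound? h       zero    t (here refl) = refl
    sound? (suc h) (suc n) t t∈ with u , u∈ , refl ← ∈-map⁻ just t∈ = cong suc (sound h n u u∈)

    complete  : ∀ h (t : Tree m) → size t ℕ.≤ h → t ∈ treesOfHeight≤ m h (size t)
    complete? : ∀ h (t : Maybe (Tree m)) → size? t ℕ.≤ h → t ∈ treesOfHeight≤? m h (size? t)
    complete h (node a l r) t≤h =
      ∈-concatMap⁺ (λ i → treesSplit m h i (size? l ℕ.+ size? r ℕ.∸ i))
        (lose (∈-upTo⁺ (s≤s (ℕ.m≤m+n (size? l) (size? r))))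
          (subst (λ j → node a l r ∈ treesSplit m h (size? l) j)
            (sym (ℕ.m+n∸m≡n (size? l) (size? r)))
            (∈-cartesianProductWith⁺ join (∈-allFin a)
              (∈-cartesianProduct⁺ (complete? h l (ℕ.m+n≤o⇒m≤o (size? l) t≤h))
                                   (complete? h r (ℕ.m+n≤o⇒n≤o (size? l) t≤h))))))
    complete? h       nothing  _         = here refl
    complete? (suc h) (just t) (s≤s t≤h) = ∈-map⁺ just (complete h t t≤h)

    unique  : ∀ h n → Unique (treesOfHeight≤ m h n)
    unique? : ∀ h n → Unique (treesOfHeight≤? m h n)
    unique h n = Unique.concat⁺ {xss = map split (upTo (suc n))}
      (All.map⁺ {xs = upTo (suc n)} (All.tabulate λ {i} _ → Unique.cartesianProductWith⁺ join
        (λ where refl → refl , refl) (Unique.allFin⁺ m)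
        (Unique.cartesianProduct⁺ (unique? h i) (unique? h (n ℕ.∸ i)))))
      (AllPairs.map⁺ {f = split} (AllPairs.map (λ i≢j {v} → disjoint i≢j v) (Unique.upTo⁺ (suc n))))
      where
      split : ℕ → List (Tree m)
      split i = treesSplit m h i (n ℕ.∸ i)
      disjoint : ∀ {i j} → i ≢ j → ∀ v → ¬ (v ∈ split i × v ∈ split j)
      disjoint {i} {j} i≢j (node _ l _) (∈i , ∈j) = i≢j (trans
        (sym (sound? h i l (proj₁ (∈-split h i (n ℕ.∸ i) ∈i))))
        (sound? h j l (proj₁ (∈-split h j (n ℕ.∸ j) ∈j))))
    unique? h       zero    = All.[] AllPairs.∷ AllPairs.[]
    unique? zero    (suc n) = AllPairs.[]
    unique? (suc h) (suc n) = Unique.map⁺ (λ where refl → refl) (unique h n)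

  ∈-trees⁺ : ∀ (t : Tree m) → t ∈ trees m (size t)
  ∈-trees⁺ t = complete (size t) t ℕ.≤-refl

  ∈-trees⁻ : ∀ n (t : Tree m) → t ∈ trees m n → size t ≡ n
  ∈-trees⁻ n = sound n n

  trees-unique : ∀ n → Unique (trees m n)
  trees-unique n = unique n n

trees-nonEmpty : ∀ m n → .{{ℕ.NonZero m}} → ℕ.NonZero (length (trees m n))
trees-nonEmpty (suc m) n = ℕ.>-nonZero (∈-length
  (subst (λ k → path n ∈ trees (suc m) k) (size-path n) (∈-trees⁺ (path n))))
  where
  path : ℕ → Tree (suc m)
  path zero    = node Fin.zero nothing nothing
  path (suc n) = node Fin.zero (just (path n)) nothing
  size-path : ∀ n → size (path n) ≡ n
  size-path zero    = refl
  size-path (suc n) = cong suc (trans (ℕ.+-identityʳ (size (path n))) (size-path n))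

avgDagEdges : ∀ m → .{{ℕ.NonZero m}} → ℕ → ℚ
avgDagEdges m n =
  (+ sum (map (length ∘ dagEdges) (trees m n)) ℚ./ length (trees m n)) {{trees-nonEmpty m n}}

Eventually : (ℕ → Set) → Set
Eventually P = ∃[ N ] ∀ n → N ℕ.≤ n → P n

Cauchy : (ℕ → ℚ) → Set
Cauchy x = ∀ ε → 0ℚ ℚ.< ε → ∃[ N ] ∀ i j → N ℕ.≤ i → N ℕ.≤ j → ℚ.∣ x i ℚ.- x j ∣ ℚ.≤ ε

module Rational where

  open import Data.Rational.Base
  open import Data.Rational.Properties
  open +-*-Solver

  -- The reciprocal, extended by inv 0 = 0.
  inv : ℚ → ℚ
  inv p@(mkℚ (+ zero)    _ _) = 0ℚ
  inv p@(mkℚ (ℤ.+[1+ _ ]) _ _) = 1/ p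
  inv p@(mkℚ (-[1+ _ ])  _ _) = 1/ p

  *-inv : ∀ p → 0ℚ < p → p * inv p ≡ 1ℚ
  *-inv (mkℚ (+ zero) _ _) (*<* (+<+ ()))
  *-inv p@(mkℚ (ℤ.+[1+ _ ]) _ _) _ = *-inverseʳ p
  *-inv (mkℚ (-[1+ _ ]) _ _) (*<* ())

  inv-pos : ∀ p → 0ℚ < p → 0ℚ < inv p
  inv-pos (mkℚ (+ zero) _ _) (*<* (+<+ ()))
  inv-pos p@(mkℚ (ℤ.+[1+ _ ]) _ _) _ = positive⁻¹ (1/ p)
  inv-pos (mkℚ (-[1+ _ ]) _ _) (*<* ())

  0<½ : 0ℚ < ½
  0<½ = positive⁻¹ ½

  0<* : ∀ {p q} → 0ℚ < p → 0ℚ < q → 0ℚ < p * q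
  0<* {p} {q} 0<p 0<q =
    positive⁻¹ (p * q) {{pos*pos⇒pos p {{positive 0<p}} q {{positive 0<q}}}}

  0≤* : ∀ {p q} → 0ℚ ≤ p → 0ℚ ≤ q → 0ℚ ≤ p * q
  0≤* {p} {q} 0≤p 0≤q =
    nonNegative⁻¹ (p * q) {{nonNeg*nonNeg⇒nonNeg p {{nonNegative 0≤p}} q {{nonNegative 0≤q}}}}

  0≤+ : ∀ {p q} → 0ℚ ≤ p → 0ℚ ≤ q → 0ℚ ≤ p + q
  0≤+ 0≤p 0≤q = +-mono-≤ 0≤p 0≤q

  *-mono : ∀ {p q r s} → 0ℚ ≤ p → 0ℚ ≤ s → p ≤ q → r ≤ s → p * r ≤ q * s
  *-mono {p} {q} {r} {s} 0≤p 0≤s p≤q r≤s =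
    ≤-trans (*-monoˡ-≤-nonNeg p {{nonNegative 0≤p}} r≤s)
            (*-monoʳ-≤-nonNeg s {{nonNegative 0≤s}} p≤q)

  p≤p+q : ∀ {p q} → 0ℚ ≤ q → p ≤ p + q
  p≤p+q {p} {q} 0≤q = subst (_≤ p + q) (+-identityʳ p) (+-monoʳ-≤ p 0≤q)

  -≤⇒≤+ : ∀ {p q r} → p - q ≤ r → p ≤ q + r
  -≤⇒≤+ {p} {q} {r} h = subst₂ _≤_
    (solve 2 (λ p q → q :+ (p :- q) := p) refl p q) refl (+-monoʳ-≤ q h)

  ≤+⇒-≤ : ∀ {p q r} → p ≤ q + r → p - q ≤ r
  ≤+⇒-≤ {p} {q} {r} h = subst (p - q ≤_)
    (solve 2 (λ q r → (q :+ r) :- q := r) refl q r) (+-monoˡ-≤ (- q) h)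

  ∣∣≤ : ∀ {p r} → p ≤ r → - p ≤ r → ∣ p ∣ ≤ r
  ∣∣≤ {p} h h′ with ∣p∣≡p∨∣p∣≡-p p
  ... | inj₁ eq = subst (_≤ _) (sym eq) h
  ... | inj₂ eq = subst (_≤ _) (sym eq) h′

  p≤∣p∣ : ∀ p → p ≤ ∣ p ∣
  p≤∣p∣ p with ≤-total 0ℚ p
  ... | inj₁ 0≤p = ≤-reflexive (sym (0≤p⇒∣p∣≡p 0≤p))
  ... | inj₂ p≤0 = ≤-trans p≤0 (0≤∣p∣ p)

  neg-swap : ∀ p q → - (p - q) ≡ q - p
  neg-swap = solve 2 (λ p q → :- (p :- q) := q :- p) refl

  ∣-∣≤ : ∀ {p q r} → p ≤ q + r → q ≤ p + r → ∣ p - q ∣ ≤ r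
  ∣-∣≤ {p} {q} h h′ =
    ∣∣≤ (≤+⇒-≤ h) (subst (_≤ _) (sym (neg-swap p q)) (≤+⇒-≤ h′))

  ∣-∣≤⇒≤+ : ∀ {p q r} → ∣ p - q ∣ ≤ r → p ≤ q + r
  ∣-∣≤⇒≤+ {p} {q} h = -≤⇒≤+ (≤-trans (p≤∣p∣ (p - q)) h)

  ½+½ : ∀ ε → ½ * ε + ½ * ε ≡ ε
  ½+½ ε = trans (sym (*-distribʳ-+ ε ½ ½)) (*-identityˡ ε)

  frac : ℕ → ℕ → ℚ
  frac a n = + a / suc n

  toℚᵘ-frac : ∀ a n → toℚᵘ (frac a n) ℚᵘ.≃ mkℚᵘ (+ a) n
  toℚᵘ-frac a n = toℚᵘ-fromℚᵘ (mkℚᵘ (+ a) n)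

  frac-≤ : ∀ {a b m n} → a ℕ.* suc n ℕ.≤ b ℕ.* suc m → frac a m ≤ frac b n
  frac-≤ {a} {b} {m} {n} h = toℚᵘ-cancel-≤
    (ℚᵘ.≤-respˡ-≃ (ℚᵘ.≃-sym (toℚᵘ-frac a m))
      (ℚᵘ.≤-respʳ-≃ (ℚᵘ.≃-sym (toℚᵘ-frac b n))
        (ℚᵘ.*≤* (subst₂ ℤ._≤_ (ℤ.pos-* a (suc n)) (ℤ.pos-* b (suc m)) (+≤+ h)))))

  frac-≡ : ∀ {a b m n} → a ℕ.* suc n ≡ b ℕ.* suc m → frac a m ≡ frac b n
  frac-≡ {a} {b} {m} {n} h =
    ≤-antisym (frac-≤ {a} {b} {m} {n} (ℕ.≤-reflexive h))
              (frac-≤ {b} {a} {n} {m} (ℕ.≤-reflexive (sym h)))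

  frac-nonNeg : ∀ a n → 0ℚ ≤ frac a n
  frac-nonNeg a n = frac-≤ {0} {a} {0} {n} z≤n

  frac-pos : ∀ a n → 0ℚ < frac (suc a) n
  frac-pos a n = positive⁻¹ (frac (suc a) n) {{normalize-pos (suc a) (suc n)}}

  mkℚ≡frac : ∀ a n .(c : Coprime a (suc n)) → mkℚ (+ a) n (λ {d} → c {d}) ≡ frac a n
  mkℚ≡frac a n c = sym (↥p/↧p≡p (mkℚ (+ a) n (λ {d} → c {d})))

  frac-* : ∀ a b m n → frac a m * frac b n ≡ frac (a ℕ.* b) (n ℕ.+ m ℕ.* suc n)
  frac-* a b m n = toℚᵘ-injective
    (ℚᵘ.≃-trans (toℚᵘ-homo-* (frac a m) (frac b n))
    (ℚᵘ.≃-trans (ℚᵘ.*-cong (toℚᵘ-frac a m) (toℚᵘ-frac b n))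
    (ℚᵘ.≃-trans (ℚᵘ.≃-reflexive (cong (λ i → mkℚᵘ i (n ℕ.+ m ℕ.* suc n)) (sym (ℤ.pos-* a b))))
    (ℚᵘ.≃-sym (toℚᵘ-frac (a ℕ.* b) (n ℕ.+ m ℕ.* suc n))))))

  frac-+ : ∀ a b n → frac a n + frac b n ≡ frac (a ℕ.+ b) n
  frac-+ a b n = toℚᵘ-injective
    (ℚᵘ.≃-trans (toℚᵘ-homo-+ (frac a n) (frac b n))
    (ℚᵘ.≃-trans (ℚᵘ.+-cong (toℚᵘ-frac a n) (toℚᵘ-frac b n))
    (ℚᵘ.≃-trans (*≡* eq)
    (ℚᵘ.≃-sym (toℚᵘ-frac (a ℕ.+ b) n)))))
    where
    d = + suc n
    eq : (+ a ℤ.* d ℤ.+ + b ℤ.* d) ℤ.* d ≡ (+ a ℤ.+ + b) ℤ.* (d ℤ.* d)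
    eq = trans (cong (ℤ._* d) (sym (ℤ.*-distribʳ-+ d (+ a) (+ b))))
               (ℤ.*-assoc (+ a ℤ.+ + b) d d)

  archimedean : ∀ ε → 0ℚ < ε → Eventually (λ n → frac 1 n ≤ ε)
  archimedean (mkℚ (+ zero) _ _) (*<* (+<+ ()))
  archimedean (mkℚ (-[1+ _ ]) _ _) (*<* ())
  archimedean (mkℚ (ℤ.+[1+ a ]) d c) _ = d , λ n d≤n →
    subst (frac 1 n ≤_) (sym (mkℚ≡frac (suc a) d (λ {e} → c {e})))
      (frac-≤ {1} {suc a} {n} {d}
        (ℕ.*-mono-≤ {1} {suc a} (s≤s z≤n) (s≤s d≤n)))

  module _ {P Q : ℕ → Set} where

    both : Eventually P → Eventually Q → Eventually (λ n → P n × Q n)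
    both (M , p) (N , q) = M ℕ.⊔ N , λ n h →
      p n (ℕ.m⊔n≤o⇒m≤o M N h) , q n (ℕ.m⊔n≤o⇒n≤o M N h)

  OneSided : (ℕ → ℚ) → Set
  OneSided x = ∀ ε → 0ℚ < ε → ∃[ N ] ∀ i j → N ℕ.≤ i → N ℕ.≤ j → x i ≤ x j + ε

  cauchy⇒oneSided : ∀ x → Cauchy x → OneSided x
  cauchy⇒oneSided x c ε 0<ε = let N , h = c ε 0<ε in
    N , λ i j Ni Nj → ∣-∣≤⇒≤+ (h i j Ni Nj)

  oneSided⇒cauchy : ∀ x → OneSided x → Cauchy x
  oneSided⇒cauchy x c ε 0<ε = let N , h = c ε 0<ε in
    N , λ i j Ni Nj → ∣-∣≤ (h i j Ni Nj) (h j i Nj Ni)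

  const-cauchy : ∀ q → Cauchy (λ _ → q)
  const-cauchy q ε 0<ε = 0 , λ _ _ _ _ →
    subst (λ p → ∣ p ∣ ≤ ε) (sym (+-inverseʳ q)) (<⇒≤ 0<ε)

  +-cauchy : ∀ x y → Cauchy x → Cauchy y → Cauchy (λ i → x i + y i)
  +-cauchy x y cx cy = oneSided⇒cauchy (λ i → x i + y i) λ ε 0<ε →
    let 0<ε′ = 0<* 0<½ 0<ε
        M , h = cauchy⇒oneSided x cx (½ * ε) 0<ε′
        N , k = cauchy⇒oneSided y cy (½ * ε) 0<ε′
    in M ℕ.⊔ N , λ i j Ni Nj → subst (x i + y i ≤_)
      (trans (solve 3 (λ a b e → (a :+ e) :+ (b :+ e) := (a :+ b) :+ (e :+ e)) refl (x j) (y j) (½ * ε))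
             (cong (_+_ (x j + y j)) (½+½ ε)))
      (+-mono-≤ (h i j (ℕ.m⊔n≤o⇒m≤o M N Ni) (ℕ.m⊔n≤o⇒m≤o M N Nj))
                (k i j (ℕ.m⊔n≤o⇒n≤o M N Ni) (ℕ.m⊔n≤o⇒n≤o M N Nj)))

  neg-cauchy : ∀ x → Cauchy x → Cauchy (λ i → - x i)
  neg-cauchy x cx ε 0<ε = let N , h = cx ε 0<ε in
    N , λ i j Ni Nj → subst (λ p → ∣ p ∣ ≤ ε)
      (solve 2 (λ a b → b :- a := (:- a) :- (:- b)) refl (x i) (x j)) (h j i Nj Ni)

  ∣∣-cauchy : ∀ x → Cauchy x → Cauchy (λ i → ∣ x i ∣)
  ∣∣-cauchy x cx = oneSided⇒cauchy (λ i → ∣ x i ∣) λ ε 0<ε → let N , h = cx ε 0<ε in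
    N , λ i j Ni Nj → ≤-trans
      (≤-reflexive (cong ∣_∣ (solve 2 (λ a b → a := b :+ (a :- b)) refl (x i) (x j))))
      (≤-trans (∣p+q∣≤∣p∣+∣q∣ (x j) (x i - x j)) (+-monoʳ-≤ ∣ x j ∣ (h i j Ni Nj)))

  bounded : ∀ x → Cauchy x → ∃[ B ] 0ℚ < B × Eventually (λ i → ∣ x i ∣ ≤ B)
  bounded x cx =
    let N , h = cauchy⇒oneSided (λ i → ∣ x i ∣) (∣∣-cauchy x cx) 1ℚ (positive⁻¹ 1ℚ)
    in ∣ x N ∣ + 1ℚ
     , <-≤-trans (positive⁻¹ 1ℚ)
         (subst (_≤ ∣ x N ∣ + 1ℚ) (+-identityˡ 1ℚ) (+-monoˡ-≤ 1ℚ (0≤∣p∣ (x N))))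
     , N , λ i Ni → h i N Ni ℕ.≤-refl

  *-cauchy : ∀ x y → Cauchy x → Cauchy y → Cauchy (λ i → x i * y i)
  *-cauchy x y cx cy ε 0<ε =
    let A , 0<A , MA , hA = bounded x cx
        B , 0<B , MB , hB = bounded y cy
        α = ½ * ε * inv A
        β = ½ * ε * inv B
        M , h = cx β (0<* (0<* 0<½ 0<ε) (inv-pos B 0<B))
        N , k = cy α (0<* (0<* 0<½ 0<ε) (inv-pos A 0<A))
        K = MA ℕ.⊔ MB
        L = M ℕ.⊔ N
        toK = λ {i} (p : K ℕ.⊔ L ℕ.≤ i) → ℕ.m⊔n≤o⇒m≤o K L p
        toL = λ {i} (p : K ℕ.⊔ L ℕ.≤ i) → ℕ.m⊔n≤o⇒n≤o K L p
        cancel = λ D (0<D : 0ℚ < D) → trans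
          (solve 3 (λ d e i → d :* (e :* i) := e :* (d :* i)) refl D (½ * ε) (inv D))
          (trans (cong (_*_ (½ * ε)) (*-inv D 0<D)) (*-identityʳ (½ * ε)))
    in K ℕ.⊔ L , λ i j Ni Nj → begin
      ∣ x i * y i - x j * y j ∣
        ≡⟨ cong ∣_∣ (solve 4 (λ a b c d → a :* b :- c :* d := a :* (b :- d) :+ d :* (a :- c))
             refl (x i) (y i) (x j) (y j)) ⟩
      ∣ x i * (y i - y j) + y j * (x i - x j) ∣
        ≤⟨ ∣p+q∣≤∣p∣+∣q∣ (x i * (y i - y j)) (y j * (x i - x j)) ⟩
      ∣ x i * (y i - y j) ∣ + ∣ y j * (x i - x j) ∣
        ≡⟨ cong₂ _+_ (∣p*q∣≡∣p∣*∣q∣ (x i) (y i - y j)) (∣p*q∣≡∣p∣*∣q∣ (y j) (x i - x j)) ⟩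
      ∣ x i ∣ * ∣ y i - y j ∣ + ∣ y j ∣ * ∣ x i - x j ∣
        ≤⟨ +-mono-≤
             (*-mono (0≤∣p∣ (x i)) (<⇒≤ (0<* (0<* 0<½ 0<ε) (inv-pos A 0<A)))
                (hA i (ℕ.m⊔n≤o⇒m≤o MA MB (toK Ni)))
                (k i j (ℕ.m⊔n≤o⇒n≤o M N (toL Ni)) (ℕ.m⊔n≤o⇒n≤o M N (toL Nj))))
             (*-mono (0≤∣p∣ (y j)) (<⇒≤ (0<* (0<* 0<½ 0<ε) (inv-pos B 0<B)))
                (hB j (ℕ.m⊔n≤o⇒n≤o MA MB (toK Nj)))
                (h i j (ℕ.m⊔n≤o⇒m≤o M N (toL Ni)) (ℕ.m⊔n≤o⇒m≤o M N (toL Nj)))) ⟩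
      A * α + B * β
        ≡⟨ cong₂ _+_ (cancel A 0<A) (cancel B 0<B) ⟩
      ½ * ε + ½ * ε
        ≡⟨ ½+½ ε ⟩
      ε ∎
    where open ≤-Reasoning

  inv-antitone : ∀ {δ p} → 0ℚ < δ → δ ≤ p → inv p ≤ inv δ
  inv-antitone {δ} {p} 0<δ δ≤p = subst₂ _≤_
    (trans (solve 3 (λ d i e → i :* (d :* e) := (i :* d) :* e) refl δ (inv p) (inv δ))
      (trans (*-assoc (inv p) δ (inv δ))
        (trans (cong (inv p *_) (*-inv δ 0<δ)) (*-identityʳ (inv p)))))
    (trans (cong (_* inv δ) (trans (*-comm (inv p) p) (*-inv p 0<p))) (*-identityˡ (inv δ)))
    (subst₂ _≤_
      (solve 3 (λ d i e → (i :* d) :* e := i :* (d :* e)) refl δ (inv p) (inv δ)) refl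
      (*-monoʳ-≤-nonNeg (inv δ) {{nonNegative (<⇒≤ (inv-pos δ 0<δ))}}
        (*-monoˡ-≤-nonNeg (inv p) {{nonNegative (<⇒≤ (inv-pos p 0<p))}} δ≤p)))
    where
    0<p : 0ℚ < p
    0<p = <-≤-trans 0<δ δ≤p

  inv-cauchy : ∀ x → Cauchy x → ∀ δ → 0ℚ < δ → Eventually (λ i → δ ≤ x i) →
               Cauchy (λ i → inv (x i))
  inv-cauchy x cx δ 0<δ (M , δ≤) = oneSided⇒cauchy (λ i → inv (x i)) λ ε 0<ε →
    let η = ε * (δ * δ)
        0<η = 0<* 0<ε (0<* 0<δ 0<δ)
        N , h = cauchy⇒oneSided x cx η 0<η
    in M ℕ.⊔ N , λ i j Ni Nj →
    let a = x i
        b = x j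
        δ≤a = δ≤ i (ℕ.m⊔n≤o⇒m≤o M N Ni)
        δ≤b = δ≤ j (ℕ.m⊔n≤o⇒m≤o M N Nj)
        0<a = <-≤-trans 0<δ δ≤a
        0<b = <-≤-trans 0<δ δ≤b
        0≤ia = <⇒≤ (inv-pos a 0<a)
        0≤ib = <⇒≤ (inv-pos b 0<b)
        0≤D = <⇒≤ (inv-pos δ 0<δ)
    in -≤⇒≤+ {inv a} {inv b} (begin
      inv a - inv b
        ≡⟨ cong₂ _-_ (sym (*-identityʳ (inv a))) (sym (*-identityʳ (inv b))) ⟩
      inv a * 1ℚ - inv b * 1ℚ
        ≡⟨ cong₂ (λ u v → inv a * u - inv b * v) (sym (*-inv b 0<b)) (sym (*-inv a 0<a)) ⟩
      inv a * (b * inv b) - inv b * (a * inv a)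
        ≡⟨ solve 4 (λ a b c d → c :* (b :* d) :- d :* (a :* c) := (b :- a) :* (c :* d))
             refl a b (inv a) (inv b) ⟩
      (b - a) * (inv a * inv b)
        ≤⟨ *-monoʳ-≤-nonNeg (inv a * inv b) {{nonNegative (0≤* 0≤ia 0≤ib)}}
             (≤+⇒-≤ {b} {a} {η} (h j i (ℕ.m⊔n≤o⇒n≤o M N Nj) (ℕ.m⊔n≤o⇒n≤o M N Ni))) ⟩
      η * (inv a * inv b)
        ≤⟨ *-monoˡ-≤-nonNeg η {{nonNegative (<⇒≤ 0<η)}}
             (*-mono 0≤ia 0≤D (inv-antitone 0<δ δ≤a) (inv-antitone 0<δ δ≤b)) ⟩
      η * (inv δ * inv δ)
        ≡⟨ solve 3 (λ e d i → (e :* (d :* d)) :* (i :* i) := e :* ((d :* i) :* (d :* i)))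
             refl ε δ (inv δ) ⟩
      ε * ((δ * inv δ) * (δ * inv δ))
        ≡⟨ cong (λ u → ε * (u * u)) (*-inv δ 0<δ) ⟩
      ε * (1ℚ * 1ℚ)
        ≡⟨ *-identityʳ ε ⟩
      ε ∎)
    where open ≤-Reasoning

  -- The integer square root of k, given that of k - 1.
  isqrt-step : (k r : ℕ) → ℕ
  isqrt-step k r = if suc r ℕ.* suc r ℕ.≤ᵇ k then suc r else r

  isqrt : ℕ → ℕ
  isqrt zero    = 0
  isqrt (suc k) = isqrt-step (suc k) (isqrt k)

  isqrt-spec : ∀ k → isqrt k ℕ.* isqrt k ℕ.≤ k × k ℕ.< suc (isqrt k) ℕ.* suc (isqrt k)
  isqrt-spec zero    = z≤n , s≤s z≤n
  isqrt-spec (suc k) = step (isqrt k) (isqrt-spec k)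
    where
    Spec : ℕ → ℕ → Set
    Spec k r = r ℕ.* r ℕ.≤ k × k ℕ.< suc r ℕ.* suc r
    step : ∀ r → Spec k r → Spec (suc k) (isqrt-step (suc k) r)
    step r (lo , hi) with suc r ℕ.* suc r ℕ.≤ᵇ suc k in eq
    ... | true  = ℕ.≤ᵇ⇒≤ _ _ (subst T (sym eq) _)
                , ℕ.≤-<-trans hi (ℕ.*-mono-< (ℕ.n<1+n (suc r)) (ℕ.n<1+n (suc r)))
    ... | false = ℕ.m≤n⇒m≤1+n lo
                , ℕ.≰⇒> (λ h → subst T eq (ℕ.≤⇒≤ᵇ h))

  -- √(a/d) to within 1/(n+1), as isqrt(ad(n+1)²)/(d(n+1)); 0 for negative arguments.
  sqrtℚ : ℕ → ℚ → ℚ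
  sqrtℚ n (mkℚ (+ a) d-1 _) =
    + isqrt (a ℕ.* suc d-1 ℕ.* (suc n ℕ.* suc n)) / (suc d-1 ℕ.* suc n)
  sqrtℚ n (mkℚ -[1+ _ ] _ _) = 0ℚ

  sqrtℚ-nonNeg : ∀ n q → 0ℚ ≤ sqrtℚ n q
  sqrtℚ-nonNeg n (mkℚ (+ a) d _) =
    frac-nonNeg (isqrt (a ℕ.* suc d ℕ.* (suc n ℕ.* suc n))) (n ℕ.+ d ℕ.* suc n)
  sqrtℚ-nonNeg n (mkℚ -[1+ _ ] _ _) = ≤-refl

  sqrtℚ-lower : ∀ n q → sqrtℚ n q ≡ 0ℚ ⊎ sqrtℚ n q * sqrtℚ n q ≤ q
  sqrtℚ-lower n (mkℚ -[1+ _ ] _ _) = inj₁ refl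
  sqrtℚ-lower n (mkℚ (+ a) d c) = inj₂ (subst₂ _≤_
    (sym (frac-* r r D D)) (sym (mkℚ≡frac a d (λ {e} → c {e})))
    (frac-≤ {r ℕ.* r} {a} {D ℕ.+ D ℕ.* suc D} {d}
      (ℕ.≤-trans (ℕ.*-monoˡ-≤ (suc d) (proj₁ (isqrt-spec (a ℕ.* suc d ℕ.* (suc n ℕ.* suc n)))))
        (ℕ.≤-reflexive (lem a (suc d) (suc n))))))
    where
    D = n ℕ.+ d ℕ.* suc n
    r = isqrt (a ℕ.* suc d ℕ.* (suc n ℕ.* suc n))
    lem : ∀ a d n → a ℕ.* d ℕ.* (n ℕ.* n) ℕ.* d ≡ a ℕ.* ((d ℕ.* n) ℕ.* (d ℕ.* n))
    lem = solve-∀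

  sqrtℚ-upper : ∀ n q → q ≤ (sqrtℚ n q + frac 1 n) * (sqrtℚ n q + frac 1 n)
  sqrtℚ-upper n q@(mkℚ -[1+ _ ] _ _) =
    ≤-trans (<⇒≤ (negative⁻¹ q)) (0≤* (0≤+ ≤-refl (frac-nonNeg 1 n)) (0≤+ ≤-refl (frac-nonNeg 1 n)))
  sqrtℚ-upper n (mkℚ (+ a) d c) = subst₂ _≤_
    (sym (mkℚ≡frac a d (λ {e} → c {e}))) (sym eq)
    (frac-≤ {a} {R ℕ.* R} {d} {D ℕ.+ D ℕ.* suc D}
      (ℕ.≤-trans (ℕ.≤-reflexive (lem a (suc d) (suc n)))
        (ℕ.*-monoˡ-≤ (suc d)
          (ℕ.≤-trans (ℕ.<⇒≤ (proj₂ (isqrt-spec (a ℕ.* suc d ℕ.* (suc n ℕ.* suc n)))))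
            (ℕ.*-mono-≤ r<R r<R)))))
    where
    D = n ℕ.+ d ℕ.* suc n
    r = isqrt (a ℕ.* suc d ℕ.* (suc n ℕ.* suc n))
    R = r ℕ.+ suc d
    r<R : r ℕ.< R
    r<R = ℕ.m<m+n r (s≤s z≤n)
    lem : ∀ a d n → a ℕ.* ((d ℕ.* n) ℕ.* (d ℕ.* n)) ≡ a ℕ.* d ℕ.* (n ℕ.* n) ℕ.* d
    lem = solve-∀
    step : frac r D + frac 1 n ≡ frac R D
    step = trans
      (cong (_+_ (frac r D)) (frac-≡ {1} {suc d} {n} {D} (ℕ.*-identityˡ (suc D))))
      (frac-+ r (suc d) D)
    eq : (frac r D + frac 1 n) * (frac r D + frac 1 n) ≡ frac (R ℕ.* R) (D ℕ.+ D ℕ.* suc D)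
    eq = trans (cong₂ _*_ step step) (frac-* R R D D)

  sqrt-cauchy : ∀ x → Cauchy x → Cauchy (λ i → sqrtℚ i (x i))
  sqrt-cauchy x cx = oneSided⇒cauchy (λ i → sqrtℚ i (x i)) λ ε 0<ε →
    let h  = ½ * ε
        0<h = 0<* 0<½ 0<ε
        η  = ε * h
        M , close = cauchy⇒oneSided x cx η (0<* 0<ε 0<h)
        N , small = archimedean h 0<h
    in M ℕ.⊔ N , λ i j Ni Nj →
      step ε 0<ε (x i) (x j) i j
        (close i j (ℕ.m⊔n≤o⇒m≤o M N Ni) (ℕ.m⊔n≤o⇒m≤o M N Nj))
        (small j (ℕ.m⊔n≤o⇒n≤o M N Nj))
    where
    step : ∀ ε → 0ℚ < ε → ∀ a b i j → a ≤ b + ε * (½ * ε) → frac 1 j ≤ ½ * ε →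
           sqrtℚ i a ≤ sqrtℚ j b + ε
    step ε 0<ε a b i j a≤b small with sqrtℚ i a ≤? sqrtℚ j b + ε
    ... | yes p = p
    ... | no ¬p = ⊥-elim (<-irrefl refl (begin-strict
      (t + ε) * (t + ε)
        ≤⟨ *-mono 0≤t+ε 0≤s (<⇒≤ t+ε<s) (<⇒≤ t+ε<s) ⟩
      s * s
        ≤⟨ s²≤a ⟩
      a
        ≤⟨ a≤b ⟩
      b + ε * h
        ≤⟨ +-monoˡ-≤ (ε * h) (sqrtℚ-upper j b) ⟩
      (t + frac 1 j) * (t + frac 1 j) + ε * h
        ≤⟨ +-monoˡ-≤ (ε * h) (*-mono (0≤+ 0≤t (frac-nonNeg 1 j)) (0≤+ 0≤t (<⇒≤ 0<h))
             (+-monoʳ-≤ t small) (+-monoʳ-≤ t small)) ⟩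
      (t + h) * (t + h) + ε * h
        ≡⟨ cong (λ u → (t + h) * (t + h) + u * h) (sym (½+½ ε)) ⟩
      (t + h) * (t + h) + (h + h) * h
        ≡⟨ solve 2 (λ t h → (t :+ h) :* (t :+ h) :+ (h :+ h) :* h :=
             (t :* t :+ (h :+ h) :* t :+ (h :+ h) :* h :+ h :* h)) refl t h ⟩
      t * t + (h + h) * t + (h + h) * h + h * h
        <⟨ p<p+q (0<* 0<h 0<h) ⟩
      (t * t + (h + h) * t + (h + h) * h + h * h) + h * h
        ≤⟨ p≤p+q (0≤* (0≤+ (<⇒≤ 0<h) (<⇒≤ 0<h)) 0≤t) ⟩
      (t * t + (h + h) * t + (h + h) * h + h * h) + h * h + (h + h) * t
        ≡⟨ solve 2 (λ t h → (t :* t :+ (h :+ h) :* t :+ (h :+ h) :* h :+ h :* h)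
               :+ h :* h :+ (h :+ h) :* t
             := (t :+ (h :+ h)) :* (t :+ (h :+ h))) refl t h ⟩
      (t + (h + h)) * (t + (h + h))
        ≡⟨ cong (λ u → (t + u) * (t + u)) (½+½ ε) ⟩
      (t + ε) * (t + ε) ∎))
      where
      open ≤-Reasoning
      h : ℚ
      h = ½ * ε
      0<h : 0ℚ < h
      0<h = 0<* 0<½ 0<ε
      s t : ℚ
      s = sqrtℚ i a
      t = sqrtℚ j b
      0≤s : 0ℚ ≤ s
      0≤s = sqrtℚ-nonNeg i a
      0≤t : 0ℚ ≤ t
      0≤t = sqrtℚ-nonNeg j b
      0≤t+ε : 0ℚ ≤ t + ε
      0≤t+ε = 0≤+ 0≤t (<⇒≤ 0<ε)
      t+ε<s : t + ε < s
      t+ε<s = ≰⇒> ¬p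
      p<p+q : ∀ {p q} → 0ℚ < q → p < p + q
      p<p+q {p} {q} 0<q = subst (_< p + q) (+-identityʳ p) (+-monoʳ-< p 0<q)
      s²≤a : s * s ≤ a
      s²≤a with sqrtℚ-lower i a
      ... | inj₁ s≡0 = ⊥-elim (<-irrefl (sym s≡0) (≤-<-trans 0≤t+ε t+ε<s))
      ... | inj₂ h = h

  0<1 : 0ℚ < 1ℚ
  0<1 = positive⁻¹ 1ℚ

  sqrt-pos : ∀ (x : ℕ → ℚ) δ → 0ℚ < δ → Eventually (λ i → δ ≤ x i) →
             ∃[ δ′ ] 0ℚ < δ′ × Eventually (λ i → δ′ ≤ sqrtℚ i (x i))
  sqrt-pos x δ 0<δ δ≤x =
    let N , h = both (archimedean (½ * (δ ⊓ 1ℚ)) (0<* 0<½ ⊓-pos)) δ≤x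
    in ½ * (δ ⊓ 1ℚ) , 0<* 0<½ ⊓-pos , N , λ i Ni → step i (proj₁ (h i Ni)) (proj₂ (h i Ni))
    where
    ⊓-pos : 0ℚ < δ ⊓ 1ℚ
    ⊓-pos with ⊓-sel δ 1ℚ
    ... | inj₁ eq = subst (0ℚ <_) (sym eq) 0<δ
    ... | inj₂ eq = subst (0ℚ <_) (sym eq) 0<1
    step : ∀ i → frac 1 i ≤ ½ * (δ ⊓ 1ℚ) → δ ≤ x i → ½ * (δ ⊓ 1ℚ) ≤ sqrtℚ i (x i)
    step i small δ≤ with ½ * (δ ⊓ 1ℚ) ≤? sqrtℚ i (x i)
    ... | yes p = p
    ... | no ¬p = ⊥-elim (<-irrefl refl (begin-strict
      x i
        ≤⟨ sqrtℚ-upper i (x i) ⟩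
      (s + frac 1 i) * (s + frac 1 i)
        ≤⟨ *-mono 0≤s+ 0≤s+ (<⇒≤ s+<μ) ≤-refl ⟩
      μ * (s + frac 1 i)
        <⟨ *-monoʳ-<-pos μ {{positive ⊓-pos}} s+<μ ⟩
      μ * μ
        ≤⟨ *-mono (<⇒≤ ⊓-pos) (<⇒≤ 0<1) (p⊓q≤p δ 1ℚ) (p⊓q≤q δ 1ℚ) ⟩
      δ * 1ℚ
        ≡⟨ *-identityʳ δ ⟩
      δ
        ≤⟨ δ≤ ⟩
      x i ∎))
      where
      open ≤-Reasoning
      μ : ℚ
      μ = δ ⊓ 1ℚ
      s : ℚ
      s = sqrtℚ i (x i)
      0≤s+ : 0ℚ ≤ s + frac 1 i
      0≤s+ = 0≤+ (sqrtℚ-nonNeg i (x i)) (frac-nonNeg 1 i)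
      s+<μ : s + frac 1 i < μ
      s+<μ = subst (s + frac 1 i <_) (½+½ μ) (+-mono-<-≤ (≰⇒> ¬p) small)

  sum< : ℕ → (ℕ → ℚ) → ℚ
  sum< zero    f = 0ℚ
  sum< (suc n) f = sum< n f + f n

  sum<-cong : ∀ n {f g} → (∀ i → f i ≡ g i) → sum< n f ≡ sum< n g
  sum<-cong zero    h = refl
  sum<-cong (suc n) h = cong₂ _+_ (sum<-cong n h) (h n)

  sum<-+ : ∀ m n f → sum< (m ℕ.+ n) f ≡ sum< m f + sum< n (λ i → f (m ℕ.+ i))
  sum<-+ m zero f = trans (cong (λ k → sum< k f) (ℕ.+-identityʳ m)) (sym (+-identityʳ _))
  sum<-+ m (suc n) f = trans (cong (λ k → sum< k f) (ℕ.+-suc m n))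
    (trans (cong (_+ f (m ℕ.+ n)) (sum<-+ m n f))
      (+-assoc (sum< m f) (sum< n (λ i → f (m ℕ.+ i))) (f (m ℕ.+ n))))

  sum<-≥ : ∀ n {f c} → (∀ i → i ℕ.< n → c ≤ f i) → (+ n / 1) * c ≤ sum< n f
  sum<-≥ zero {f} {c} h = ≤-reflexive (*-zeroˡ c)
  sum<-≥ (suc n) {f} {c} h = subst (_≤ sum< n f + f n)
    (trans (trans (cong (_+_ (frac n 0 * c)) (sym (*-identityˡ c))) (sym (*-distribʳ-+ c (frac n 0) 1ℚ)))
       (cong (_* c) (trans (frac-+ n 1 0) (cong (λ k → frac k 0) (ℕ.+-comm n 1)))))
    (+-mono-≤ (sum<-≥ n (λ i i<n → h i (ℕ.m<n⇒m<1+n i<n))) (h n (ℕ.n<1+n n)))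

  sum<-≤ : ∀ n {f c} → (∀ i → i ℕ.< n → f i ≤ c) → sum< n f ≤ (+ n / 1) * c
  sum<-≤ zero {f} {c} h = ≤-reflexive (sym (*-zeroˡ c))
  sum<-≤ (suc n) {f} {c} h = subst (sum< n f + f n ≤_)
    (trans (trans (cong (_+_ (frac n 0 * c)) (sym (*-identityˡ c))) (sym (*-distribʳ-+ c (frac n 0) 1ℚ)))
       (cong (_* c) (trans (frac-+ n 1 0) (cong (λ k → frac k 0) (ℕ.+-comm n 1)))))
    (+-mono-≤ (sum<-≤ n (λ i i<n → h i (ℕ.m<n⇒m<1+n i<n))) (h n (ℕ.n<1+n n)))

  -- The right Riemann sum of ∫₁ᵏ dt/t with mesh 1/N, where N = n+1:
  -- the points are (N+j+1)/N for j < (k-1)N.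
  logSum : ℕ → ℕ → ℚ
  logSum k n = sum< (ℕ.pred k ℕ.* suc n) (λ j → + 1 / (suc n ℕ.+ suc j))

  module _ (p : ℕ) where

    private
      L : ℕ → ℚ
      L n = sum< (p ℕ.* suc n) (λ j → + 1 / (suc n ℕ.+ suc j))

      extra : ℕ → ℚ
      extra n = sum< (suc p) (λ j → frac 1 (suc n ℕ.+ (p ℕ.* suc n ℕ.+ j)))

      term : ∀ n j → + 1 / (suc n ℕ.+ suc j) ≡ frac 1 (suc n ℕ.+ j)
      term n j = cong (frac 1) (ℕ.+-suc n j)

      recurrence : ∀ n → L n + extra n ≡ frac 1 (suc n) + L (suc n)
      recurrence n = begin
        L n + extra n
          ≡⟨ cong (_+ extra n) (sum<-cong (p ℕ.* suc n) (term n)) ⟩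
        sum< (p ℕ.* suc n) f + extra n
          ≡⟨ sym (sum<-+ (p ℕ.* suc n) (suc p) f) ⟩
        sum< (p ℕ.* suc n ℕ.+ suc p) f
          ≡⟨ cong (λ k → sum< k f) (lem p n) ⟩
        sum< (1 ℕ.+ p ℕ.* suc (suc n)) f
          ≡⟨ sum<-+ 1 (p ℕ.* suc (suc n)) f ⟩
        (0ℚ + frac 1 (suc n ℕ.+ 0)) + sum< (p ℕ.* suc (suc n)) (λ j → f (suc j))
          ≡⟨ cong₂ _+_ (trans (+-identityˡ _) (cong (frac 1) (ℕ.+-identityʳ (suc n))))
               refl ⟩
        frac 1 (suc n) + L (suc n) ∎
        where
        open ≡-Reasoning
        f : ℕ → ℚ
        f j = frac 1 (suc n ℕ.+ j)
        lem : ∀ p n → p ℕ.* suc n ℕ.+ suc p ≡ 1 ℕ.+ p ℕ.* suc (suc n)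
        lem = solve-∀

      k/kn : ∀ n → (+ suc p / 1) * frac 1 (n ℕ.+ p ℕ.* suc n) ≡ frac 1 n
      k/kn n = trans (frac-* (suc p) 1 0 K) (frac-≡ {suc p ℕ.* 1} {1} {K ℕ.+ 0} {n} (lem p n))
        where
        K = n ℕ.+ p ℕ.* suc n
        lem : ∀ p n → suc p ℕ.* 1 ℕ.* suc n ≡ 1 ℕ.* suc (n ℕ.+ p ℕ.* suc n ℕ.+ 0)
        lem = solve-∀

      extra-lower : ∀ n → frac 1 (suc n) ≤ extra n
      extra-lower n = subst (_≤ extra n) (k/kn (suc n)) (sum<-≥ (suc p) λ j j<k →
        frac-≤ {1} {1} {suc n ℕ.+ p ℕ.* suc (suc n)} {suc n ℕ.+ (p ℕ.* suc n ℕ.+ j)}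
          (ℕ.*-monoʳ-≤ 1 (s≤s (ℕ.≤-trans
            (ℕ.+-monoʳ-≤ (suc n) (ℕ.+-monoʳ-≤ (p ℕ.* suc n) (ℕ.≤-pred j<k)))
            (ℕ.≤-reflexive (cong (suc n ℕ.+_) (lem p n)))))))
        where
        lem : ∀ p n → p ℕ.* suc n ℕ.+ p ≡ p ℕ.* suc (suc n)
        lem = solve-∀

      extra-upper : ∀ n → extra n ≤ frac 1 n
      extra-upper n = subst (extra n ≤_) (k/kn n) (sum<-≤ (suc p) λ j j<k →
        frac-≤ {1} {1} {suc n ℕ.+ (p ℕ.* suc n ℕ.+ j)} {n ℕ.+ p ℕ.* suc n}
          (ℕ.*-monoʳ-≤ 1 (s≤s (ℕ.+-mono-≤ (ℕ.n≤1+n n) (ℕ.m≤m+n (p ℕ.* suc n) j)))))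

      cancel : ∀ {a b c d} → a + b ≡ c + d → c ≤ b → a ≤ d
      cancel {a} {b} {c} {d} eq c≤b = subst₂ _≤_
        (solve 2 (λ a c → a :+ c :- c := a) refl a c)
        (trans (cong (_- c) eq) (solve 2 (λ c d → c :+ d :- c := d) refl c d))
        (+-monoˡ-≤ (- c) (+-monoʳ-≤ a c≤b))

    logSum-mono : ∀ n → L n ≤ L (suc n)
    logSum-mono n = cancel (recurrence n) (extra-lower n)

    logSum-anti : ∀ n → L (suc n) + frac 1 (suc n) ≤ L n + frac 1 n
    logSum-anti n = ≤-trans (≤-reflexive (trans (+-comm (L (suc n)) _) (sym (recurrence n))))
                            (+-monoʳ-≤ (L n) (extra-upper n))

    private
      mono+ : ∀ n d → L n ≤ L (n ℕ.+ d)
      mono+ n zero = ≤-reflexive (cong L (sym (ℕ.+-identityʳ n)))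
      mono+ n (suc d) = ≤-trans (mono+ n d)
        (≤-trans (logSum-mono (n ℕ.+ d)) (≤-reflexive (cong L (sym (ℕ.+-suc n d)))))

      U : ℕ → ℚ
      U n = L n + frac 1 n

      anti+ : ∀ n d → U (n ℕ.+ d) ≤ U n
      anti+ n zero = ≤-reflexive (cong U (ℕ.+-identityʳ n))
      anti+ n (suc d) = ≤-trans (≤-reflexive (cong U (ℕ.+-suc n d)))
        (≤-trans (logSum-anti (n ℕ.+ d)) (anti+ n d))

      mono : ∀ {m n} → m ℕ.≤ n → L m ≤ L n
      mono {m} {n} h = ≤-trans (mono+ m (n ℕ.∸ m)) (≤-reflexive (cong L (ℕ.m+[n∸m]≡n h)))

      anti : ∀ {m n} → m ℕ.≤ n → U n ≤ U m
      anti {m} {n} h = ≤-trans (≤-reflexive (cong U (sym (ℕ.m+[n∸m]≡n h)))) (anti+ m (n ℕ.∸ m))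

    riemann-cauchy : Cauchy L
    riemann-cauchy = oneSided⇒cauchy L λ ε 0<ε → let N , h = archimedean ε 0<ε in
      N , λ i j Ni Nj → begin
        L i           ≤⟨ p≤p+q (frac-nonNeg 1 i) ⟩
        U i           ≤⟨ anti Ni ⟩
        L N + frac 1 N ≤⟨ +-mono-≤ (mono Nj) (h N ℕ.≤-refl) ⟩
        L j + ε       ∎
      where open ≤-Reasoning

    riemann-lower : .{{ℕ.NonZero p}} → ∀ i → ½ ≤ L i
    riemann-lower i = ≤-trans (first p) (mono {0} {i} z≤n)
      where
      sum<-nonNeg : ∀ n f → (∀ i → 0ℚ ≤ f i) → 0ℚ ≤ sum< n f
      sum<-nonNeg zero    f h = ≤-refl
      sum<-nonNeg (suc n) f h = 0≤+ (sum<-nonNeg n f h) (h n)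
      first : ∀ p → .{{ℕ.NonZero p}} → ½ ≤ sum< (p ℕ.* 1) (λ j → + 1 / (1 ℕ.+ suc j))
      first (suc p) = subst (½ ≤_) (sym (sum<-+ 1 (p ℕ.* 1) g))
        (≤-trans (≤-reflexive (sym (+-identityˡ ½)))
          (p≤p+q {0ℚ + ½} (sum<-nonNeg (p ℕ.* 1) _ (λ i → frac-nonNeg 1 (suc (suc i))))))
        where
        g : ℕ → ℚ
        g j = + 1 / (1 ℕ.+ suc j)

  logSum-cauchy : ∀ k → Cauchy (logSum k)
  logSum-cauchy k = riemann-cauchy (ℕ.pred k)

  -- The alternating sum a 0 - a 1 + a 2 - … of n terms.
  alt : (ℕ → ℚ) → ℕ → ℚ
  alt a zero    = 0ℚ
  alt a (suc n) = a 0 - alt (a ∘ suc) n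

  leibniz : ℕ → ℚ
  leibniz j = + 4 / suc (2 ℕ.* j)

  alt-bounds : ∀ a → (∀ i → 0ℚ ≤ a i) → (∀ i → a (suc i) ≤ a i) →
               ∀ n → 0ℚ ≤ alt a n × alt a n ≤ a 0
  alt-bounds a nonNeg anti zero = ≤-refl , nonNeg 0
  alt-bounds a nonNeg anti (suc n) =
    let lo , hi = alt-bounds (a ∘ suc) (nonNeg ∘ suc) (anti ∘ suc) n
    in subst (_≤ a 0 - alt (a ∘ suc) n) (+-inverseʳ (a 0))
         (+-monoʳ-≤ (a 0) (neg-antimono-≤ (≤-trans hi (anti 0))))
     , subst (a 0 - alt (a ∘ suc) n ≤_) (+-identityʳ (a 0))
         (+-monoʳ-≤ (a 0) (neg-antimono-≤ lo))

  alt-tail : ∀ a → (∀ i → 0ℚ ≤ a i) → (∀ i → a (suc i) ≤ a i) →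
             ∀ N d → ∣ alt a (N ℕ.+ d) - alt a N ∣ ≤ a N
  alt-tail a nonNeg anti zero d =
    let lo , hi = alt-bounds a nonNeg anti d
    in subst (_≤ a 0) (sym (trans (cong ∣_∣ (+-identityʳ (alt a d))) (0≤p⇒∣p∣≡p lo))) hi
  alt-tail a nonNeg anti (suc N) d =
    subst (_≤ a (suc N))
      (trans (sym (∣-p∣≡∣p∣ _)) (cong ∣_∣
        (solve 3 (λ x y z → :- (y :- z) := (x :- y) :- (x :- z)) refl
          (a 0) (alt (a ∘ suc) (N ℕ.+ d)) (alt (a ∘ suc) N))))
      (alt-tail (a ∘ suc) (nonNeg ∘ suc) (anti ∘ suc) N d)

  leibniz-nonNeg : ∀ i → 0ℚ ≤ leibniz i
  leibniz-nonNeg i = frac-nonNeg 4 (2 ℕ.* i)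

  leibniz-anti : ∀ i → leibniz (suc i) ≤ leibniz i
  leibniz-anti i = frac-≤ {4} {4} {2 ℕ.* suc i} {2 ℕ.* i}
    (ℕ.*-monoʳ-≤ 4 (s≤s (ℕ.*-monoʳ-≤ 2 (ℕ.n≤1+n i))))

  leibniz-small : ∀ i → leibniz i ≤ (+ 4 / 1) * frac 1 i
  leibniz-small i = subst (leibniz i ≤_) (sym (frac-* 4 1 0 i))
    (frac-≤ {4} {4} {2 ℕ.* i} {i ℕ.+ 0} (ℕ.*-monoʳ-≤ 4 (s≤s (ℕ.+-monoʳ-≤ i z≤n))))

  leibniz-cauchy : Cauchy (alt leibniz)
  leibniz-cauchy ε 0<ε =
    let η = (+ 1 / 4) * (½ * ε)
        N , h = archimedean η (0<* (positive⁻¹ (+ 1 / 4)) (0<* 0<½ 0<ε))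
        small = λ i (Ni : N ℕ.≤ i) → begin
          ∣ alt leibniz i - alt leibniz N ∣
            ≡⟨ cong (λ k → ∣ alt leibniz k - alt leibniz N ∣) (sym (ℕ.m+[n∸m]≡n Ni)) ⟩
          ∣ alt leibniz (N ℕ.+ (i ℕ.∸ N)) - alt leibniz N ∣
            ≤⟨ alt-tail leibniz leibniz-nonNeg leibniz-anti N (i ℕ.∸ N) ⟩
          leibniz N
            ≤⟨ leibniz-small N ⟩
          (+ 4 / 1) * frac 1 N
            ≤⟨ *-monoˡ-≤-nonNeg (+ 4 / 1) (h N ℕ.≤-refl) ⟩
          (+ 4 / 1) * ((+ 1 / 4) * (½ * ε))
            ≡⟨ sym (*-assoc (+ 4 / 1) (+ 1 / 4) (½ * ε)) ⟩
          1ℚ * (½ * ε)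
            ≡⟨ *-identityˡ (½ * ε) ⟩
          ½ * ε ∎
    in N , λ i j Ni Nj → begin
      ∣ alt leibniz i - alt leibniz j ∣
        ≡⟨ cong ∣_∣ (solve 3 (λ x y z → x :- y := (x :- z) :- (y :- z)) refl
             (alt leibniz i) (alt leibniz j) (alt leibniz N)) ⟩
      ∣ (alt leibniz i - alt leibniz N) - (alt leibniz j - alt leibniz N) ∣
        ≤⟨ ∣p-q∣≤∣p∣+∣q∣ (alt leibniz i - alt leibniz N) (alt leibniz j - alt leibniz N) ⟩
      ∣ alt leibniz i - alt leibniz N ∣ + ∣ alt leibniz j - alt leibniz N ∣
        ≤⟨ +-mono-≤ (small i Ni) (small j Nj) ⟩
      ½ * ε + ½ * ε
        ≡⟨ ½+½ ε ⟩
      ε ∎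
    where open ≤-Reasoning

  leibniz-lower : Eventually (λ n → 1ℚ ≤ alt leibniz n)
  leibniz-lower = 1 , lower
    where
    open ≤-Reasoning
    lower : ∀ n → 1 ℕ.≤ n → 1ℚ ≤ alt leibniz n
    lower (suc n) _ = begin
      1ℚ
        ≤⟨ toWitness {a? = 1ℚ ≤? leibniz 0 - leibniz 1} _ ⟩
      leibniz 0 - leibniz 1
        ≤⟨ +-monoʳ-≤ (leibniz 0) (neg-antimono-≤ (proj₂
             (alt-bounds (leibniz ∘ suc) (leibniz-nonNeg ∘ suc) (leibniz-anti ∘ suc) n))) ⟩
      leibniz 0 - alt (leibniz ∘ suc) n ∎

-- Real numbers are Cauchy sequences of rationals, considered up to _≃_.

record ℝ : Set where
  no-eta-equality
  field
    seq    : ℕ → ℚ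
    cauchy : Cauchy seq

open ℝ public

infix  4 _≃_ _≤_
infixl 6 _+_
infixl 7 _*_ _÷_
infix  8 √_

_≃_ : ℝ → ℝ → Set
x ≃ y = ∀ ε → 0ℚ ℚ.< ε → Eventually (λ i → ℚ.∣ seq x i ℚ.- seq y i ∣ ℚ.≤ ε)

_≤_ : ℝ → ℝ → Set
x ≤ y = ∀ ε → 0ℚ ℚ.< ε → Eventually (λ i → seq x i ℚ.≤ seq y i ℚ.+ ε)

record Positive (x : ℝ) : Set where
  field
    bound     : ℚ
    bound-pos : 0ℚ ℚ.< bound
    bound≤    : Eventually (λ i → bound ℚ.≤ seq x i)

fromℚ : ℚ → ℝ
fromℚ q .seq _  = q
fromℚ q .cauchy = Rational.const-cauchy q

fromℕ : ℕ → ℝ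
fromℕ n = fromℚ (+ n ℚ./ 1)

_+_ : ℝ → ℝ → ℝ
(x + y) .seq i  = seq x i ℚ.+ seq y i
(x + y) .cauchy = Rational.+-cauchy (seq x) (seq y) (cauchy x) (cauchy y)

_*_ : ℝ → ℝ → ℝ
(x * y) .seq i  = seq x i ℚ.* seq y i
(x * y) .cauchy = Rational.*-cauchy (seq x) (seq y) (cauchy x) (cauchy y)

∣_∣ : ℝ → ℝ
∣ x ∣ .seq i  = ℚ.∣ seq x i ∣
∣ x ∣ .cauchy = Rational.∣∣-cauchy (seq x) (cauchy x)

_÷_ : (x y : ℝ) → {{Positive y}} → ℝ
(x ÷ y) .seq i = seq x i ℚ.* Rational.inv (seq y i)
(x ÷ y) {{p}} .cauchy = Rational.*-cauchy (seq x) (Rational.inv ∘ seq y) (cauchy x)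
  (Rational.inv-cauchy (seq y) (cauchy y) (p .bound) (p .bound-pos) (p .bound≤))
  where open Positive

-- √ x is 0 for x ≤ 0.
√_ : ℝ → ℝ
(√ x) .seq i  = Rational.sqrtℚ i (seq x i)
(√ x) .cauchy = Rational.sqrt-cauchy (seq x) (cauchy x)

-- The natural logarithm ∫₁ᵏ dt/t of a positive integer k, as a limit of Riemann sums (ln 0 = 0).
ln : ℕ → ℝ
ln k .seq    = Rational.logSum k
ln k .cauchy = Rational.logSum-cauchy k

-- π = 4/1 - 4/3 + 4/5 - …
π : ℝ
π .seq    = Rational.alt Rational.leibniz
π .cauchy = Rational.leibniz-cauchy

instance
  π-positive : Positive π
  π-positive = record
    { bound = 1ℚ ; bound-pos = Rational.0<1 ; bound≤ = Rational.leibniz-lower }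

  ln-positive : ∀ {n} → .{{NonTrivial n}} → Positive (ln n)
  ln-positive {n} = record
    { bound     = ½
    ; bound-pos = Rational.0<½
    ; bound≤    = 0 , λ i _ → Rational.riemann-lower (ℕ.pred n)
        {{ℕ.>-nonZero (ℕ.<⇒≤pred (ℕ.nonTrivial⇒n>1 n))}} i
    }

  √-positive : ∀ {x} → {{Positive x}} → Positive (√ x)
  √-positive {x} {{p}} =
    let δ , 0<δ , δ≤ = Rational.sqrt-pos (seq x) (p .bound) (p .bound-pos) (p .bound≤)
    in record { bound = δ ; bound-pos = 0<δ ; bound≤ = δ≤ }
    where open Positive

-- Sequences indexed by n ≥ 2, where ln n is positive.
Sequence : Set
Sequence = (n : ℕ) → .{{NonTrivial n}} → ℝ

infix 4 _=O_

_=O_ : Sequence → Sequence → Set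
f =O g = ∃[ C ] ∃[ N ] ∀ n → .{{_ : NonTrivial n}} → N ℕ.≤ n → ∣ f n ∣ ≤ C * ∣ g n ∣

κ : ℕ → ℝ
κ m = √ (ln (4 ℕ.* m) ÷ π)

Ē : ∀ m → .{{ℕ.NonZero m}} → ℕ → ℝ
Ē m n = fromℚ (avgDagEdges m n)

{-# OPTIONS --safe #-}
module Submission where

-- Let N = n+1 be the number of nodes, B k the number of trees with k nodes and G k = (k+1) B k.
-- Grafting a fixed tree with k nodes onto one of the empty positions of a tree with N-k nodes
-- shows that it occurs G (N-k) times in all trees with N nodes together; pairs of occurrences
-- are counted similarly. Choose P with (4m)^P ≤ n < (4m)^(P+1). There are O(B P) trees with
-- fewer than P nodes, and by Bonferroni's inequality almost all occurrences of larger trees are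
-- distinct. Hence, up to a factor 1 + O(1/P), the average number of dag edges is the average
-- number of edges whose source carries a subtree with at least P nodes. This has a closed form,
-- asymptotic to 3nβ, where β is the central binomial coefficient (2P over P) divided by 4^P.
-- Finally πPβ² = 1 + O(1/P) by Wallis, and P = ln n / ln (4m) + O(1). Wallis' formula is derived
-- from the Leibniz series through the partial fractions of Σ (-1)^k (2n over n+k) / (2k+1),
-- in which k ranges from -n to n.

-- The cutoff balances two errors. Counting all trees with fewer than `P` nodes costs about `B P`,
-- and the surplus of occurrences over distinct subtrees among the larger ones costs about n² `B P`
-- / (4m)^(2P) per tree. The main term has order nβ with β = `G P` / (4m)^P. As `G P` = (P+1) `B P`,
-- the relative errors have orders (4m)^P / (nP) and n / ((4m)^P P). Both are O(1/P) as long as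
-- (4m)^P agrees with n up to a constant factor. The order of the reals is not decidable, and an
-- O-bound between them speaks about all late approximants. So the asymptotics are proved as
-- inequalities between natural numbers, with all denominators cleared, and then for the `i`-th
-- rational approximants of both sides. The index from which these hold may depend on n, but the
-- constants may not. Relative errors are two-sided bounds by a factor 1 + k/P, because such bounds
-- can be multiplied and reversed without division; square roots are removed by comparing squares.
-- The sequence ε is the quotient of both sides minus 1, so the equation for Ē is an identity and
-- only the bound on ε has content.

-- Sums over the pairs with i + j = n.

module Antidiagonal where

  open import Data.Nat.Base
  open import Data.Nat.Properties
  open import Data.Nat.Tactic.RingSolver using (solve-∀)
  open import Relation.Binary.PropositionalEquality

  -- Both indices are arguments of the summand, so that convolutions are written without the
  -- truncated subtraction n ∸ i.
  antidiag : (ℕ → ℕ → ℕ) → ℕ → ℕ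
  antidiag g zero    = g 0 0
  antidiag g (suc n) = g 0 (suc n) + antidiag (λ i → g (suc i)) n

  antidiag-cong : ∀ n {g h : ℕ → ℕ → ℕ} → (∀ i j → i + j ≡ n → g i j ≡ h i j) →
                  antidiag g n ≡ antidiag h n
  antidiag-cong zero    e = e 0 0 refl
  antidiag-cong (suc n) e = cong₂ _+_ (e 0 (suc n) refl)
    (antidiag-cong n λ i j i+j≡n → e (suc i) j (cong suc i+j≡n))

  antidiag-mono : ∀ n {g h : ℕ → ℕ → ℕ} → (∀ i j → i + j ≡ n → g i j ≤ h i j) →
                  antidiag g n ≤ antidiag h n
  antidiag-mono zero    e = e 0 0 refl
  antidiag-mono (suc n) e = +-mono-≤ (e 0 (suc n) refl)
    (antidiag-mono n λ i j i+j≡n → e (suc i) j (cong suc i+j≡n))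

  antidiag-+ : ∀ n (g h : ℕ → ℕ → ℕ) →
               antidiag (λ i j → g i j + h i j) n ≡ antidiag g n + antidiag h n
  antidiag-+ zero    g h = refl
  antidiag-+ (suc n) g h = trans (cong (g 0 (suc n) + h 0 (suc n) +_) (antidiag-+ n _ _))
    (interchange (g 0 (suc n)) _ _ _)
    where
    interchange : ∀ a b c d → a + b + (c + d) ≡ (a + c) + (b + d)
    interchange = solve-∀

  antidiag-*ˡ : ∀ n c (g : ℕ → ℕ → ℕ) → antidiag (λ i j → c * g i j) n ≡ c * antidiag g n
  antidiag-*ˡ zero    c g = refl
  antidiag-*ˡ (suc n) c g = trans (cong (c * g 0 (suc n) +_) (antidiag-*ˡ n c _))
    (sym (*-distribˡ-+ c _ _))

  antidiag-last : ∀ n (g : ℕ → ℕ → ℕ) →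
                  antidiag g (suc n) ≡ antidiag (λ i j → g i (suc j)) n + g (suc n) 0
  antidiag-last zero    g = refl
  antidiag-last (suc n) g = trans (cong (g 0 (suc (suc n)) +_) (antidiag-last n (λ i → g (suc i))))
    (sym (+-assoc (g 0 (suc (suc n))) _ _))

  antidiag-swap : ∀ n (g : ℕ → ℕ → ℕ) → antidiag g n ≡ antidiag (λ i j → g j i) n
  antidiag-swap zero    g = refl
  antidiag-swap (suc n) g = trans (antidiag-last n g)
    (trans (cong (_+ g (suc n) 0) (antidiag-swap n (λ i j → g i (suc j)))) (+-comm _ (g (suc n) 0)))

  antidiag-symmetrize : ∀ n (f g : ℕ → ℕ) →
    antidiag (λ i j → f i * g j + g i * f j) n ≡ 2 * antidiag (λ i j → f i * g j) n
  antidiag-symmetrize n f g = trans (antidiag-+ n _ _) (cong (antidiag (λ i j → f i * g j) n +_)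
    (trans (antidiag-swap n (λ i j → g i * f j))
      (trans (antidiag-cong n λ i j _ → *-comm (g j) (f i)) (sym (+-identityʳ _)))))

  antidiag-zero : ∀ n {g : ℕ → ℕ → ℕ} → (∀ i j → i + j ≡ n → g i j ≡ 0) → antidiag g n ≡ 0
  antidiag-zero zero    e = e 0 0 refl
  antidiag-zero (suc n) e = cong₂ _+_ (e 0 (suc n) refl)
    (antidiag-zero n λ i j i+j≡n → e (suc i) j (cong suc i+j≡n))

  antidiag-shift : ∀ p n {g : ℕ → ℕ → ℕ} → (∀ i j → i < p → g i j ≡ 0) →
                   antidiag g (p + n) ≡ antidiag (λ i → g (p + i)) n
  antidiag-shift zero    n e = refl
  antidiag-shift (suc p) n {g} e = cong₂ _+_ (e 0 (suc p + n) z<s)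
    (antidiag-shift p n λ i j i<p → e (suc i) j (s<s i<p))

-- Recurrences, growth and convolutions of the Catalan numbers and central binomial coefficients.

module Catalan where

  open import Data.Nat.Base
  open import Data.Nat.Properties
  open import Data.Nat.Tactic.RingSolver using (solve-∀)
  open import Relation.Binary.PropositionalEquality
  open Antidiagonal

  module Recurrence (m : ℕ) (B : ℕ → ℕ) (B-zero : B 0 ≡ 1)
           (B-suc : ∀ n → B (suc n) ≡ m * antidiag (λ i j → B i * B j) n) where

    -- mⁿ times the central binomial coefficient
    G : ℕ → ℕ
    G n = suc n * B n

    private
      BB GB : ℕ → ℕ
      BB = antidiag (λ i j → B i * B j)
      GB = antidiag (λ i j → G i * B j)

    -- After symmetrization the weight (i+1) + (j+1) is constant on the antidiagonal.
    double-GB : ∀ n → 2 * GB n ≡ (2 + n) * BB n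
    double-GB n = begin
      2 * GB n
        ≡⟨ lem (GB n) ⟩
      GB n + GB n
        ≡⟨ cong (GB n +_) (antidiag-swap n _) ⟩
      GB n + antidiag (λ i j → G j * B i) n
        ≡⟨ sym (antidiag-+ n _ _) ⟩
      antidiag (λ i j → G i * B j + G j * B i) n
        ≡⟨ antidiag-cong n (λ i j e → trans (lem′ i j (B i) (B j)) (cong (λ k → (2 + k) * (B i * B j)) e)) ⟩
      antidiag (λ i j → (2 + n) * (B i * B j)) n
        ≡⟨ antidiag-*ˡ n (2 + n) _ ⟩
      (2 + n) * BB n ∎
      where
      open ≡-Reasoning
      lem : ∀ x → 2 * x ≡ x + x
      lem = solve-∀
      lem′ : ∀ i j x y → suc i * x * y + suc j * y * x ≡ (2 + (i + j)) * (x * y)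
      lem′ = solve-∀

    G-zero : G 0 ≡ 1
    G-zero = trans (+-identityʳ (B 0)) B-zero

    G-suc : ∀ n → G (suc n) ≡ 2 * m * GB n
    G-suc n = begin
      (2 + n) * B (suc n)    ≡⟨ cong ((2 + n) *_) (B-suc n) ⟩
      (2 + n) * (m * BB n)   ≡⟨ lem (2 + n) m (BB n) ⟩
      m * ((2 + n) * BB n)   ≡⟨ cong (m *_) (sym (double-GB n)) ⟩
      m * (2 * GB n)         ≡⟨ lem″ m (GB n) ⟩
      2 * m * GB n ∎
      where
      open ≡-Reasoning
      lem : ∀ a b c → a * (b * c) ≡ b * (a * c)
      lem = solve-∀
      lem″ : ∀ b c → b * (2 * c) ≡ 2 * b * c
      lem″ = solve-∀

    -- In terms of generating functions, G = 1/(1-2mzB) and (1-2mzB)² = 1-4mz,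
    -- hence (1-4mz)G = 1-2mzB.
    private
      linear : ∀ k n → n ≤ k → G (suc n) + 2 * m * B n ≡ 4 * m * G n
      linear k zero _ = begin
        2 * B 1 + 2 * m * B 0
          ≡⟨ cong₂ (λ x y → 2 * x + 2 * m * y) (B-suc 0) B-zero ⟩
        2 * (m * (B 0 * B 0)) + 2 * m * 1
          ≡⟨ cong (λ y → 2 * (m * (y * y)) + 2 * m * 1) B-zero ⟩
        2 * (m * 1) + 2 * m * 1
          ≡⟨ lem m ⟩
        4 * m * 1
          ≡⟨ cong (4 * m *_) (sym G-zero) ⟩
        4 * m * G 0 ∎
        where
        open ≡-Reasoning
        lem : ∀ m → 2 * (m * 1) + 2 * m * 1 ≡ 4 * m * 1
        lem = solve-∀
      -- Adding 4m² `BB n` to both sides replaces a subtraction: it supplies the terms 2m `B i` that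
      -- the induction hypothesis needs under the sum. All i ≤ n occur there, hence the bound `k`.
      linear (suc k) (suc n) (s≤s n≤k) = +-cancelʳ-≡ (4 * (m * m) * BB n) _ _ (begin
        G (2 + n) + 2 * m * B (suc n) + 4 * (m * m) * BB n
          ≡⟨ cong (λ x → x + 2 * m * B (suc n) + 4 * (m * m) * BB n) (G-suc (suc n)) ⟩
        2 * m * (G 0 * B (suc n) + antidiag (λ i j → G (suc i) * B j) n) + 2 * m * B (suc n) + 4 * (m * m) * BB n
          ≡⟨ cong (λ x → 2 * m * (x * B (suc n) + antidiag (λ i j → G (suc i) * B j) n) + 2 * m * B (suc n)
                + 4 * (m * m) * BB n) G-zero ⟩
        2 * m * (1 * B (suc n) + antidiag (λ i j → G (suc i) * B j) n) + 2 * m * B (suc n) + 4 * (m * m) * BB n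
          ≡⟨ lem₁ m (B (suc n)) (antidiag (λ i j → G (suc i) * B j) n) (BB n) ⟩
        4 * m * B (suc n) + 2 * m * (antidiag (λ i j → G (suc i) * B j) n + 2 * m * BB n)
          ≡⟨ cong (λ x → 4 * m * B (suc n) + 2 * m * x) sums ⟩
        4 * m * B (suc n) + 2 * m * (4 * m * GB n)
          ≡⟨ cong₂ _+_ (cong (4 * m *_) (B-suc n)) refl ⟩
        4 * m * (m * BB n) + 2 * m * (4 * m * GB n)
          ≡⟨ lem₂ m (BB n) (GB n) ⟩
        4 * m * (2 * m * GB n) + 4 * (m * m) * BB n
          ≡⟨ cong (λ x → 4 * m * x + 4 * (m * m) * BB n) (sym (G-suc n)) ⟩
        4 * m * G (suc n) + 4 * (m * m) * BB n ∎)
        where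
        open ≡-Reasoning
        lem₁ : ∀ m b s t → 2 * m * (1 * b + s) + 2 * m * b + 4 * (m * m) * t
             ≡ 4 * m * b + 2 * m * (s + 2 * m * t)
        lem₁ = solve-∀
        lem₂ : ∀ m t s → 4 * m * (m * t) + 2 * m * (4 * m * s) ≡ 4 * m * (2 * m * s) + 4 * (m * m) * t
        lem₂ = solve-∀
        lem₃ : ∀ g m b c → g * c + 2 * m * (b * c) ≡ (g + 2 * m * b) * c
        lem₃ = solve-∀
        sums : antidiag (λ i j → G (suc i) * B j) n + 2 * m * BB n ≡ 4 * m * GB n
        sums = begin
          antidiag (λ i j → G (suc i) * B j) n + 2 * m * BB n
            ≡⟨ cong (antidiag (λ i j → G (suc i) * B j) n +_) (sym (antidiag-*ˡ n (2 * m) _)) ⟩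
          antidiag (λ i j → G (suc i) * B j) n + antidiag (λ i j → 2 * m * (B i * B j)) n
            ≡⟨ sym (antidiag-+ n _ _) ⟩
          antidiag (λ i j → G (suc i) * B j + 2 * m * (B i * B j)) n
            ≡⟨ antidiag-cong n (λ i j e → trans (lem₃ (G (suc i)) m (B i) (B j))
                 (trans (cong (_* B j) (linear k i (≤-trans (m+n≤o⇒m≤o i (≤-reflexive e)) n≤k)))
                   (*-assoc (4 * m) (G i) (B j)))) ⟩
          antidiag (λ i j → 4 * m * (G i * B j)) n
            ≡⟨ antidiag-*ˡ n (4 * m) _ ⟩
          4 * m * GB n ∎

    -- As `G n` is a multiple of `B n`, the linear relation collapses to the first-order recurrence
    -- of the Catalan numbers.
    G-step : ∀ n → G (suc n) ≡ m * (4 * n + 2) * B n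
    G-step n = +-cancelʳ-≡ (2 * m * B n) _ _ (trans (linear n n ≤-refl) (lem m n (B n)))
      where
      lem : ∀ m n b → 4 * m * (suc n * b) ≡ m * (4 * n + 2) * b + 2 * m * b
      lem = solve-∀

    G-ratio : ∀ n → suc n * G (suc n) ≡ m * (4 * n + 2) * G n
    G-ratio n = trans (cong (suc n *_) (G-step n)) (lem (suc n) (m * (4 * n + 2)) (B n))
      where
      lem : ∀ a b c → a * (b * c) ≡ b * (a * c)
      lem = solve-∀

    G-grows : ∀ n → G (suc n) ≤ 4 * m * G n
    G-grows n = *-cancelˡ-≤ (suc n) (begin
      suc n * G (suc n)             ≡⟨ G-ratio n ⟩
      m * (4 * n + 2) * G n         ≤⟨ m≤m+n _ (2 * m * G n) ⟩
      m * (4 * n + 2) * G n + 2 * m * G n ≡⟨ lem m n (G n) ⟩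
      suc n * (4 * m * G n) ∎)
      where
      open ≤-Reasoning
      lem : ∀ m n g → m * (4 * n + 2) * g + 2 * m * g ≡ suc n * (4 * m * g)
      lem = solve-∀

    private
      iterate-≤ : (f : ℕ → ℕ) → (∀ n → 4 * m * f n ≤ f (suc n)) → ∀ k n → (4 * m) ^ k * f n ≤ f (k + n)
      iterate-≤ f h zero    n = ≤-reflexive (+-identityʳ (f n))
      iterate-≤ f h (suc k) n = begin
        4 * m * (4 * m) ^ k * f n   ≡⟨ *-assoc (4 * m) _ _ ⟩
        4 * m * ((4 * m) ^ k * f n) ≤⟨ *-monoʳ-≤ (4 * m) (iterate-≤ f h k n) ⟩
        4 * m * f (k + n)           ≤⟨ h (k + n) ⟩
        f (suc k + n) ∎
        where open ≤-Reasoning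

    -- `G n` has order (4m)^n / √n. Hence `G` grows by a factor of at most 4m per step, whereas
    -- (2n+1) `G n` and n `G n` grow by at least 4m; these bounds take the place of Stirling's
    -- formula.
    G-≤ : ∀ k n → G (k + n) ≤ (4 * m) ^ k * G n
    G-≤ zero    n = ≤-reflexive (sym (+-identityʳ (G n)))
    G-≤ (suc k) n = begin
      G (suc k + n)               ≤⟨ G-grows (k + n) ⟩
      4 * m * G (k + n)           ≤⟨ *-monoʳ-≤ (4 * m) (G-≤ k n) ⟩
      4 * m * ((4 * m) ^ k * G n) ≡⟨ sym (*-assoc (4 * m) _ _) ⟩
      (4 * m) ^ suc k * G n ∎
      where open ≤-Reasoning

    [2n+1]G-≥ : ∀ k n → (4 * m) ^ k * ((2 * n + 1) * G n) ≤ (2 * (k + n) + 1) * G (k + n)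
    [2n+1]G-≥ = iterate-≤ (λ n → (2 * n + 1) * G n) λ n → *-cancelˡ-≤ (suc n) (begin
      suc n * (4 * m * ((2 * n + 1) * G n))
        ≤⟨ m≤m+n _ _ ⟩
      suc n * (4 * m * ((2 * n + 1) * G n)) + 2 * m * (2 * n + 1) * G n
        ≡⟨ lem m n (G n) ⟩
      (2 * suc n + 1) * (m * (4 * n + 2) * G n)
        ≡⟨ cong ((2 * suc n + 1) *_) (sym (G-ratio n)) ⟩
      (2 * suc n + 1) * (suc n * G (suc n))
        ≡⟨ lem′ (2 * suc n + 1) (suc n) (G (suc n)) ⟩
      suc n * ((2 * suc n + 1) * G (suc n)) ∎)
      where
      open ≤-Reasoning
      lem : ∀ m n g → suc n * (4 * m * ((2 * n + 1) * g)) + 2 * m * (2 * n + 1) * g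
          ≡ (2 * suc n + 1) * (m * (4 * n + 2) * g)
      lem = solve-∀
      lem′ : ∀ a b c → a * (b * c) ≡ b * (a * c)
      lem′ = solve-∀

    nG-≥ : ∀ k n → (4 * m) ^ k * (n * G n) ≤ (k + n) * G (k + n)
    nG-≥ = iterate-≤ (λ n → n * G n) λ n → begin
      4 * m * (n * G n)                   ≤⟨ m≤m+n _ (2 * m * G n) ⟩
      4 * m * (n * G n) + 2 * m * G n     ≡⟨ lem m n (G n) ⟩
      m * (4 * n + 2) * G n               ≡⟨ sym (G-ratio n) ⟩
      suc n * G (suc n) ∎
      where
      open ≤-Reasoning
      lem : ∀ m n g → 4 * m * (n * g) + 2 * m * g ≡ m * (4 * n + 2) * g
      lem = solve-∀

    K : ℕ → ℕ → ℕ
    K p = antidiag (λ i j → B (p + i) * G j)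

    -- The convolution of B and G is Gosper summable: even its tails have a closed form.
    K-closed : ∀ p n → suc (p + n) * K p n ≡ (2 * n + 1) * (G n * G p)
    K-closed p zero = trans (cong₂ (λ x y → suc x * (B x * y)) (+-identityʳ p) G-zero)
      (trans (lem (suc p) (B p)) (cong (λ y → 1 * (y * G p)) (sym G-zero)))
      where
      lem : ∀ a b → a * (b * 1) ≡ 1 * (1 * (a * b))
      lem = solve-∀
    -- Splitting off the summand i = 0 leaves the tail that starts at `suc p`, so the induction is
    -- on n with p varying.
    K-closed p (suc n) = *-cancelˡ-≡ _ _ (suc p) (begin
      suc p * (suc (p + suc n) * (B (p + 0) * G (suc n) + antidiag (λ i j → B (p + suc i) * G j) n))
        ≡⟨ cong₂ (λ x y → suc p * (suc (p + suc n) * (B x * G (suc n) + y))) (+-identityʳ p)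
             (antidiag-cong n λ i j _ → cong (λ x → B x * G j) (+-suc p i)) ⟩
      suc p * (suc (p + suc n) * (B p * G (suc n) + K (suc p) n))
        ≡⟨ cong (λ x → suc p * (suc x * (B p * G (suc n) + K (suc p) n))) (+-suc p n) ⟩
      suc p * (suc (suc p + n) * (B p * G (suc n) + K (suc p) n))
        ≡⟨ lem₁ p n (B p) (G (suc n)) (K (suc p) n) ⟩
      suc (suc p + n) * (G p * G (suc n)) + suc p * (suc (suc p + n) * K (suc p) n)
        ≡⟨ cong (λ x → suc (suc p + n) * (G p * G (suc n)) + suc p * x) (K-closed (suc p) n) ⟩
      suc (suc p + n) * (G p * G (suc n)) + suc p * ((2 * n + 1) * (G n * G (suc p)))
        ≡⟨ cong (suc (suc p + n) * (G p * G (suc n)) +_) exchange ⟩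
      suc (suc p + n) * (G p * G (suc n)) + (2 * p + 1) * (G p * (suc n * G (suc n)))
        ≡⟨ lem₂ p n (G p) (G (suc n)) ⟩
      suc p * ((2 * suc n + 1) * (G (suc n) * G p)) ∎)
      where
      open ≡-Reasoning
      lem₁ : ∀ p n b g k → suc p * (suc (suc p + n) * (b * g + k))
           ≡ suc (suc p + n) * (suc p * b * g) + suc p * (suc (suc p + n) * k)
      lem₁ = solve-∀
      lem₂ : ∀ p n x y → suc (suc p + n) * (x * y) + (2 * p + 1) * (x * (suc n * y))
           ≡ suc p * ((2 * suc n + 1) * (y * x))
      lem₂ = solve-∀
      lem₃ : ∀ a b x y → a * (b * (x * y)) ≡ b * (x * (a * y))
      lem₃ = solve-∀
      lem₄ : ∀ m p n x y → (2 * n + 1) * (x * (m * (4 * p + 2) * y)) ≡ (2 * p + 1) * (y * (m * (4 * n + 2) * x))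
      lem₄ = solve-∀
      -- `G-ratio` at p and at n, joined by (2n+1)(4p+2) = (2p+1)(4n+2).
      exchange : suc p * ((2 * n + 1) * (G n * G (suc p))) ≡ (2 * p + 1) * (G p * (suc n * G (suc n)))
      exchange = begin
        suc p * ((2 * n + 1) * (G n * G (suc p)))   ≡⟨ lem₃ (suc p) (2 * n + 1) (G n) (G (suc p)) ⟩
        (2 * n + 1) * (G n * (suc p * G (suc p)))   ≡⟨ cong (λ x → (2 * n + 1) * (G n * x)) (G-ratio p) ⟩
        (2 * n + 1) * (G n * (m * (4 * p + 2) * G p)) ≡⟨ lem₄ m p n (G n) (G p) ⟩
        (2 * p + 1) * (G p * (m * (4 * n + 2) * G n)) ≡⟨ cong (λ x → (2 * p + 1) * (G p * x)) (sym (G-ratio n)) ⟩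
        (2 * p + 1) * (G p * (suc n * G (suc n))) ∎

    -- The recurrence `Q-suc` for pairs of occurrences, with the solution n `G n` inserted. It holds
    -- because i(i+1) + j(j+1) + 2(i+1)(j+1) depends on i + j only.
    G-square : ∀ n → 2 * m * (antidiag (λ i j → i * G i * B j) n + antidiag (λ i j → G i * G j) n)
                     ≡ suc n * G (suc n)
    G-square n = begin
      2 * m * (S₁ + S₂)
        ≡⟨ lem m S₁ S₂ ⟩
      m * (S₁ + S₁ + 2 * S₂)
        ≡⟨ cong (λ x → m * (S₁ + x + 2 * S₂)) (antidiag-swap n _) ⟩
      m * (S₁ + antidiag (λ i j → j * G j * B i) n + 2 * S₂)
        ≡⟨ cong (m *_) (sym (trans (antidiag-+ n _ _) (cong₂ _+_ (antidiag-+ n _ _) (antidiag-*ˡ n 2 _)))) ⟩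
      m * antidiag (λ i j → i * G i * B j + j * G j * B i + 2 * (G i * G j)) n
        ≡⟨ cong (m *_) (antidiag-cong n λ i j e →
             trans (lem′ i j (B i) (B j)) (cong (λ k → suc k * (2 + k) * (B i * B j)) e)) ⟩
      m * antidiag (λ i j → suc n * (2 + n) * (B i * B j)) n
        ≡⟨ cong (m *_) (antidiag-*ˡ n (suc n * (2 + n)) _) ⟩
      m * (suc n * (2 + n) * BB n)
        ≡⟨ lem″ m (suc n) (2 + n) (BB n) ⟩
      suc n * ((2 + n) * (m * BB n))
        ≡⟨ cong (λ x → suc n * ((2 + n) * x)) (sym (B-suc n)) ⟩
      suc n * G (suc n) ∎
      where
      open ≡-Reasoning
      S₁ S₂ : ℕ
      S₁ = antidiag (λ i j → i * G i * B j) n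
      S₂ = antidiag (λ i j → G i * G j) n
      lem : ∀ m x y → 2 * m * (x + y) ≡ m * (x + x + 2 * y)
      lem = solve-∀
      lem′ : ∀ i j x y → i * (suc i * x) * y + j * (suc j * y) * x + 2 * (suc i * x * (suc j * y))
           ≡ suc (i + j) * (2 + (i + j)) * (x * y)
      lem′ = solve-∀
      lem″ : ∀ m a b x → m * (a * b * x) ≡ a * (b * (m * x))
      lem″ = solve-∀

-- Finite sums over lists.

module ListSum where

  open import Data.Empty using (⊥-elim)
  open import Data.List.Base
    using (List; []; _∷_; _++_; map; concatMap; length; upTo; applyUpTo; cartesianProductWith)
  open import Data.List.Membership.Propositional using (_∈_)
  open import Data.List.Properties using (map-++; map-∘; map-upTo)
  open import Data.List.Relation.Unary.All as All using (All)
  open import Data.List.Relation.Unary.AllPairs using (_∷_)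
  open import Data.List.Relation.Unary.Any using (here; there)
  open import Data.List.Relation.Unary.Unique.Propositional using (Unique)
  open import Data.Nat.Base
  open import Data.Nat.ListAction using (sum)
  open import Data.Nat.ListAction.Properties using (sum-++)
  open import Data.Nat.Properties
  open import Data.Nat.Tactic.RingSolver using (solve-∀)
  open import Function.Base using (_∘_)
  open import Relation.Binary.Definitions using (DecidableEquality)
  open import Relation.Binary.PropositionalEquality
  open import Relation.Nullary using (¬_; Dec; yes; no)
  open Antidiagonal

  private variable
    A C D : Set

  ∑ : List A → (A → ℕ) → ℕ
  ∑ xs f = sum (map f xs)

  ∑-++ : ∀ (xs ys : List A) f → ∑ (xs ++ ys) f ≡ ∑ xs f + ∑ ys f
  ∑-++ xs ys f = trans (cong sum (map-++ f xs ys)) (sum-++ (map f xs) (map f ys))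

  ∑-map : ∀ (g : C → A) xs f → ∑ (map g xs) f ≡ ∑ xs (f ∘ g)
  ∑-map g xs f = cong sum (sym (map-∘ xs))

  ∑-concatMap : ∀ (g : C → List A) xs f → ∑ (concatMap g xs) f ≡ ∑ xs (λ x → ∑ (g x) f)
  ∑-concatMap g []       f = refl
  ∑-concatMap g (x ∷ xs) f =
    trans (∑-++ (g x) (concatMap g xs) f) (cong (∑ (g x) f +_) (∑-concatMap g xs f))

  ∑-cartesianProductWith : ∀ (g : C → D → A) xs ys f →
    ∑ (cartesianProductWith g xs ys) f ≡ ∑ xs (λ x → ∑ ys (λ y → f (g x y)))
  ∑-cartesianProductWith g []       ys f = refl
  ∑-cartesianProductWith g (x ∷ xs) ys f = trans (∑-++ (map (g x) ys) _ f)
    (cong₂ _+_ (∑-map (g x) ys f) (∑-cartesianProductWith g xs ys f))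

  ∑-cong-∈ : ∀ (xs : List A) {f g} → (∀ {x} → x ∈ xs → f x ≡ g x) → ∑ xs f ≡ ∑ xs g
  ∑-cong-∈ []       e = refl
  ∑-cong-∈ (x ∷ xs) e = cong₂ _+_ (e (here refl)) (∑-cong-∈ xs (e ∘ there))

  ∑-cong : ∀ (xs : List A) {f g} → (∀ x → f x ≡ g x) → ∑ xs f ≡ ∑ xs g
  ∑-cong xs e = ∑-cong-∈ xs (λ {x} _ → e x)

  ∑-mono-∈ : ∀ (xs : List A) {f g} → (∀ {x} → x ∈ xs → f x ≤ g x) → ∑ xs f ≤ ∑ xs g
  ∑-mono-∈ []       e = ≤-refl
  ∑-mono-∈ (x ∷ xs) e = +-mono-≤ (e (here refl)) (∑-mono-∈ xs (e ∘ there))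

  ∑-mono : ∀ (xs : List A) {f g} → (∀ x → f x ≤ g x) → ∑ xs f ≤ ∑ xs g
  ∑-mono xs e = ∑-mono-∈ xs (λ {x} _ → e x)

  ∑-+ : ∀ (xs : List A) f g → ∑ xs (λ x → f x + g x) ≡ ∑ xs f + ∑ xs g
  ∑-+ []       f g = refl
  ∑-+ (x ∷ xs) f g = trans (cong (f x + g x +_) (∑-+ xs f g)) (interchange (f x) (g x) _ _)
    where
    interchange : ∀ a b c d → a + b + (c + d) ≡ (a + c) + (b + d)
    interchange = solve-∀

  ∑-*ˡ : ∀ (xs : List A) c f → ∑ xs (λ x → c * f x) ≡ c * ∑ xs f
  ∑-*ˡ []       c f = sym (*-zeroʳ c)
  ∑-*ˡ (x ∷ xs) c f = trans (cong (c * f x +_) (∑-*ˡ xs c f)) (sym (*-distribˡ-+ c _ _))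

  ∑-*ʳ : ∀ (xs : List A) c f → ∑ xs (λ x → f x * c) ≡ ∑ xs f * c
  ∑-*ʳ xs c f = trans (∑-cong xs (λ x → *-comm (f x) c)) (trans (∑-*ˡ xs c f) (*-comm c _))

  ∑-const : ∀ (xs : List A) c → ∑ xs (λ _ → c) ≡ length xs * c
  ∑-const []       c = refl
  ∑-const (x ∷ xs) c = cong (c +_) (∑-const xs c)

  ∑-zero-∈ : ∀ (xs : List A) {f} → (∀ {x} → x ∈ xs → f x ≡ 0) → ∑ xs f ≡ 0
  ∑-zero-∈ xs e = trans (∑-cong-∈ xs e) (trans (∑-const xs 0) (*-zeroʳ (length xs)))

  ∑-swap : ∀ (xs : List A) (ys : List C) (f : A → C → ℕ) →
           ∑ xs (λ x → ∑ ys (f x)) ≡ ∑ ys (λ y → ∑ xs (λ x → f x y))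
  ∑-swap []       ys f = sym (∑-zero-∈ ys (λ _ → refl))
  ∑-swap (x ∷ xs) ys f = trans (cong (∑ ys (f x) +_) (∑-swap xs ys f))
    (sym (∑-+ ys (f x) (λ y → ∑ xs (λ x → f x y))))

  ∑-upTo : ∀ n f → ∑ (upTo n) f ≡ sum (applyUpTo f n)
  ∑-upTo n f = cong sum (map-upTo f n)

  ∑-upTo-∷ : ∀ n f → ∑ (upTo (suc n)) f ≡ f 0 + ∑ (upTo n) (f ∘ suc)
  ∑-upTo-∷ n f = trans (∑-upTo (suc n) f) (cong (f 0 +_) (sym (∑-upTo n (f ∘ suc))))

  ∑-upTo-+ : ∀ m n f → ∑ (upTo (m + n)) f ≡ ∑ (upTo m) f + ∑ (upTo n) (f ∘ (m +_))
  ∑-upTo-+ zero    n f = refl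
  ∑-upTo-+ (suc m) n f = begin
    ∑ (upTo (suc m + n)) f
      ≡⟨ ∑-upTo-∷ (m + n) f ⟩
    f 0 + ∑ (upTo (m + n)) (f ∘ suc)
      ≡⟨ cong (f 0 +_) (∑-upTo-+ m n (f ∘ suc)) ⟩
    f 0 + (∑ (upTo m) (f ∘ suc) + ∑ (upTo n) (f ∘ (suc m +_)))
      ≡⟨ sym (+-assoc (f 0) _ _) ⟩
    f 0 + ∑ (upTo m) (f ∘ suc) + ∑ (upTo n) (f ∘ (suc m +_))
      ≡⟨ cong (_+ ∑ (upTo n) (f ∘ (suc m +_))) (sym (∑-upTo-∷ m f)) ⟩
    ∑ (upTo (suc m)) f + ∑ (upTo n) (f ∘ (suc m +_)) ∎
    where open ≡-Reasoning

  ∑-antidiag : ∀ n (g : ℕ → ℕ → ℕ) → ∑ (upTo (suc n)) (λ i → g i (n ∸ i)) ≡ antidiag g n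
  ∑-antidiag n g = trans (∑-upTo (suc n) (λ i → g i (n ∸ i))) (go n g)
    where
    go : ∀ n g → sum (applyUpTo (λ i → g i (n ∸ i)) (suc n)) ≡ antidiag g n
    go zero    g = +-identityʳ (g 0 0)
    go (suc n) g = cong (g 0 (suc n) +_) (go n (λ i → g (suc i)))

  -- The sequence 2 a (i+1) satisfies the same hypothesis, so that the sum without its first term is
  -- at most c by induction.
  ∑-geometric : ∀ k (a : ℕ → ℕ) c → (∀ i → i < k → 2 ^ i * a i ≤ c) → ∑ (upTo k) a ≤ 2 * c
  ∑-geometric zero    a c h = z≤n
  ∑-geometric (suc k) a c h = begin
    ∑ (upTo (suc k)) a             ≡⟨ ∑-upTo-∷ k a ⟩
    a 0 + ∑ (upTo k) (a ∘ suc)     ≤⟨ +-mono-≤ (≤-trans (m≤m+n (a 0) 0) (h 0 z<s)) tail ⟩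
    c + c                          ≡⟨ cong (c +_) (sym (+-identityʳ c)) ⟩
    2 * c ∎
    where
    open ≤-Reasoning
    lem : ∀ b x → b * (2 * x) ≡ 2 * b * x
    lem = solve-∀
    tail : ∑ (upTo k) (a ∘ suc) ≤ c
    tail = *-cancelˡ-≤ 2 (≤-trans (≤-reflexive (sym (∑-*ˡ (upTo k) 2 (a ∘ suc))))
      (∑-geometric k (λ i → 2 * a (suc i)) c λ i i<k →
        ≤-trans (≤-reflexive (lem (2 ^ i) (a (suc i)))) (h (suc i) (s<s i<k))))

  ⟦_⟧ : ∀ {P : Set} → Dec P → ℕ
  ⟦ yes _ ⟧ = 1
  ⟦ no  _ ⟧ = 0

  ⟦⟧-yes : ∀ {P : Set} (d : Dec P) → P → ⟦ d ⟧ ≡ 1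
  ⟦⟧-yes (yes _) _ = refl
  ⟦⟧-yes (no ¬p) p = ⊥-elim (¬p p)

  ⟦⟧-no : ∀ {P : Set} (d : Dec P) → ¬ P → ⟦ d ⟧ ≡ 0
  ⟦⟧-no (yes p) ¬p = ⊥-elim (¬p p)
  ⟦⟧-no (no _)  _  = refl

  module _ {A : Set} (_≟_ : DecidableEquality A) where

    ∑-select : ∀ {xs} → Unique xs → ∀ {v} → v ∈ xs → ∀ (f : A → ℕ) → ∑ xs (λ u → f u * ⟦ v ≟ u ⟧) ≡ f v
    ∑-select {x ∷ xs} (x∉ ∷ _) {v} (here refl) f = trans
      (cong₂ _+_ (trans (cong (f v *_) (⟦⟧-yes (v ≟ v) refl)) (*-identityʳ (f v)))
        (∑-zero-∈ xs λ {u} u∈ →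
          trans (cong (f u *_) (⟦⟧-no (v ≟ u) (All.lookup x∉ u∈))) (*-zeroʳ (f u))))
      (+-identityʳ (f v))
    ∑-select {x ∷ xs} (x∉ ∷ uniq) {v} (there v∈) f = cong₂ _+_
      (trans (cong (f x *_) (⟦⟧-no (v ≟ x) (λ where refl → All.lookup x∉ v∈ refl))) (*-zeroʳ (f x)))
      (∑-select uniq v∈ f)

    ∑-select-∉ : ∀ {xs v} → ¬ v ∈ xs → ∀ (f : A → ℕ) → ∑ xs (λ u → f u * ⟦ v ≟ u ⟧) ≡ 0
    ∑-select-∉ {xs} {v} v∉ f = ∑-zero-∈ xs λ {u} u∈ →
      trans (cong (f u *_) (⟦⟧-no (v ≟ u) (λ where refl → v∉ u∈))) (*-zeroʳ (f u))

-- Sums over all trees with a given number of nodes.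

module TreeSum where

  open import Data.List.Base
    using (List; []; _∷_; map; concatMap; length; upTo; allFin; cartesianProduct; cartesianProductWith)
  open import Data.List.Properties using (length-tabulate)
  open import Data.Maybe.Base using (Maybe; just)
  open import Data.Nat.Base
  open import Data.Nat.Properties
  open import Data.Product.Base using (_,_)
  open import Function.Base using (_∘_; id)
  open import Relation.Binary.PropositionalEquality
  open import Defs using (Tree; node; join; treesOfHeight≤; treesOfHeight≤?; treesSplit; trees)
  open Antidiagonal
  open ListSum

  module _ (m : ℕ) where

    -- The number of nodes, rather than edges, is the index from here on: it is additive.
    ∑T : ℕ → (Maybe (Tree m) → ℕ) → ℕ
    ∑T n f = ∑ (treesOfHeight≤? m n n) f

    ∑-height-suc : ∀ h n f → ∑ (treesOfHeight≤? m (suc h) (suc n)) f ≡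
      antidiag (λ i j → ∑ (allFin m) λ a → ∑ (treesOfHeight≤? m h i) λ l →
        ∑ (treesOfHeight≤? m h j) λ r → f (just (node a l r))) n
    ∑-height-suc h n f = begin
      ∑ (map just (treesOfHeight≤ m h n)) f
        ≡⟨ ∑-map just (treesOfHeight≤ m h n) f ⟩
      ∑ (concatMap split (upTo (suc n))) (f ∘ just)
        ≡⟨ ∑-concatMap split (upTo (suc n)) (f ∘ just) ⟩
      ∑ (upTo (suc n)) (λ i → ∑ (treesSplit m h i (n ∸ i)) (f ∘ just))
        ≡⟨ ∑-antidiag n (λ i j → ∑ (treesSplit m h i j) (f ∘ just)) ⟩
      antidiag (λ i j → ∑ (treesSplit m h i j) (f ∘ just)) n
        ≡⟨ antidiag-cong n (λ i j _ → trans
             (∑-cartesianProductWith join (allFin m)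
               (cartesianProduct (treesOfHeight≤? m h i) (treesOfHeight≤? m h j)) (f ∘ just))
             (∑-cong (allFin m) λ a →
               ∑-cartesianProductWith _,_ (treesOfHeight≤? m h i) (treesOfHeight≤? m h j)
                 (λ lr → f (just (join a lr))))) ⟩
      antidiag (λ i j → ∑ (allFin m) λ a → ∑ (treesOfHeight≤? m h i) λ l →
        ∑ (treesOfHeight≤? m h j) λ r → f (just (node a l r))) n ∎
      where
      open ≡-Reasoning
      split : ℕ → List (Tree m)
      split i = treesSplit m h i (n ∸ i)

    -- The enumeration lists subtrees under the height bound inherited from the root instead of
    -- their own. Removing this mismatch makes `∑T` recursive.
    ∑-height : ∀ h h′ n f → n ≤ h → n ≤ h′ → ∑ (treesOfHeight≤? m h n) f ≡ ∑ (treesOfHeight≤? m h′ n) f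
    ∑-height h       h′       zero    f _         _          = refl
    ∑-height (suc h) (suc h′) (suc n) f (s≤s n≤h) (s≤s n≤h′) = begin
      ∑ (treesOfHeight≤? m (suc h) (suc n)) f
        ≡⟨ ∑-height-suc h n f ⟩
      _
        ≡⟨ antidiag-cong n (λ i j i+j≡n →
             let i≤n = m+n≤o⇒m≤o i (≤-reflexive i+j≡n)
                 j≤n = m+n≤o⇒n≤o i (≤-reflexive i+j≡n)
             in ∑-cong (allFin m) λ a → trans
                  (∑-cong (treesOfHeight≤? m h i) λ l →
                    ∑-height h h′ j (λ r → f (just (node a l r))) (≤-trans j≤n n≤h) (≤-trans j≤n n≤h′))
                  (∑-height h h′ i (λ l → ∑ (treesOfHeight≤? m h′ j) λ r → f (just (node a l r)))
                    (≤-trans i≤n n≤h) (≤-trans i≤n n≤h′))) ⟩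
      _
        ≡⟨ sym (∑-height-suc h′ n f) ⟩
      ∑ (treesOfHeight≤? m (suc h′) (suc n)) f ∎
      where open ≡-Reasoning

    -- The summand must ignore the root label, whose choice then contributes the factor `m`.
    ∑T-suc : ∀ n (f : Maybe (Tree m) → ℕ) (φ : Maybe (Tree m) → Maybe (Tree m) → ℕ) →
      (∀ a l r → f (just (node a l r)) ≡ φ l r) →
      ∑T (suc n) f ≡ m * antidiag (λ i j → ∑T i λ l → ∑T j λ r → φ l r) n
    ∑T-suc n f φ e = begin
      ∑T (suc n) f
        ≡⟨ ∑-height-suc n n f ⟩
      antidiag (λ i j → ∑ (allFin m) λ a → ∑ (treesOfHeight≤? m n i) λ l →
        ∑ (treesOfHeight≤? m n j) λ r → f (just (node a l r))) n
        ≡⟨ antidiag-cong n (λ i j i+j≡n →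
             let i≤n = m+n≤o⇒m≤o i (≤-reflexive i+j≡n)
                 j≤n = m+n≤o⇒n≤o i (≤-reflexive i+j≡n)
             in trans (∑-cong (allFin m) λ a → trans
                  (∑-cong (treesOfHeight≤? m n i) λ l → trans
                     (∑-cong (treesOfHeight≤? m n j) λ r → e a l r)
                     (∑-height n j j (φ l) j≤n ≤-refl))
                  (∑-height n i i (λ l → ∑T j (φ l)) i≤n ≤-refl))
                (trans (∑-const (allFin m) _) (cong (_* ∑T i (λ l → ∑T j (φ l))) (length-tabulate {n = m} id)))) ⟩
      antidiag (λ i j → m * (∑T i λ l → ∑T j λ r → φ l r)) n
        ≡⟨ antidiag-*ˡ n m _ ⟩
      m * antidiag (λ i j → ∑T i λ l → ∑T j λ r → φ l r) n ∎
      where open ≡-Reasoning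

    ∑T-cong : ∀ n {f g} → (∀ t → f t ≡ g t) → ∑T n f ≡ ∑T n g
    ∑T-cong n = ∑-cong (treesOfHeight≤? m n n)

    ∑T-+ : ∀ n f g → ∑T n (λ t → f t + g t) ≡ ∑T n f + ∑T n g
    ∑T-+ n = ∑-+ (treesOfHeight≤? m n n)

    -- The empty tree `nothing` counts as the tree without nodes, so this is mⁿ times the n-th
    -- Catalan number.
    B : ℕ → ℕ
    B n = ∑T n (λ _ → 1)

    ∑T-const : ∀ n c → ∑T n (λ _ → c) ≡ B n * c
    ∑T-const n c = trans (∑-const ts c) (cong (_* c)
      (sym (trans (∑-const ts 1) (*-identityʳ (length ts)))))
      where ts = treesOfHeight≤? m n n

    ∑T-product : ∀ i j f g → ∑T i (λ l → ∑T j λ r → f l * g r) ≡ ∑T i f * ∑T j g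
    ∑T-product i j f g = trans
      (∑-cong (treesOfHeight≤? m i i) λ l → ∑-*ˡ (treesOfHeight≤? m j j) (f l) g)
      (∑-*ʳ (treesOfHeight≤? m i i) (∑T j g) f)

    ∑T-fst : ∀ i j f → ∑T i (λ l → ∑T j λ _ → f l) ≡ ∑T i f * B j
    ∑T-fst i j f = trans
      (∑-cong (treesOfHeight≤? m i i) λ l → trans (∑T-const j (f l)) (*-comm (B j) (f l)))
      (∑-*ʳ (treesOfHeight≤? m i i) (B j) f)

    ∑T-snd : ∀ i j g → ∑T i (λ _ → ∑T j λ r → g r) ≡ B i * ∑T j g
    ∑T-snd i j g = ∑T-const i (∑T j g)

    ∑T-split : ∀ i j f → ∑T i (λ l → ∑T j λ r → f l + f r) ≡ ∑T i f * B j + B i * ∑T j f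
    ∑T-split i j f = trans
      (∑T-cong i λ l → ∑T-+ j (λ _ → f l) f)
      (trans (∑T-+ i (λ l → ∑T j λ _ → f l) (λ _ → ∑T j f))
        (cong₂ _+_ (∑T-fst i j f) (∑T-snd i j f)))

    B-zero : B 0 ≡ 1
    B-zero = refl

    B-suc : ∀ n → B (suc n) ≡ m * antidiag (λ i j → B i * B j) n
    B-suc n = trans (∑T-suc n (λ _ → 1) (λ _ _ → 1) (λ _ _ _ → refl))
      (cong (m *_) (antidiag-cong n λ i j _ → ∑T-snd i j (λ _ → 1)))

    ∑T-trees : ∀ n f → ∑T (suc n) f ≡ ∑ (trees m n) (f ∘ just)
    ∑T-trees n f = ∑-map just (trees m n) f

    length-trees : ∀ n → length (trees m n) ≡ B (suc n)
    length-trees n = sym (trans (∑T-trees n (λ _ → 1))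
      (trans (∑-const (trees m n) 1) (*-identityʳ (length (trees m n)))))

-- Counting occurrences, and pairs of occurrences, of a fixed subtree.

module Occurrences where

  open import Data.List.Base using (_++_)
  open import Data.Maybe.Base using (Maybe; just; nothing)
  open import Data.Nat.Base
  open import Data.Nat.Properties hiding (_≟_)
  open import Data.Nat.Tactic.RingSolver using (solve-∀)
  open import Function.Base using (_∘_)
  open import Relation.Binary.PropositionalEquality
  open import Relation.Nullary using (yes; no)
  open import Defs using (Tree; node; size; size?; subtrees; subtrees?; _≟_; trees; ∈-trees⁺; ∈-trees⁻; trees-unique)
  open Antidiagonal
  open ListSum
  open TreeSum

  module _ {m : ℕ} (u : Tree m) where

    occurrences : Maybe (Tree m) → ℕ
    occurrences t = ∑ (subtrees? t) (λ v → ⟦ v ≟ u ⟧)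

    -- Two distinct occurrences of u lie in different subtrees of their lowest common ancestor.
    pairs : Maybe (Tree m) → ℕ
    pairs nothing             = 0
    pairs (just (node _ l r)) = pairs l + pairs r + occurrences l * occurrences r

    occurrences-node : ∀ a l r →
      occurrences (just (node a l r)) ≡ ⟦ node a l r ≟ u ⟧ + (occurrences l + occurrences r)
    occurrences-node a l r = cong (⟦ node a l r ≟ u ⟧ +_) (∑-++ (subtrees? l) (subtrees? r) _)

    -- `size?` counts nodes and `size` edges: the hypothesis says that t has fewer nodes than u.
    occurrences-small : ∀ t → size? t ≤ size u → occurrences t ≡ 0
    occurrences-small nothing             _   = refl
    occurrences-small (just t@(node a l r)) t<u = trans (occurrences-node a l r)
      (cong₂ _+_ (⟦⟧-no (t ≟ u) (λ where refl → <-irrefl refl t<u))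
        (cong₂ _+_ (occurrences-small l (≤-trans (m≤m+n (size? l) (size? r)) (<⇒≤ t<u)))
                   (occurrences-small r (≤-trans (m≤n+m (size? r) (size? l)) (<⇒≤ t<u)))))

    private
      -- If x and y are both positive, merging the two truncations loses 1, which the product x * y
      -- ≥ 1 repays; otherwise nothing is lost.
      combine : ∀ x y a b → x ≤ x ⊓ 1 + a → y ≤ y ⊓ 1 + b → x + y ≤ (x + y) ⊓ 1 + (a + b + x * y)
      combine zero y a b _ q = begin
        y                          ≤⟨ q ⟩
        y ⊓ 1 + b                  ≤⟨ +-monoʳ-≤ (y ⊓ 1) (≤-trans (m≤n+m b a) (m≤m+n (a + b) 0)) ⟩
        y ⊓ 1 + (a + b + 0) ∎
        where open ≤-Reasoning
      combine (suc x) zero a b p _ = begin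
        suc (x + 0)                ≡⟨ cong suc (+-identityʳ x) ⟩
        suc x                      ≤⟨ p ⟩
        suc (x ⊓ 0) + a            ≡⟨ cong (λ z → suc z + a) (⊓-zeroʳ x) ⟩
        1 + a                      ≤⟨ +-monoʳ-≤ 1 (≤-trans (m≤m+n a b) (m≤m+n (a + b) (x * 0))) ⟩
        1 + (a + b + x * 0)        ≡⟨ cong (λ z → suc z + (a + b + x * 0)) (sym (⊓-zeroʳ (x + 0))) ⟩
        suc ((x + 0) ⊓ 0) + (a + b + x * 0) ∎
        where open ≤-Reasoning
      combine (suc x) (suc y) a b p q = begin
        suc x + suc y              ≤⟨ +-mono-≤ p q ⟩
        suc (x ⊓ 0) + a + (suc (y ⊓ 0) + b)
          ≡⟨ cong₂ (λ z w → suc z + a + (suc w + b)) (⊓-zeroʳ x) (⊓-zeroʳ y) ⟩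
        1 + a + (1 + b)            ≤⟨ m≤m+n _ (x + y + x * y) ⟩
        1 + a + (1 + b) + (x + y + x * y) ≡⟨ lem a b x y ⟩
        1 + (a + b + suc x * suc y)
          ≡⟨ cong (λ z → suc z + (a + b + suc x * suc y)) (sym (⊓-zeroʳ (x + suc y))) ⟩
        suc ((x + suc y) ⊓ 0) + (a + b + suc x * suc y) ∎
        where
        open ≤-Reasoning
        lem : ∀ a b x y → 1 + a + (1 + b) + (x + y + x * y) ≡ 1 + (a + b + suc x * suc y)
        lem = solve-∀

    -- With c occurrences there are c(c-1)/2 pairs, which is at least c - 1. The induction along the
    -- tree avoids identifying `pairs` with that number.
    bonferroni : ∀ t → occurrences t ≤ occurrences t ⊓ 1 + pairs t
    bonferroni nothing = z≤n
    bonferroni (just t@(node a l r)) with t ≟ u in eq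
    ... | yes refl = ≤-trans (≤-reflexive (trans e (cong (_⊓ 1) (sym e)))) (m≤m+n _ (pairs (just t)))
      where
      e : 1 + ∑ (subtrees? l ++ subtrees? r) (λ v → ⟦ v ≟ u ⟧) ≡ 1
      e = cong suc (trans (∑-++ (subtrees? l) (subtrees? r) _)
        (cong₂ _+_ (occurrences-small l (m≤m+n (size? l) (size? r)))
                   (occurrences-small r (m≤n+m (size? r) (size? l)))))
    ... | no _ = subst (λ c → c ≤ c ⊓ 1 + pairs (just t)) (sym (∑-++ (subtrees? l) (subtrees? r) _))
      (combine (occurrences l) (occurrences r) (pairs l) (pairs r) (bonferroni l) (bonferroni r))

  module Moments (m : ℕ) where

    open Catalan.Recurrence m (B m) (B-zero m) (B-suc m) public

    module _ (u : Tree m) where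

      ∑-equal : ∀ n → n ≢ size u → ∑ (trees m n) (λ t → ⟦ t ≟ u ⟧) ≡ 0
      ∑-equal n n≢u = ∑-zero-∈ (trees m n) λ {t} t∈ →
        ⟦⟧-no (t ≟ u) (λ where refl → n≢u (sym (∈-trees⁻ n t t∈)))

      ∑-equal-size : ∑ (trees m (size u)) (λ t → ⟦ t ≟ u ⟧) ≡ 1
      ∑-equal-size = trans
        (∑-cong (trees m (size u)) λ t → trans (⟦⟧-sym t) (sym (+-identityʳ ⟦ u ≟ t ⟧)))
        (∑-select _≟_ (trees-unique (size u)) (∈-trees⁺ u) (λ _ → 1))
        where
        ⟦⟧-sym : ∀ t → ⟦ t ≟ u ⟧ ≡ ⟦ u ≟ t ⟧
        ⟦⟧-sym t with t ≟ u
        ... | yes refl = sym (⟦⟧-yes (u ≟ u) refl)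
        ... | no t≢u   = sym (⟦⟧-no (u ≟ t) (λ e → t≢u (sym e)))

      F Q : ℕ → ℕ
      F n = ∑T m n (occurrences u)
      Q n = ∑T m n (pairs u)

      private
        p : ℕ
        p = suc (size u)

        root : Maybe (Tree m) → ℕ
        root nothing  = 0
        root (just t) = ⟦ t ≟ u ⟧

        below : Maybe (Tree m) → ℕ
        below nothing             = 0
        below (just (node _ l r)) = occurrences u l + occurrences u r

      F-suc : ∀ n → F (suc n) ≡
              ∑ (trees m n) (λ t → ⟦ t ≟ u ⟧) + 2 * m * antidiag (λ i j → F i * B m j) n
      F-suc n = begin
        F (suc n)
          ≡⟨ ∑T-cong m (suc n) {occurrences u} {λ t → root t + below t} (λ where
                               nothing             → refl
                               (just (node a l r)) → occurrences-node u a l r) ⟩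
        ∑T m (suc n) (λ t → root t + below t)
          ≡⟨ ∑T-+ m (suc n) root below ⟩
        ∑T m (suc n) root + ∑T m (suc n) below
          ≡⟨ cong₂ _+_ (∑-map just (trees m n) root)
               (∑T-suc m n below (λ l r → occurrences u l + occurrences u r) (λ _ _ _ → refl)) ⟩
        ∑ (trees m n) (λ t → ⟦ t ≟ u ⟧)
          + m * antidiag (λ i j → ∑T m i λ l → ∑T m j λ r → occurrences u l + occurrences u r) n
          ≡⟨ cong (λ x → ∑ (trees m n) (λ t → ⟦ t ≟ u ⟧) + m * x)
               (trans (antidiag-cong n λ i j _ → ∑T-split m i j (occurrences u))
                 (antidiag-symmetrize n F (B m))) ⟩
        ∑ (trees m n) (λ t → ⟦ t ≟ u ⟧) + m * (2 * antidiag (λ i j → F i * B m j) n)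
          ≡⟨ cong (∑ (trees m n) (λ t → ⟦ t ≟ u ⟧) +_) (lem m _) ⟩
        ∑ (trees m n) (λ t → ⟦ t ≟ u ⟧) + 2 * m * antidiag (λ i j → F i * B m j) n ∎
        where
        open ≡-Reasoning
        lem : ∀ m x → m * (2 * x) ≡ 2 * m * x
        lem = solve-∀

      Q-suc : ∀ n → 2 * Q (suc n) ≡
              2 * m * (antidiag (λ i j → 2 * Q i * B m j) n + antidiag (λ i j → F i * F j) n)
      Q-suc n = begin
        2 * Q (suc n)
          ≡⟨ cong (2 *_) (∑T-suc m n (pairs u)
               (λ l r → pairs u l + pairs u r + occurrences u l * occurrences u r) (λ _ _ _ → refl)) ⟩
        2 * (m * antidiag (λ i j → ∑T m i λ l → ∑T m j λ r →
          pairs u l + pairs u r + occurrences u l * occurrences u r) n)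
          ≡⟨ cong (λ x → 2 * (m * x)) (antidiag-cong n λ i j _ → trans
               (trans (∑T-cong m i λ l → ∑T-+ m j (λ r → pairs u l + pairs u r) (λ r → occurrences u l * occurrences u r))
                      (∑T-+ m i (λ l → ∑T m j λ r → pairs u l + pairs u r)
                             (λ l → ∑T m j λ r → occurrences u l * occurrences u r)))
               (cong₂ _+_ (∑T-split m i j (pairs u)) (∑T-product m i j (occurrences u) (occurrences u)))) ⟩
        2 * (m * antidiag (λ i j → Q i * B m j + B m i * Q j + F i * F j) n)
          ≡⟨ cong (λ x → 2 * (m * x)) (trans (antidiag-+ n _ _)
               (cong (_+ antidiag (λ i j → F i * F j) n) (antidiag-symmetrize n Q (B m)))) ⟩
        2 * (m * (2 * antidiag (λ i j → Q i * B m j) n + antidiag (λ i j → F i * F j) n))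
          ≡⟨ sym (*-assoc 2 m _) ⟩
        2 * m * (2 * antidiag (λ i j → Q i * B m j) n + antidiag (λ i j → F i * F j) n)
          ≡⟨ cong (λ x → 2 * m * (x + antidiag (λ i j → F i * F j) n)) (sym (trans
               (antidiag-cong n λ i j _ → *-assoc 2 (Q i) (B m j)) (antidiag-*ˡ n 2 _))) ⟩
        2 * m * (antidiag (λ i j → 2 * Q i * B m j) n + antidiag (λ i j → F i * F j) n) ∎
        where open ≡-Reasoning

      F-zero : ∀ n → n < p → F n ≡ 0
      F-zero n n<p = go n n ≤-refl n<p
        where
        go : ∀ k n → n ≤ k → n < p → F n ≡ 0
        go k       zero    _         _   = refl
        go (suc k) (suc n) (s≤s n≤k) n<p = trans (F-suc n) (cong₂ _+_
          (∑-equal n (λ where refl → <-irrefl refl n<p))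
          (trans (cong (2 * m *_) (antidiag-zero n λ i j i+j≡n →
            let i≤n = m+n≤o⇒m≤o i (≤-reflexive i+j≡n)
            in cong (_* B m j) (go k i (≤-trans i≤n n≤k) (≤-<-trans i≤n (<-trans (n<1+n n) n<p)))))
            (*-zeroʳ (2 * m))))

      -- In place of a grafting bijection: shifted by p, `F` obeys the recurrence `G-suc`, and its
      -- initial value 1 comes from the tree u itself.
      F-closed : ∀ n → F (p + n) ≡ G n
      F-closed n = go n n ≤-refl
        where
        go : ∀ k n → n ≤ k → F (p + n) ≡ G n
        go k zero _ = begin
          F (suc (size u + 0))
            ≡⟨ cong (F ∘ suc) (+-identityʳ (size u)) ⟩
          F p
            ≡⟨ F-suc (size u) ⟩
          ∑ (trees m (size u)) (λ t → ⟦ t ≟ u ⟧) + 2 * m * antidiag (λ i j → F i * B m j) (size u)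
            ≡⟨ cong₂ _+_ ∑-equal-size (trans (cong (2 * m *_) (antidiag-zero (size u) λ i j i+j≡n →
                 cong (_* B m j) (F-zero i (s≤s (m+n≤o⇒m≤o i (≤-reflexive i+j≡n)))))) (*-zeroʳ (2 * m))) ⟩
          1
            ≡⟨ sym G-zero ⟩
          G 0 ∎
          where open ≡-Reasoning
        go (suc k) (suc n) (s≤s n≤k) = begin
          F (suc (size u + suc n))
            ≡⟨ cong (F ∘ suc) (+-suc (size u) n) ⟩
          F (suc (p + n))
            ≡⟨ F-suc (p + n) ⟩
          ∑ (trees m (p + n)) (λ t → ⟦ t ≟ u ⟧) + 2 * m * antidiag (λ i j → F i * B m j) (p + n)
            ≡⟨ cong₂ (λ x y → x + 2 * m * y)
                 (∑-equal (p + n) (λ e → <-irrefl (sym e) (s≤s (m≤m+n (size u) n))))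
                 (antidiag-shift p n λ i j i<p → cong (_* B m j) (F-zero i i<p)) ⟩
          2 * m * antidiag (λ i j → F (p + i) * B m j) n
            ≡⟨ cong (2 * m *_) (antidiag-cong n λ i j i+j≡n →
                 cong (_* B m j) (go k i (≤-trans (m+n≤o⇒m≤o i (≤-reflexive i+j≡n)) n≤k))) ⟩
          2 * m * antidiag (λ i j → G i * B m j) n
            ≡⟨ sym (G-suc n) ⟩
          G (suc n) ∎
          where open ≡-Reasoning

      private
        FF : ∀ n → antidiag (λ i j → F i * F j) (p + (p + n)) ≡ antidiag (λ i j → G i * G j) n
        FF n = begin
          antidiag (λ i j → F i * F j) (p + (p + n))
            ≡⟨ antidiag-shift p (p + n) (λ i j i<p → cong (_* F j) (F-zero i i<p)) ⟩
          antidiag (λ i j → F (p + i) * F j) (p + n)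
            ≡⟨ antidiag-swap (p + n) (λ i j → F (p + i) * F j) ⟩
          antidiag (λ i j → F (p + j) * F i) (p + n)
            ≡⟨ antidiag-shift p n (λ i j i<p → trans (cong (F (p + j) *_) (F-zero i i<p)) (*-zeroʳ (F (p + j)))) ⟩
          antidiag (λ i j → F (p + j) * F (p + i)) n
            ≡⟨ antidiag-cong n (λ i j _ → trans (cong₂ _*_ (F-closed j) (F-closed i)) (*-comm (G j) (G i))) ⟩
          antidiag (λ i j → G i * G j) n ∎
          where open ≡-Reasoning

        FF-zero : ∀ n → n < p + p → antidiag (λ i j → F i * F j) n ≡ 0
        FF-zero n n<2p = antidiag-zero n λ i j i+j≡n → vanish i j (subst (_< p + p) (sym i+j≡n) n<2p)
          where
          vanish : ∀ i j → i + j < p + p → F i * F j ≡ 0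
          vanish i j h with p ≤? i
          ... | no i≱p  = cong (_* F j) (F-zero i (≰⇒> i≱p))
          ... | yes p≤i = trans (cong (F i *_)
                  (F-zero j (+-cancelˡ-< p j p (≤-<-trans (+-monoˡ-≤ j p≤i) h)))) (*-zeroʳ (F i))

      -- Two occurrences need a common ancestor outside both, so even 2p nodes are too few.
      Q-zero : ∀ n → n ≤ p + p → 2 * Q n ≡ 0
      Q-zero n n≤2p = go n n ≤-refl n≤2p
        where
        go : ∀ k n → n ≤ k → n ≤ p + p → 2 * Q n ≡ 0
        go k       zero    _         _   = refl
        go (suc k) (suc n) (s≤s n≤k) n<2p = trans (Q-suc n) (trans (cong (2 * m *_) (cong₂ _+_
          (antidiag-zero n λ i j i+j≡n →
            let i≤n = m+n≤o⇒m≤o i (≤-reflexive i+j≡n)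
            in cong (_* B m j) (go k i (≤-trans i≤n n≤k) (≤-trans i≤n (<⇒≤ n<2p))))
          (FF-zero n n<2p)))
          (*-zeroʳ (2 * m)))

      -- A pair arises by grafting u at two of the n+1 empty positions of a tree with n nodes, and
      -- twice the number of such choices is (n+1) n `B n`.
      Q-closed : ∀ n → 2 * Q (p + p + n) ≡ n * G n
      Q-closed n = go n n ≤-refl
        where
        go : ∀ k n → n ≤ k → 2 * Q (p + p + n) ≡ n * G n
        go k       zero    _         = Q-zero (p + p + 0) (≤-reflexive (+-identityʳ (p + p)))
        go (suc k) (suc n) (s≤s n≤k) = begin
          2 * Q (p + p + suc n)
            ≡⟨ cong (λ x → 2 * Q x) (+-suc (p + p) n) ⟩
          2 * Q (suc (p + p + n))
            ≡⟨ Q-suc (p + p + n) ⟩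
          2 * m * (antidiag (λ i j → 2 * Q i * B m j) (p + p + n) + antidiag (λ i j → F i * F j) (p + p + n))
            ≡⟨ cong (2 * m *_) (cong₂ _+_
                 (trans (antidiag-shift (p + p) n λ i j i<2p → cong (_* B m j) (Q-zero i (<⇒≤ i<2p)))
                   (antidiag-cong n λ i j i+j≡n →
                     cong (_* B m j) (go k i (≤-trans (m+n≤o⇒m≤o i (≤-reflexive i+j≡n)) n≤k))))
                 (trans (cong (antidiag (λ i j → F i * F j)) (+-assoc p p n)) (FF n))) ⟩
          2 * m * (antidiag (λ i j → i * G i * B m j) n + antidiag (λ i j → G i * G j) n)
            ≡⟨ G-square n ⟩
          suc n * G (suc n) ∎
          where open ≡-Reasoning

      -- Truncated subtraction is harmless: if the pair does not fit, the right side is 0 * `G 0`.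
      Q-formula : ∀ n → 2 * Q n ≡ (n ∸ (p + p)) * G (n ∸ (p + p))
      Q-formula n with p + p ≤? n
      ... | yes 2p≤n = trans (cong (λ x → 2 * Q x) (sym (m+[n∸m]≡n 2p≤n))) (Q-closed (n ∸ (p + p)))
      ... | no 2p≰n  = trans (Q-zero n n≤2p) (cong (λ x → x * G x) (sym (m≤n⇒m∸n≡0 n≤2p)))
        where
        n≤2p : n ≤ p + p
        n≤2p = <⇒≤ (≰⇒> 2p≰n)

-- The edges of the minimal dag, counted by the subtree at their source.

module DagEdges where

  open import Data.List.Base using (List; []; _∷_; _++_; length; upTo; deduplicate; filter)
  open import Data.List.Membership.Propositional using (_∈_)
  open import Data.List.Membership.Propositional.Properties using (∈-++⁻; ∈-deduplicate⁻; ∈-upTo⁺)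
  open import Data.List.Relation.Unary.Any using (here; there)
  import Data.List.Relation.Unary.Unique.Propositional.Properties as Unique
  open import Data.Maybe.Base using (Maybe; just; nothing)
  open import Data.Nat.Base
  open import Data.Nat.Properties as ℕ hiding (_≟_)
  open import Data.Nat.Tactic.RingSolver using (solve-∀)
  open import Data.Sum.Base using (inj₁; inj₂)
  open import Function.Base using (_∘_)
  open import Relation.Binary.PropositionalEquality hiding (J)
  open import Relation.Nullary using (¬_; yes; no)
  open import Relation.Nullary.Decidable using (¬?)
  open import Defs using (Tree; node; size; size?; subtrees; subtrees?; _≟_; trees;
    ∈-trees⁺; ∈-trees⁻; trees-unique; dagNodes; dagEdges; outEdges)
  open Antidiagonal
  open ListSum
  open TreeSum
  open Occurrences

  length-∑ : ∀ {A : Set} (xs : List A) → length xs ≡ ∑ xs (λ _ → 1)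
  length-∑ xs = sym (trans (∑-const xs 1) (*-identityʳ (length xs)))

  module _ {m : ℕ} where

    degree : Tree m → ℕ
    degree u = length (outEdges u)

    length-dagEdges : ∀ t → length (dagEdges t) ≡ ∑ (dagNodes t) degree
    length-dagEdges t = trans (length-∑ (dagEdges t))
      (trans (∑-concatMap outEdges (dagNodes t) (λ _ → 1))
        (∑-cong (dagNodes t) λ u → sym (length-∑ (outEdges u))))

    size-subtrees : ∀ t {v : Tree m} → v ∈ subtrees? t → size v < size? t
    size-subtrees (just (node _ l r)) (here refl) = ≤-refl
    size-subtrees (just (node _ l r)) (there v∈) with ∈-++⁻ (subtrees? l) v∈
    ... | inj₁ v∈l = <-trans (size-subtrees l v∈l) (s≤s (m≤m+n (size? l) (size? r)))
    ... | inj₂ v∈r = <-trans (size-subtrees r v∈r) (s≤s (m≤n+m (size? r) (size? l)))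

    ∑-deduplicate : ∀ (u : Tree m) xs →
      ∑ (deduplicate _≟_ xs) (λ v → ⟦ v ≟ u ⟧) ≡ ∑ xs (λ v → ⟦ v ≟ u ⟧) ⊓ 1
    ∑-deduplicate u []       = refl
    ∑-deduplicate u (x ∷ xs) with x ≟ u
    ... | yes refl = cong suc (trans (absent (deduplicate _≟_ xs)) (sym (⊓-zeroʳ _)))
      where
      absent : ∀ ys → ∑ (filter (λ y → ¬? (x ≟ y)) ys) (λ v → ⟦ v ≟ x ⟧) ≡ 0
      absent []       = refl
      absent (y ∷ ys) with x ≟ y
      ... | yes _   = absent ys
      ... | no  x≢y = cong₂ _+_ (⟦⟧-no (y ≟ x) (x≢y ∘ sym)) (absent ys)
    ... | no x≢u = trans (kept (deduplicate _≟_ xs)) (∑-deduplicate u xs)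
      where
      kept : ∀ ys → ∑ (filter (λ y → ¬? (x ≟ y)) ys) (λ v → ⟦ v ≟ u ⟧) ≡ ∑ ys (λ v → ⟦ v ≟ u ⟧)
      kept []       = refl
      kept (y ∷ ys) with x ≟ y
      ... | yes refl = trans (kept ys) (cong (_+ ∑ ys (λ v → ⟦ v ≟ u ⟧)) (sym (⟦⟧-no (x ≟ u) x≢u)))
      ... | no _     = cong (⟦ y ≟ u ⟧ +_) (kept ys)

    -- Writing `f v` as a sum over all candidates u makes the range of summation independent of the
    -- tree under consideration, so that the two sums can be interchanged.
    ∑-all-trees : ∀ n (v : Tree m) → size v ≤ n → ∀ (f : Tree m → ℕ) →
      ∑ (upTo (suc n)) (λ p → ∑ (trees m p) (λ u → f u * ⟦ v ≟ u ⟧)) ≡ f v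
    ∑-all-trees n v v≤n f = trans (∑-cong (upTo (suc n)) inner)
      (∑-select ℕ._≟_ (Unique.upTo⁺ (suc n)) (∈-upTo⁺ (s≤s v≤n)) (λ _ → f v))
      where
      inner : ∀ p → ∑ (trees m p) (λ u → f u * ⟦ v ≟ u ⟧) ≡ f v * ⟦ size v ℕ.≟ p ⟧
      inner p with size v ℕ.≟ p
      ... | yes refl = trans (∑-select _≟_ (trees-unique p) (∈-trees⁺ v) f) (sym (*-identityʳ (f v)))
      ... | no v≢p   = trans (∑-select-∉ _≟_ (λ v∈ → v≢p (∈-trees⁻ p v v∈)) f) (sym (*-zeroʳ (f v)))

    dagEdges-by-subtree : ∀ n t → size t ≤ n → length (dagEdges t) ≡
      ∑ (upTo (suc n)) λ p → ∑ (trees m p) λ u → degree u * (occurrences u (just t) ⊓ 1)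
    dagEdges-by-subtree n t t≤n = begin
      length (dagEdges t)
        ≡⟨ length-dagEdges t ⟩
      ∑ (dagNodes t) degree
        ≡⟨ ∑-cong-∈ (dagNodes t) (λ {v} v∈ → sym (∑-all-trees n v
             (≤-trans (≤-pred (size-subtrees (just t) (∈-deduplicate⁻ _≟_ (subtrees t) v∈))) t≤n) degree)) ⟩
      ∑ (dagNodes t) (λ v → ∑ (upTo (suc n)) λ p → ∑ (trees m p) λ u → degree u * ⟦ v ≟ u ⟧)
        ≡⟨ ∑-swap (dagNodes t) (upTo (suc n)) _ ⟩
      ∑ (upTo (suc n)) (λ p → ∑ (dagNodes t) λ v → ∑ (trees m p) λ u → degree u * ⟦ v ≟ u ⟧)
        ≡⟨ ∑-cong (upTo (suc n)) (λ p → trans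
             (∑-swap (dagNodes t) (trees m p) (λ v u → degree u * ⟦ v ≟ u ⟧))
             (∑-cong (trees m p) λ u → trans (∑-*ˡ (dagNodes t) (degree u) (λ v → ⟦ v ≟ u ⟧))
               (cong (degree u *_) (∑-deduplicate u (subtrees t))))) ⟩
      ∑ (upTo (suc n)) (λ p → ∑ (trees m p) λ u → degree u * (occurrences u (just t) ⊓ 1)) ∎
      where open ≡-Reasoning

  module Bounds (m : ℕ) where

    open Moments m public

    S : ℕ → ℕ
    S n = ∑ (trees m n) (length ∘ dagEdges)

    -- The number of trees that contain u: truncation at 1 turns the number of occurrences into an
    -- indicator.
    J : Tree m → ℕ → ℕ
    J u n = ∑ (trees m n) (λ t → occurrences u (just t) ⊓ 1)

    S-by-subtree : ∀ n → S n ≡ ∑ (upTo (suc n)) λ p → ∑ (trees m p) λ u → degree u * J u n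
    S-by-subtree n = begin
      S n
        ≡⟨ ∑-cong-∈ (trees m n) (λ {t} t∈ → dagEdges-by-subtree n t (≤-reflexive (∈-trees⁻ n t t∈))) ⟩
      ∑ (trees m n) (λ t → ∑ (upTo (suc n)) λ p → ∑ (trees m p) λ u → degree u * (occurrences u (just t) ⊓ 1))
        ≡⟨ ∑-swap (trees m n) (upTo (suc n)) _ ⟩
      ∑ (upTo (suc n)) (λ p → ∑ (trees m n) λ t → ∑ (trees m p) λ u → degree u * (occurrences u (just t) ⊓ 1))
        ≡⟨ ∑-cong (upTo (suc n)) (λ p → trans
             (∑-swap (trees m n) (trees m p) (λ t u → degree u * (occurrences u (just t) ⊓ 1)))
             (∑-cong (trees m p) λ u → ∑-*ˡ (trees m n) (degree u) (λ t → occurrences u (just t) ⊓ 1))) ⟩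
      ∑ (upTo (suc n)) (λ p → ∑ (trees m p) λ u → degree u * J u n) ∎
      where open ≡-Reasoning

    J≤B : ∀ u n → J u n ≤ B m (suc n)
    J≤B u n = ≤-trans (∑-mono (trees m n) λ t → m⊓n≤n (occurrences u (just t)) 1)
      (≤-reflexive (sym (∑T-trees m n (λ _ → 1))))

    F-trees : ∀ u p n → size u ≡ p → F u (suc (p + n)) ≡ G n
    F-trees u p n refl = F-closed u n

    J≤F : ∀ u n → J u n ≤ F u (suc n)
    J≤F u n = ≤-trans (∑-mono (trees m n) λ t → m⊓n≤m (occurrences u (just t)) 1)
      (≤-reflexive (sym (∑T-trees m n (occurrences u))))

    F≤J+Q : ∀ u n → F u (suc n) ≤ J u n + Q u (suc n)
    F≤J+Q u n = begin
      F u (suc n)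
        ≡⟨ ∑T-trees m n (occurrences u) ⟩
      ∑ (trees m n) (occurrences u ∘ just)
        ≤⟨ ∑-mono (trees m n) (λ t → bonferroni u (just t)) ⟩
      ∑ (trees m n) (λ t → occurrences u (just t) ⊓ 1 + pairs u (just t))
        ≡⟨ ∑-+ (trees m n) _ _ ⟩
      J u n + ∑ (trees m n) (pairs u ∘ just)
        ≡⟨ cong (J u n +_) (sym (∑T-trees m n (pairs u))) ⟩
      J u n + Q u (suc n) ∎
      where open ≤-Reasoning

    d : ℕ → ℕ
    d p = ∑ (trees m p) degree

    private
      empty : Maybe (Tree m) → ℕ
      empty nothing  = 1
      empty (just _) = 0

      emptyChildren : Maybe (Tree m) → ℕ
      emptyChildren nothing             = 0
      emptyChildren (just (node _ l r)) = empty l + empty r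

      degree+empty : ∀ u → degree u + emptyChildren (just u) ≡ 2
      degree+empty (node _ nothing  nothing)  = refl
      degree+empty (node _ nothing  (just _)) = refl
      degree+empty (node _ (just _) nothing)  = refl
      degree+empty (node _ (just _) (just _)) = refl

      ∑-empty : ∀ n → antidiag (λ i j → ∑T m i empty * B m j) n ≡ B m n
      ∑-empty zero    = refl
      ∑-empty (suc n) = trans (cong₂ _+_ (+-identityʳ (B m (suc n))) (antidiag-zero n λ i j _ →
          cong (_* B m j) (trans (∑T-trees m i empty) (∑-zero-∈ (trees m i) λ _ → refl))))
        (+-identityʳ (B m (suc n)))

      ∑-emptyChildren : ∀ p → ∑T m (suc p) emptyChildren ≡ 2 * m * B m p
      ∑-emptyChildren p = begin
        ∑T m (suc p) emptyChildren
          ≡⟨ ∑T-suc m p emptyChildren (λ l r → empty l + empty r) (λ _ _ _ → refl) ⟩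
        m * antidiag (λ i j → ∑T m i λ l → ∑T m j λ r → empty l + empty r) p
          ≡⟨ cong (m *_) (trans (antidiag-cong p λ i j _ → ∑T-split m i j empty)
               (antidiag-symmetrize p (λ i → ∑T m i empty) (B m))) ⟩
        m * (2 * antidiag (λ i j → ∑T m i empty * B m j) p)
          ≡⟨ cong (λ x → m * (2 * x)) (∑-empty p) ⟩
        m * (2 * B m p)
          ≡⟨ lem m (B m p) ⟩
        2 * m * B m p ∎
        where
        open ≡-Reasoning
        lem : ∀ m b → m * (2 * b) ≡ 2 * m * b
        lem = solve-∀

    -- Each root has two child positions. If a chosen one of them is empty, the label and the other
    -- subtree remain free, which gives m `B p` trees for each side.
    d-formula : ∀ p → d p + 2 * m * B m p ≡ 2 * B m (suc p)
    d-formula p = begin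
      d p + 2 * m * B m p
        ≡⟨ cong (d p +_) (trans (sym (∑-emptyChildren p)) (∑T-trees m p emptyChildren)) ⟩
      d p + ∑ (trees m p) (emptyChildren ∘ just)
        ≡⟨ sym (∑-+ (trees m p) degree (emptyChildren ∘ just)) ⟩
      ∑ (trees m p) (λ u → degree u + emptyChildren (just u))
        ≡⟨ ∑-cong (trees m p) degree+empty ⟩
      ∑ (trees m p) (λ _ → 2)
        ≡⟨ sym (∑T-trees m p (λ _ → 2)) ⟩
      ∑T m (suc p) (λ _ → 2)
        ≡⟨ ∑T-const m (suc p) 2 ⟩
      B m (suc p) * 2
        ≡⟨ *-comm (B m (suc p)) 2 ⟩
      2 * B m (suc p) ∎
      where open ≡-Reasoning

    d≤2B : ∀ p → d p ≤ 2 * B m (suc p)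
    d≤2B p = ≤-trans (m≤m+n (d p) _) (≤-reflexive (d-formula p))

    -- The number of edges of the trees of size s + M whose source has a subtree of size at least s.
    X : ℕ → ℕ → ℕ
    X s = antidiag (λ i j → d (s + i) * G j)

    -- `d-formula` makes `X` a difference of two tails of the convolution of `B` and `G`, both known
    -- from `K-closed`.
    X-formula : ∀ s M → X s M + 2 * m * K s M ≡ 2 * K (suc s) M
    X-formula s M = begin
      X s M + 2 * m * K s M
        ≡⟨ cong (X s M +_) (sym (antidiag-*ˡ M (2 * m) _)) ⟩
      X s M + antidiag (λ i j → 2 * m * (B m (s + i) * G j)) M
        ≡⟨ sym (antidiag-+ M _ _) ⟩
      antidiag (λ i j → d (s + i) * G j + 2 * m * (B m (s + i) * G j)) M
        ≡⟨ antidiag-cong M (λ i j _ → trans (lem (d (s + i)) (G j) (2 * m) (B m (s + i)))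
             (trans (cong (_* G j) (d-formula (s + i))) (*-assoc 2 (B m (suc s + i)) (G j)))) ⟩
      antidiag (λ i j → 2 * (B m (suc s + i) * G j)) M
        ≡⟨ antidiag-*ˡ M 2 _ ⟩
      2 * K (suc s) M ∎
      where
      open ≡-Reasoning
      lem : ∀ a g c b → a * g + c * (b * g) ≡ (a + c * b) * g
      lem = solve-∀

    private
      S-row : ℕ → ℕ → ℕ
      S-row n p = ∑ (trees m p) λ u → degree u * J u n

      S-split : ∀ s M → S (s + M) ≡
        ∑ (upTo s) (S-row (s + M)) + antidiag (λ i _ → S-row (s + M) (s + i)) M
      S-split s M = trans (S-by-subtree (s + M)) (trans
        (cong (λ k → ∑ (upTo k) (S-row (s + M))) (sym (+-suc s M)))
        (trans (∑-upTo-+ s (suc M) (S-row (s + M)))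
          (cong (∑ (upTo s) (S-row (s + M)) +_) (∑-antidiag M (λ i _ → S-row (s + M) (s + i))))))

    F-on-diagonal : ∀ s {i j M} u → i + j ≡ M → size u ≡ s + i → F u (suc (s + M)) ≡ G j
    F-on-diagonal s {i} {j} u refl e =
      trans (cong (F u ∘ suc) (sym (+-assoc s i j))) (F-trees u (s + i) j e)

    -- A small u is charged as if every tree contained it, a large u as if all its occurrences were
    -- in different trees.
    S≤ : ∀ s M → S (s + M) ≤ X s M + ∑ (upTo s) d * B m (suc (s + M))
    S≤ s M = begin
      S (s + M)
        ≡⟨ S-split s M ⟩
      ∑ (upTo s) (S-row (s + M)) + antidiag (λ i _ → S-row (s + M) (s + i)) M
        ≤⟨ +-mono-≤
             (∑-mono (upTo s) λ p → ≤-trans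
               (∑-mono (trees m p) λ u → *-monoʳ-≤ (degree u) (J≤B u (s + M)))
               (≤-reflexive (∑-*ʳ (trees m p) (B m (suc (s + M))) degree)))
             (antidiag-mono M λ i j i+j≡M → ≤-trans
               (∑-mono-∈ (trees m (s + i)) λ {u} u∈ → *-monoʳ-≤ (degree u) (≤-trans (J≤F u (s + M))
                 (≤-reflexive (F-on-diagonal s u i+j≡M (∈-trees⁻ (s + i) u u∈)))))
               (≤-reflexive (∑-*ʳ (trees m (s + i)) (G j) degree))) ⟩
      ∑ (upTo s) (λ p → d p * B m (suc (s + M))) + X s M
        ≡⟨ cong (_+ X s M) (∑-*ʳ (upTo s) (B m (suc (s + M))) d) ⟩
      ∑ (upTo s) d * B m (suc (s + M)) + X s M
        ≡⟨ +-comm _ (X s M) ⟩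
      X s M + ∑ (upTo s) d * B m (suc (s + M)) ∎
      where open ≤-Reasoning

    -- The number of nodes left outside two disjoint subtrees with p edges, thus p + 1 nodes, each.
    outside : ℕ → ℕ → ℕ
    outside n p = suc n ∸ (suc p + suc p)

    -- A bound for the pairs counted with the degree of their subtree: the 2 in `d≤2B` cancels the 2
    -- in `Q-formula`.
    Y : ℕ → ℕ → ℕ
    Y s M = ∑ (upTo (suc M)) λ i →
      B m (suc (s + i)) * (outside (s + M) (s + i) * G (outside (s + M) (s + i)))

    -- Bonferroni's inequality summed over all large u; the small ones only increase `S`.
    X≤ : ∀ s M → X s M ≤ S (s + M) + Y s M
    X≤ s M = begin
      X s M
        ≤⟨ antidiag-mono M (λ i j i+j≡M → ≤-trans
             (≤-reflexive (sym (∑-*ʳ (trees m (s + i)) (G j) degree)))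
             (∑-mono-∈ (trees m (s + i)) λ {u} u∈ → ≤-trans
               (*-monoʳ-≤ (degree u) (≤-trans
                 (≤-reflexive (sym (F-on-diagonal s u i+j≡M (∈-trees⁻ (s + i) u u∈)))) (F≤J+Q u (s + M))))
               (≤-reflexive (*-distribˡ-+ (degree u) (J u (s + M)) (Q u (suc (s + M))))))) ⟩
      antidiag (λ i _ → ∑ (trees m (s + i)) λ u → degree u * J u (s + M) + degree u * Q u (suc (s + M))) M
        ≡⟨ trans (antidiag-cong M λ i _ _ →
             ∑-+ (trees m (s + i)) (λ u → degree u * J u (s + M)) (λ u → degree u * Q u (suc (s + M))))
             (antidiag-+ M _ _) ⟩
      antidiag (λ i _ → S-row (s + M) (s + i)) M
        + antidiag (λ i _ → ∑ (trees m (s + i)) λ u → degree u * Q u (suc (s + M))) M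
        ≤⟨ +-mono-≤ (≤-trans (m≤n+m _ (∑ (upTo s) (S-row (s + M)))) (≤-reflexive (sym (S-split s M))))
             (antidiag-mono M λ i _ _ → row i) ⟩
      S (s + M) + antidiag (λ i _ → term i) M
        ≡⟨ cong (S (s + M) +_) (sym (∑-antidiag M (λ i _ → term i))) ⟩
      S (s + M) + Y s M ∎
      where
      open ≤-Reasoning
      e : ℕ → ℕ
      e i = outside (s + M) (s + i) * G (outside (s + M) (s + i))
      term : ℕ → ℕ
      term i = B m (suc (s + i)) * e i
      lem : ∀ a q → 2 * (a * q) ≡ a * (2 * q)
      lem = solve-∀
      row : ∀ i → ∑ (trees m (s + i)) (λ u → degree u * Q u (suc (s + M))) ≤ term i
      row i = *-cancelˡ-≤ 2 (begin
        2 * ∑ (trees m (s + i)) (λ u → degree u * Q u (suc (s + M)))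
          ≡⟨ sym (∑-*ˡ (trees m (s + i)) 2 (λ u → degree u * Q u (suc (s + M)))) ⟩
        ∑ (trees m (s + i)) (λ u → 2 * (degree u * Q u (suc (s + M))))
          ≡⟨ ∑-cong-∈ (trees m (s + i)) (λ {u} u∈ → trans (lem (degree u) (Q u (suc (s + M))))
               (cong (degree u *_) (trans (Q-formula u (suc (s + M)))
                 (cong (λ k → (suc (s + M) ∸ (suc k + suc k)) * G (suc (s + M) ∸ (suc k + suc k)))
                   (∈-trees⁻ (s + i) u u∈))))) ⟩
        ∑ (trees m (s + i)) (λ u → degree u * e i)
          ≡⟨ ∑-*ʳ (trees m (s + i)) (e i) degree ⟩
        d (s + i) * e i
          ≤⟨ *-monoˡ-≤ (e i) (d≤2B (s + i)) ⟩
        2 * B m (suc (s + i)) * e i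
          ≡⟨ *-assoc 2 (B m (suc (s + i))) (e i) ⟩
        2 * term i ∎)

-- Upper and lower bounds for the total number of dag edges, in natural numbers.

module Counting where

  open import Data.List.Base using (upTo)
  open import Data.Nat.Base
  open import Data.Nat.Properties
  open import Data.Nat.Tactic.RingSolver using (solve-∀)
  open import Data.Product.Base using (_×_; _,_)
  open import Relation.Binary.PropositionalEquality
  open import Relation.Nullary using (yes; no)
  open ListSum
  open TreeSum
  open DagEdges

  -- Serves to absorb terms of order P² into n, since 4^P ≤ (4m)^P ≤ n.
  ^-square : ∀ n → n * n ≤ 4 ^ n
  ^-square zero    = z≤n
  ^-square (suc n) = begin
    suc n * suc n                 ≡⟨ lem n ⟩
    n * n + (1 + 2 * n)           ≤⟨ +-monoˡ-≤ (1 + 2 * n) (^-square n) ⟩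
    4 ^ n + (1 + 2 * n)           ≤⟨ +-monoʳ-≤ (4 ^ n) (linear n) ⟩
    4 ^ n + 3 * 4 ^ n ∎
    where
    open ≤-Reasoning
    lem : ∀ n → suc n * suc n ≡ n * n + (1 + 2 * n)
    lem = solve-∀
    lem′ : ∀ x → 3 * x + 9 * x ≡ 3 * (4 * x)
    lem′ = solve-∀
    lem″ : ∀ n → 1 + 2 * suc n ≡ 1 + 2 * n + 2
    lem″ = solve-∀
    linear : ∀ n → 1 + 2 * n ≤ 3 * 4 ^ n
    linear zero    = s≤s z≤n
    linear (suc n) = begin
      1 + 2 * suc n              ≡⟨ lem″ n ⟩
      1 + 2 * n + 2              ≤⟨ +-mono-≤ (linear n) (≤-trans (s≤s (s≤s z≤n)) (*-monoʳ-≤ 9 (m^n>0 4 n))) ⟩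
      3 * 4 ^ n + 9 * 4 ^ n      ≡⟨ lem′ (4 ^ n) ⟩
      3 * (4 * 4 ^ n) ∎

  module _ (m : ℕ) .{{m≢0 : NonZero m}} where

    open Bounds m

    private
      1≤m : 1 ≤ m
      1≤m = >-nonZero⁻¹ m

    -- The indices begin at 1 because for m = 1 the values at 0 and 1 are both 1.
    B-doubles : ∀ n → 2 * B m (suc n) ≤ B m (suc (suc n))
    B-doubles n = *-cancelˡ-≤ (3 + n) (begin
      (3 + n) * (2 * B m (suc n))                ≤⟨ m≤m+n _ (2 * n * B m (suc n)) ⟩
      (3 + n) * (2 * B m (suc n)) + 2 * n * B m (suc n) ≡⟨ lem n (B m (suc n)) ⟩
      1 * ((4 * suc n + 2) * B m (suc n))        ≤⟨ *-monoˡ-≤ _ 1≤m ⟩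
      m * ((4 * suc n + 2) * B m (suc n))        ≡⟨ sym (*-assoc m _ _) ⟩
      m * (4 * suc n + 2) * B m (suc n)          ≡⟨ sym (G-step (suc n)) ⟩
      (3 + n) * B m (suc (suc n)) ∎)
      where
      open ≤-Reasoning
      lem : ∀ n b → (3 + n) * (2 * b) + 2 * n * b ≡ 1 * ((4 * suc n + 2) * b)
      lem = solve-∀

    ∑-B≤B : ∀ s → ∑ (upTo s) (λ p → B m (suc p)) ≤ B m (suc s)
    ∑-B≤B zero    = z≤n
    ∑-B≤B (suc s) = begin
      ∑ (upTo (suc s)) (λ p → B m (suc p))
        ≡⟨ cong (λ k → ∑ (upTo k) (λ p → B m (suc p))) (+-comm 1 s) ⟩
      ∑ (upTo (s + 1)) (λ p → B m (suc p))
        ≡⟨ ∑-upTo-+ s 1 (λ p → B m (suc p)) ⟩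
      ∑ (upTo s) (λ p → B m (suc p)) + (B m (suc (s + 0)) + 0)
        ≤⟨ +-mono-≤ (∑-B≤B s) (≤-reflexive (cong (λ k → B m (suc k) + 0) (+-identityʳ s))) ⟩
      2 * B m (suc s)
        ≤⟨ B-doubles s ⟩
      B m (suc (suc s)) ∎
      where open ≤-Reasoning

    ∑-d≤2B : ∀ s → ∑ (upTo s) d ≤ 2 * B m (suc s)
    ∑-d≤2B s = begin
      ∑ (upTo s) d                             ≤⟨ ∑-mono (upTo s) d≤2B ⟩
      ∑ (upTo s) (λ p → 2 * B m (suc p))       ≡⟨ ∑-*ˡ (upTo s) 2 _ ⟩
      2 * ∑ (upTo s) (λ p → B m (suc p))       ≤⟨ *-monoʳ-≤ 2 (∑-B≤B s) ⟩
      2 * B m (suc s) ∎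
      where open ≤-Reasoning

    -- The sum of the coefficients 4Z + 12 and 8Z + 9 that accumulate in the lower bound `σ≥`, where
    -- Z = 4m. The upper bound would do with less.
    error : ℕ
    error = 12 * (4 * m) + 21

    1≤error : 1 ≤ error
    1≤error = ≤-trans (s≤s z≤n) (m≤n+m 21 (12 * (4 * m)))

    module _ (s M : ℕ) where

      private
        -- `Z` is the exponential growth rate of `B`, `b` the number of trees, and `g` / `z` the β
        -- of the overview. The factor `z` in `σ` clears that denominator, so the claim is that σ is
        -- close to 3 n b g.
        P n N Z z b g k k′ x σ : ℕ
        P = suc s
        n = s + M
        N = suc n
        Z = 4 * m
        z = Z ^ P
        b = B m N
        g = G P
        k = K P M
        k′ = K s M
        x = X s M
        σ = z * S n

        P≤N : P ≤ N
        P≤N = s≤s (m≤m+n s M)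

        -- The closed forms of `k` and `k′` share the factor `G M`, so their quotient is explicit:
        -- it is 4m up to a factor 1 + O(1/P).
        k-relation : N * k′ * (m * (4 * s + 2)) ≡ P * (suc N * k)
        k-relation = begin
          N * k′ * (m * (4 * s + 2))
            ≡⟨ cong (_* (m * (4 * s + 2))) (K-closed s M) ⟩
          (2 * M + 1) * (G M * G s) * (m * (4 * s + 2))
            ≡⟨ lem (2 * M + 1) (G M) (G s) (m * (4 * s + 2)) ⟩
          (2 * M + 1) * (G M * (m * (4 * s + 2) * G s))
            ≡⟨ cong (λ y → (2 * M + 1) * (G M * y)) (sym (G-ratio s)) ⟩
          (2 * M + 1) * (G M * (P * g))
            ≡⟨ lem′ (2 * M + 1) (G M) P g ⟩
          P * ((2 * M + 1) * (G M * g))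
            ≡⟨ cong (P *_) (sym (K-closed P M)) ⟩
          P * (suc N * k) ∎
          where
          open ≡-Reasoning
          lem : ∀ a b c d → a * (b * c) * d ≡ a * (b * (d * c))
          lem = solve-∀
          lem′ : ∀ a b c d → a * (b * (c * d)) ≡ c * (a * (b * d))
          lem′ = solve-∀

        k≤4mk′ : k ≤ 4 * m * k′
        k≤4mk′ = *-cancelˡ-≤ (P * N) {{m*n≢0 P N}} (begin
          P * N * k                        ≡⟨ *-assoc P N k ⟩
          P * (N * k)                      ≤⟨ *-monoʳ-≤ P (*-monoˡ-≤ k (n≤1+n N)) ⟩
          P * (suc N * k)                  ≡⟨ sym k-relation ⟩
          N * k′ * (m * (4 * s + 2))       ≤⟨ m≤m+n _ (N * k′ * (m * 2)) ⟩
          N * k′ * (m * (4 * s + 2)) + N * k′ * (m * 2) ≡⟨ lem N k′ m s ⟩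
          P * N * (4 * m * k′) ∎)
          where
          open ≤-Reasoning
          lem : ∀ N k m s → N * k * (m * (4 * s + 2)) + N * k * (m * 2) ≡ suc s * N * (4 * m * k)
          lem = solve-∀

        -- The origin of the constant 3: x = 2k - 2m k′, and 2m k′ is about k/2, so x is about 3k/2,
        -- while z k is about 2 n b g.
        x≤ : 2 * x ≤ 3 * k
        x≤ = +-cancelʳ-≤ k (2 * x) (3 * k) (begin
          2 * x + k                ≤⟨ +-monoʳ-≤ (2 * x) k≤4mk′ ⟩
          2 * x + 4 * m * k′       ≡⟨ lem x m k′ ⟩
          2 * (x + 2 * m * k′)     ≡⟨ cong (2 *_) (X-formula s M) ⟩
          2 * (2 * k)              ≡⟨ lem′ k ⟩
          3 * k + k ∎)
          where
          open ≤-Reasoning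
          lem : ∀ x m k → 2 * x + 4 * m * k ≡ 2 * (x + 2 * m * k)
          lem = solve-∀
          lem′ : ∀ k → 2 * (2 * k) ≡ 3 * k + k
          lem′ = solve-∀

        -- `k-relation` contains 4s + 2 instead of 4P. The missing 2m k′ is at most 2k by
        -- `X-formula`, and the excess of `suc N` over `N` costs one more k.
        4Pmk′≤ : 4 * P * m * k′ ≤ (P + 3) * k
        4Pmk′≤ = *-cancelˡ-≤ N (begin
          N * (4 * P * m * k′)                          ≡⟨ lem N s m k′ ⟩
          N * k′ * (m * (4 * s + 2)) + N * (2 * m * k′) ≡⟨ cong (_+ N * (2 * m * k′)) k-relation ⟩
          P * (suc N * k) + N * (2 * m * k′)
            ≤⟨ +-monoʳ-≤ (P * (suc N * k)) (*-monoʳ-≤ N (≤-trans (m≤n+m _ x) (≤-reflexive (X-formula s M)))) ⟩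
          P * (suc N * k) + N * (2 * k)                 ≡⟨ lem′ P N k ⟩
          P * k + N * ((P + 2) * k)                     ≤⟨ +-monoˡ-≤ _ (*-monoˡ-≤ k P≤N) ⟩
          N * k + N * ((P + 2) * k)                     ≡⟨ lem″ P N k ⟩
          N * ((P + 3) * k) ∎)
          where
          open ≤-Reasoning
          lem : ∀ N s m k → N * (4 * suc s * m * k) ≡ N * k * (m * (4 * s + 2)) + N * (2 * m * k)
          lem = solve-∀
          lem′ : ∀ P N k → P * (suc N * k) + N * (2 * k) ≡ P * k + N * ((P + 2) * k)
          lem′ = solve-∀
          lem″ : ∀ P N k → N * k + N * ((P + 2) * k) ≡ N * ((P + 3) * k)
          lem″ = solve-∀

        x≥ : 3 * P * k ≤ 2 * P * x + 3 * k
        x≥ = +-cancelʳ-≤ (P * k) _ _ (begin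
          3 * P * k + P * k                 ≡⟨ lem P k ⟩
          2 * P * (2 * k)                   ≡⟨ cong (2 * P *_) (sym (X-formula s M)) ⟩
          2 * P * (x + 2 * m * k′)          ≡⟨ lem′ P x m k′ ⟩
          2 * P * x + 4 * P * m * k′        ≤⟨ +-monoʳ-≤ (2 * P * x) 4Pmk′≤ ⟩
          2 * P * x + (P + 3) * k           ≡⟨ lem″ P x k ⟩
          2 * P * x + 3 * k + P * k ∎)
          where
          open ≤-Reasoning
          lem : ∀ P k → 3 * P * k + P * k ≡ 2 * P * (2 * k)
          lem = solve-∀
          lem′ : ∀ P x m k → 2 * P * (x + 2 * m * k) ≡ 2 * P * x + 4 * P * m * k
          lem′ = solve-∀
          lem″ : ∀ P x k → 2 * P * x + (P + 3) * k ≡ 2 * P * x + 3 * k + P * k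
          lem″ = solve-∀

        -- In the closed form of k, the monotonicity of (2n+1) `G n` / Z^n trades z * `G M` for
        -- `G N`, hence for b. The matching lower bound uses that `G n` / Z^n decreases.
        zk≤ : z * k ≤ (2 * N + 1) * (b * g)
        zk≤ = *-cancelˡ-≤ (suc N) (begin
          suc N * (z * k)                       ≡⟨ lem (suc N) z k ⟩
          z * (suc N * k)                       ≡⟨ cong (z *_) (K-closed P M) ⟩
          z * ((2 * M + 1) * (G M * g))         ≡⟨ lem′ z (2 * M + 1) (G M) g ⟩
          z * ((2 * M + 1) * G M) * g           ≤⟨ *-monoˡ-≤ g ([2n+1]G-≥ P M) ⟩
          (2 * N + 1) * (suc N * b) * g         ≡⟨ lem″ (2 * N + 1) (suc N) b g ⟩
          suc N * ((2 * N + 1) * (b * g)) ∎)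
          where
          open ≤-Reasoning
          lem : ∀ a b c → a * (b * c) ≡ b * (a * c)
          lem = solve-∀
          lem′ : ∀ a b c d → a * (b * (c * d)) ≡ a * (b * c) * d
          lem′ = solve-∀
          lem″ : ∀ a b c d → a * (b * c) * d ≡ b * (a * (c * d))
          lem″ = solve-∀

        zk≥ : (2 * M + 1) * (b * g) ≤ z * k
        zk≥ = *-cancelˡ-≤ (suc N) (begin
          suc N * ((2 * M + 1) * (b * g))   ≡⟨ lem (suc N) (2 * M + 1) b g ⟩
          (2 * M + 1) * (G N * g)           ≤⟨ *-monoʳ-≤ (2 * M + 1) (*-monoˡ-≤ g (G-≤ P M)) ⟩
          (2 * M + 1) * (z * G M * g)       ≡⟨ lem′ (2 * M + 1) z (G M) g ⟩
          z * ((2 * M + 1) * (G M * g))     ≡⟨ cong (z *_) (sym (K-closed P M)) ⟩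
          z * (suc N * k)                   ≡⟨ lem″ z (suc N) k ⟩
          suc N * (z * k) ∎)
          where
          open ≤-Reasoning
          lem : ∀ a c b g → a * (c * (b * g)) ≡ c * (a * b * g)
          lem = solve-∀
          lem′ : ∀ a b c d → a * (b * c * d) ≡ b * (a * (c * d))
          lem′ = solve-∀
          lem″ : ∀ a b c → a * (b * c) ≡ b * (a * c)
          lem″ = solve-∀

        outside≤ : ∀ i → Z ^ ((P + i) + (P + i)) * (outside n (s + i) * G (outside n (s + i))) ≤ N * G N
        outside≤ i with (P + i) + (P + i) ≤? N
        ... | yes 2p≤N = ≤-trans (nG-≥ ((P + i) + (P + i)) (outside n (s + i)))
                (≤-reflexive (cong (λ y → y * G y) (m+[n∸m]≡n 2p≤N)))
        ... | no 2p≰N  = ≤-trans (≤-reflexive (trans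
                (cong (λ y → Z ^ ((P + i) + (P + i)) * (y * G y)) (m≤n⇒m∸n≡0 (<⇒≤ (≰⇒> 2p≰N))))
                (*-zeroʳ (Z ^ ((P + i) + (P + i)))))) z≤n

        -- The pairs decay like Z^(-2(P+i)), whereas (P+1) `B (P + i)` grows at most like Z^i. This
        -- leaves Z^(-i), weakened to 2^(-i) for the geometric sum.
        Y-term : ∀ i → 2 ^ i * (z * z * (suc P * (B m (suc (s + i)) *
                   (outside n (s + i) * G (outside n (s + i)))))) ≤ g * (N * G N)
        Y-term i = *-cancelˡ-≤ (Z ^ i) {{m^n≢0 Z i {{m*n≢0 4 m}}}} (begin
          Z ^ i * (2 ^ i * (z * z * (suc P * (B m (P + i) * e))))
            ≤⟨ *-monoʳ-≤ (Z ^ i) (*-monoˡ-≤ _ (^-monoˡ-≤ i 2≤Z)) ⟩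
          Z ^ i * (Z ^ i * (z * z * (suc P * (B m (P + i) * e))))
            ≡⟨ lem (Z ^ i) z (suc P) (B m (P + i)) e ⟩
          suc P * B m (P + i) * (z * Z ^ i * (z * Z ^ i) * e)
            ≡⟨ cong (λ y → suc P * B m (P + i) * (y * e)) (trans
                 (cong₂ _*_ (sym (^-distribˡ-+-* Z P i)) (sym (^-distribˡ-+-* Z P i)))
                 (sym (^-distribˡ-+-* Z (P + i) (P + i)))) ⟩
          suc P * B m (P + i) * (Z ^ ((P + i) + (P + i)) * e)
            ≤⟨ *-mono-≤ (≤-trans (*-monoˡ-≤ (B m (P + i)) (s≤s (m≤m+n P i)))
                 (subst (λ y → G y ≤ Z ^ i * g) (+-comm i P) (G-≤ i P))) (outside≤ i) ⟩
          Z ^ i * g * (N * G N)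
            ≡⟨ *-assoc (Z ^ i) g (N * G N) ⟩
          Z ^ i * (g * (N * G N)) ∎)
          where
          open ≤-Reasoning
          e : ℕ
          e = outside n (s + i) * G (outside n (s + i))
          2≤Z : 2 ≤ Z
          2≤Z = ≤-trans (s≤s (s≤s z≤n)) (*-monoʳ-≤ 4 1≤m)
          lem : ∀ w z p b e → w * (w * (z * z * (p * (b * e)))) ≡ p * b * (z * w * (z * w) * e)
          lem = solve-∀

        -- The number of pairs is quadratic in N; one of the two factors is absorbed by N ≤ Z z. The
        -- factor `suc P`, the quotient of `G P` and `B P`, makes this error O(1/P).
        Y≤ : N ≤ Z * z → suc P * (z * Y s M) ≤ 2 * (Z * (suc N * (b * g)))
        Y≤ N≤Zz = *-cancelˡ-≤ z {{m^n≢0 Z P {{m*n≢0 4 m}}}} (begin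
          z * (suc P * (z * Y s M))
            ≡⟨ lem z (suc P) (Y s M) ⟩
          z * z * (suc P * Y s M)
            ≡⟨ sym (trans (∑-*ˡ (upTo (suc M)) (z * z) (λ i → suc P * f i))
                 (cong (z * z *_) (∑-*ˡ (upTo (suc M)) (suc P) f))) ⟩
          ∑ (upTo (suc M)) (λ i → z * z * (suc P * f i))
            ≤⟨ ∑-geometric (suc M) _ (g * (N * G N)) (λ i _ → Y-term i) ⟩
          2 * (g * (N * G N))
            ≤⟨ *-monoʳ-≤ 2 (*-monoʳ-≤ g (*-monoˡ-≤ (G N) N≤Zz)) ⟩
          2 * (g * (Z * z * (suc N * b)))
            ≡⟨ lem′ g Z z (suc N) b ⟩
          z * (2 * (Z * (suc N * (b * g)))) ∎)
          where
          open ≤-Reasoning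
          f : ℕ → ℕ
          f i = B m (suc (s + i)) * (outside n (s + i) * G (outside n (s + i)))
          lem : ∀ z p y → z * (p * (z * y)) ≡ z * z * (p * y)
          lem = solve-∀
          lem′ : ∀ g Z z N b → 2 * (g * (Z * z * (N * b))) ≡ z * (2 * (Z * (N * (b * g))))
          lem′ = solve-∀

      private
        σ≤ : P ≤ n → z ≤ n → 2 * (P * σ) ≤ (6 * P + 13) * (n * (b * g))
        σ≤ P≤n zP≤n = begin
          2 * (P * (z * S n))
            ≤⟨ *-monoʳ-≤ 2 (*-monoʳ-≤ P (*-monoʳ-≤ z (≤-trans (S≤ s M)
                 (+-monoʳ-≤ x (*-monoˡ-≤ b (∑-d≤2B s)))))) ⟩
          2 * (P * (z * (x + 2 * B m P * b)))
            ≡⟨ lem P z x (B m P) b ⟩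
          P * z * (2 * x) + 4 * (z * (P * B m P * b))
            ≤⟨ +-mono-≤ (*-monoʳ-≤ (P * z) x≤) (*-monoʳ-≤ 4 (*-mono-≤ zP≤n
                 (*-monoˡ-≤ b (*-monoˡ-≤ (B m P) (n≤1+n P))))) ⟩
          P * z * (3 * k) + 4 * (n * (g * b))
            ≡⟨ lem′ P z k n g b ⟩
          3 * P * (z * k) + 4 * n * (b * g)
            ≤⟨ +-monoˡ-≤ _ (*-monoʳ-≤ (3 * P) zk≤) ⟩
          3 * P * ((2 * N + 1) * (b * g)) + 4 * n * (b * g)
            ≡⟨ lem″ P n (b * g) ⟩
          (6 * P + 4) * (n * (b * g)) + 9 * (P * (b * g))
            ≤⟨ +-monoʳ-≤ ((6 * P + 4) * (n * (b * g))) (*-monoʳ-≤ 9 (*-monoˡ-≤ (b * g) P≤n)) ⟩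
          (6 * P + 4) * (n * (b * g)) + 9 * (n * (b * g))
            ≡⟨ lem‴ P (n * (b * g)) ⟩
          (6 * P + 13) * (n * (b * g)) ∎
          where
          open ≤-Reasoning
          lem : ∀ P z x c b → 2 * (P * (z * (x + 2 * c * b))) ≡ P * z * (2 * x) + 4 * (z * (P * c * b))
          lem = solve-∀
          lem′ : ∀ P z k n g b → P * z * (3 * k) + 4 * (n * (g * b)) ≡ 3 * P * (z * k) + 4 * n * (b * g)
          lem′ = solve-∀
          lem″ : ∀ P n a → 3 * P * ((2 * suc n + 1) * a) + 4 * n * a ≡ (6 * P + 4) * (n * a) + 9 * (P * a)
          lem″ = solve-∀
          lem‴ : ∀ P a → (6 * P + 4) * a + 9 * a ≡ (6 * P + 13) * a
          lem‴ = solve-∀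

        σ≥ : P * P ≤ n → 1 ≤ n → N ≤ Z * z →
             6 * (P * (n * (b * g))) ≤ 2 * (P * σ) + error * (n * (b * g))
        σ≥ P²≤n 1≤n N≤Zz = begin
          6 * (P * (n * a))
            ≤⟨ m≤m+n _ (P * a * 3) ⟩
          6 * (P * (n * a)) + P * a * 3
            ≡⟨ lem s M a ⟩
          3 * P * ((2 * M + 1) * a) + 6 * (P * s * a)
            ≤⟨ +-mono-≤ (*-monoʳ-≤ (3 * P) zk≥) (*-monoʳ-≤ 6 (*-monoˡ-≤ a
                 (≤-trans (*-monoʳ-≤ P (n≤1+n s)) P²≤n))) ⟩
          3 * P * (z * k) + 6 * (n * a)
            ≡⟨ lem′ P z k (6 * (n * a)) ⟩
          z * (3 * P * k) + 6 * (n * a)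
            ≤⟨ +-monoˡ-≤ _ (*-monoʳ-≤ z (≤-trans x≥ (+-monoˡ-≤ (3 * k) (*-monoʳ-≤ (2 * P) (X≤ s M))))) ⟩
          z * (2 * P * (S n + Y s M) + 3 * k) + 6 * (n * a)
            ≡⟨ lem″ z P (S n) (Y s M) k (n * a) ⟩
          2 * (P * σ) + 2 * (P * (z * Y s M)) + 3 * (z * k) + 6 * (n * a)
            ≤⟨ +-monoˡ-≤ (6 * (n * a)) (+-mono-≤
                 (+-monoʳ-≤ (2 * (P * σ)) (*-monoʳ-≤ 2 (≤-trans (*-monoˡ-≤ (z * Y s M) (n≤1+n P)) (Y≤ N≤Zz))))
                 (*-monoʳ-≤ 3 zk≤)) ⟩
          2 * (P * σ) + 2 * (2 * (Z * (suc N * a))) + 3 * ((2 * N + 1) * a) + 6 * (n * a)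
            ≡⟨ lem‴ (P * σ) Z n a ⟩
          2 * (P * σ) + (4 * Z + 12) * (n * a) + (8 * Z + 9) * (1 * a)
            ≤⟨ +-monoʳ-≤ _ (*-monoʳ-≤ (8 * Z + 9) (*-monoˡ-≤ a 1≤n)) ⟩
          2 * (P * σ) + (4 * Z + 12) * (n * a) + (8 * Z + 9) * (n * a)
            ≡⟨ lem⁗ (P * σ) Z (n * a) ⟩
          2 * (P * σ) + error * (n * a) ∎
          where
          open ≤-Reasoning
          a : ℕ
          a = b * g
          lem : ∀ s M a → 6 * (suc s * ((s + M) * a)) + suc s * a * 3
              ≡ 3 * suc s * ((2 * M + 1) * a) + 6 * (suc s * s * a)
          lem = solve-∀
          lem′ : ∀ P z k r → 3 * P * (z * k) + r ≡ z * (3 * P * k) + r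
          lem′ = solve-∀
          lem″ : ∀ z P S Y k r → z * (2 * P * (S + Y) + 3 * k) + 6 * r
               ≡ 2 * (P * (z * S)) + 2 * (P * (z * Y)) + 3 * (z * k) + 6 * r
          lem″ = solve-∀
          lem‴ : ∀ r Z n a → 2 * r + 2 * (2 * (Z * (suc (suc n) * a))) + 3 * ((2 * suc n + 1) * a) + 6 * (n * a)
               ≡ 2 * r + (4 * Z + 12) * (n * a) + (8 * Z + 9) * (1 * a)
          lem‴ = solve-∀
          lem⁗ : ∀ r Z a → 2 * r + (4 * Z + 12) * a + (8 * Z + 9) * a ≡ 2 * r + (12 * Z + 21) * a
          lem⁗ = solve-∀

      -- Both bounds carry the same factor 1 + error/P, which is the two-sided form used for
      -- relative errors later.
      S-asymptotics : z ≤ n → N ≤ Z * z → error ≤ P →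
        P * σ ≤ (P + error) * (3 * (n * (b * g))) × P * (3 * (n * (b * g))) ≤ (P + error) * σ
      S-asymptotics zP≤n N≤Zz error≤P = upper , lower
        where
        open ≤-Reasoning
        a : ℕ
        a = n * (b * g)
        P²≤n : P * P ≤ n
        P²≤n = ≤-trans (^-square P) (≤-trans (^-monoˡ-≤ P (*-monoʳ-≤ 4 1≤m)) zP≤n)
        P≤n : P ≤ n
        P≤n = ≤-trans (m≤m*n P P) P²≤n
        upper : P * σ ≤ (P + error) * (3 * a)
        upper = *-cancelˡ-≤ 2 (begin
          2 * (P * σ)                ≤⟨ σ≤ P≤n zP≤n ⟩
          (6 * P + 13) * a           ≤⟨ *-monoˡ-≤ a (≤-trans (m≤m+n (6 * P + 13) (72 * Z + 113)) (≤-reflexive (lem P Z))) ⟩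
          (2 * ((P + error) * 3)) * a ≡⟨ lem′ (P + error) a ⟩
          2 * ((P + error) * (3 * a)) ∎)
          where
          lem : ∀ P Z → 6 * P + 13 + (72 * Z + 113) ≡ 2 * ((P + (12 * Z + 21)) * 3)
          lem = solve-∀
          lem′ : ∀ q a → 2 * (q * 3) * a ≡ 2 * (q * (3 * a))
          lem′ = solve-∀
        σ≥′ : 6 * (P * a) ≤ 2 * (P * σ) + error * a
        σ≥′ = σ≥ P²≤n (≤-trans (s≤s {_} {s} z≤n) P≤n) N≤Zz
        -- A crude bound that turns the additive error `error * a` into a multiple of σ; it requires
        -- error ≤ P.
        a≤σ : a ≤ σ
        a≤σ = *-cancelˡ-≤ (2 * P) (+-cancelʳ-≤ (P * a) _ _ (begin
          2 * P * a + P * a          ≤⟨ m≤m+n _ (3 * (P * a)) ⟩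
          2 * P * a + P * a + 3 * (P * a) ≡⟨ lem P a ⟩
          6 * (P * a)                ≤⟨ σ≥′ ⟩
          2 * (P * σ) + error * a    ≤⟨ +-monoʳ-≤ _ (*-monoˡ-≤ a error≤P) ⟩
          2 * (P * σ) + P * a        ≡⟨ cong (_+ P * a) (sym (*-assoc 2 P σ)) ⟩
          2 * P * σ + P * a ∎))
          where
          lem : ∀ P a → 2 * P * a + P * a + 3 * (P * a) ≡ 6 * (P * a)
          lem = solve-∀
        lower : P * (3 * a) ≤ (P + error) * σ
        lower = *-cancelˡ-≤ 2 (begin
          2 * (P * (3 * a))          ≡⟨ lem P a ⟩
          6 * (P * a)                ≤⟨ σ≥′ ⟩
          2 * (P * σ) + error * a    ≤⟨ +-monoʳ-≤ _ (≤-trans (*-monoʳ-≤ error a≤σ) (m≤m+n (error * σ) (1 * (error * σ)))) ⟩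
          2 * (P * σ) + 2 * (error * σ) ≡⟨ lem′ P error σ ⟩
          2 * ((P + error) * σ) ∎)
          where
          lem : ∀ P a → 2 * (P * (3 * a)) ≡ 6 * (P * a)
          lem = solve-∀
          lem′ : ∀ P e σ → 2 * (P * σ) + 2 * (e * σ) ≡ 2 * ((P + e) * σ)
          lem′ = solve-∀

-- The embedding of the natural numbers into the rationals.

module RationalArithmetic where

  import Data.Integer.Base as ℤ
  open import Data.Nat.Base as ℕ using (ℕ; suc)
  import Data.Nat.Properties as ℕ
  open import Data.Nat.Tactic.RingSolver using (solve-∀)
  open import Data.Rational.Base
  open import Data.Rational.Properties
  open import Data.Rational.Solver using (module +-*-Solver)
  open import Relation.Binary.PropositionalEquality
  open import Defs using (module Rational)
  open +-*-Solver
  open Rational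

  abstract
    -- Kept opaque so that ring identities treat `ι n` as an indeterminate instead of a normalized
    -- fraction.
    ι : ℕ → ℚ
    ι n = frac n 0

    ι-def : ∀ n → ι n ≡ ℤ.+ n / 1
    ι-def n = refl

    ι-0 : ι 0 ≡ 0ℚ
    ι-0 = refl

    ι-1 : ι 1 ≡ 1ℚ
    ι-1 = refl

    ι-+ : ∀ m n → ι (m ℕ.+ n) ≡ ι m + ι n
    ι-+ m n = sym (frac-+ m n 0)

    ι-* : ∀ m n → ι (m ℕ.* n) ≡ ι m * ι n
    ι-* m n = sym (frac-* m n 0 0)

    ι-mono : ∀ {m n} → m ℕ.≤ n → ι m ≤ ι n
    ι-mono {m} {n} m≤n = frac-≤ {m} {n} {0} {0} (ℕ.*-monoˡ-≤ 1 m≤n)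

    ι-pos : ∀ n → 0ℚ < ι (suc n)
    ι-pos n = frac-pos n 0

    frac-ι : ∀ a n → frac a n * ι (suc n) ≡ ι a
    frac-ι a n = trans (frac-* a (suc n) n 0) (frac-≡ {a ℕ.* suc n} {a} {0 ℕ.+ n ℕ.* 1} {0} (lem a n))
      where
      lem : ∀ a n → a ℕ.* suc n ℕ.* 1 ≡ a ℕ.* suc (0 ℕ.+ n ℕ.* 1)
      lem = solve-∀

  ι-nonNeg : ∀ n → 0ℚ ≤ ι n
  ι-nonNeg n = subst (_≤ ι n) ι-0 (ι-mono ℕ.z≤n)

  ι-suc : ∀ n → ι (suc n) ≡ ι n + 1ℚ
  ι-suc n = trans (cong ι (ℕ.+-comm 1 n)) (trans (ι-+ n 1) (cong (ι n +_) ι-1))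

  ι-∸ : ∀ {m n} → n ℕ.≤ m → ι (m ℕ.∸ n) ≡ ι m - ι n
  ι-∸ {m} {n} n≤m = trans (solve 2 (λ a b → a := (b :+ a) :- b) refl (ι (m ℕ.∸ n)) (ι n))
    (cong (_- ι n) (trans (sym (ι-+ n (m ℕ.∸ n))) (cong ι (ℕ.m+[n∸m]≡n n≤m))))

  ι-2 : ι 2 ≡ 1ℚ + 1ℚ
  ι-2 = trans (ι-suc 1) (cong (_+ 1ℚ) ι-1)

  ι-double : ∀ n → ι (2 ℕ.* n) ≡ ι n + ι n
  ι-double n = trans (cong (λ k → ι (n ℕ.+ k)) (ℕ.+-identityʳ n)) (ι-+ n n)

  cancel-≡ : ∀ r {p q} → 0ℚ < r → r * p ≡ r * q → p ≡ q
  cancel-≡ r {p} {q} 0<r eq = ≤-antisym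
    (*-cancelˡ-≤-pos r {{positive 0<r}} (≤-reflexive eq))
    (*-cancelˡ-≤-pos r {{positive 0<r}} (≤-reflexive (sym eq)))

  cancel-≤ : ∀ r {p q} → 0ℚ < r → r * p ≤ r * q → p ≤ q
  cancel-≤ r 0<r = *-cancelˡ-≤-pos r {{positive 0<r}}

  *-monoˡ : ∀ r {p q} → 0ℚ ≤ r → p ≤ q → r * p ≤ r * q
  *-monoˡ r 0≤r = *-monoˡ-≤-nonNeg r {{nonNegative 0≤r}}

  *-monoʳ : ∀ r {p q} → 0ℚ ≤ r → p ≤ q → p * r ≤ q * r
  *-monoʳ r 0≤r = *-monoʳ-≤-nonNeg r {{nonNegative 0≤r}}

  zeroˡ : ∀ {p} q → p ≡ 0ℚ → p * q ≡ 0ℚ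
  zeroˡ q refl = *-zeroˡ q

  zeroʳ : ∀ p {q} → q ≡ 0ℚ → p * q ≡ 0ℚ
  zeroʳ p refl = *-zeroʳ p

  0≤-diff : ∀ {p q r} → 0ℚ ≤ r → p + r ≡ q → p ≤ q
  0≤-diff {p} 0≤r eq = ≤-trans (p≤p+q 0≤r) (≤-reflexive eq)

-- Alternating sums of quotients of binomial coefficients.

module Wallis where

  open import Data.Nat.Base as ℕ using (ℕ; zero; suc)
  import Data.Nat.Properties as ℕ
  open import Data.Rational.Base
  open import Data.Rational.Properties
  open import Data.Rational.Solver using (module +-*-Solver)
  open import Function.Base using (_∘_)
  open import Relation.Binary.PropositionalEquality
  open import Relation.Nullary using (yes; no)
  open import Defs using (module Rational)
  open +-*-Solver
  open Rational
  open RationalArithmetic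

  alt-cong : ∀ n {f g} → (∀ i → f i ≡ g i) → alt f n ≡ alt g n
  alt-cong zero    e = refl
  alt-cong (suc n) e = cong₂ _-_ (e 0) (alt-cong n (e ∘ suc))

  alt-linear : ∀ n c f g → alt (λ i → c * f i + g i) n ≡ c * alt f n + alt g n
  alt-linear zero    c f g = solve 1 (λ c → con 0ℚ := c :* con 0ℚ :+ con 0ℚ) refl c
  alt-linear (suc n) c f g = trans (cong (_-_ (c * f 0 + g 0)) (alt-linear n c (f ∘ suc) (g ∘ suc)))
    (solve 5 (λ c x y u v → c :* x :+ y :- (c :* u :+ v) := c :* (x :- u) :+ (y :- v)) refl
      c (f 0) (g 0) (alt (f ∘ suc) n) (alt (g ∘ suc) n))

  alt-scale : ∀ n c f → alt (λ i → c * f i) n ≡ c * alt f n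
  alt-scale zero    c f = sym (*-zeroʳ c)
  alt-scale (suc n) c f = trans (cong (_-_ (c * f 0)) (alt-scale n c (f ∘ suc)))
    (solve 3 (λ c x u → c :* x :- c :* u := c :* (x :- u)) refl c (f 0) (alt (f ∘ suc) n))

  alt-zero : ∀ n {f} → (∀ i → f i ≡ 0ℚ) → alt f n ≡ 0ℚ
  alt-zero zero    e = refl
  alt-zero (suc n) e = cong₂ _-_ (e 0) (alt-zero n (e ∘ suc))

  -- The factor r stands for a termwise error c / r without division.
  alt-close : ∀ n c r f g → 0ℚ ≤ r → (∀ i → r * ∣ f i - g i ∣ ≤ c) → r * ∣ alt f n - alt g n ∣ ≤ ι n * c
  alt-close zero    c r f g 0≤r h = ≤-reflexive (trans (*-zeroʳ r) (sym (trans (cong (_* c) ι-0) (*-zeroˡ c))))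
  alt-close (suc n) c r f g 0≤r h = begin
    r * ∣ (f 0 - alt (f ∘ suc) n) - (g 0 - alt (g ∘ suc) n) ∣
      ≡⟨ cong (λ x → r * ∣ x ∣) (solve 4 (λ a b c d → (a :- b) :- (c :- d) := (a :- c) :- (b :- d)) refl
           (f 0) (alt (f ∘ suc) n) (g 0) (alt (g ∘ suc) n)) ⟩
    r * ∣ (f 0 - g 0) - (alt (f ∘ suc) n - alt (g ∘ suc) n) ∣
      ≤⟨ *-monoˡ r 0≤r (∣p-q∣≤∣p∣+∣q∣ (f 0 - g 0) (alt (f ∘ suc) n - alt (g ∘ suc) n)) ⟩
    r * (∣ f 0 - g 0 ∣ + ∣ alt (f ∘ suc) n - alt (g ∘ suc) n ∣)
      ≡⟨ *-distribˡ-+ r _ _ ⟩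
    r * ∣ f 0 - g 0 ∣ + r * ∣ alt (f ∘ suc) n - alt (g ∘ suc) n ∣
      ≤⟨ +-mono-≤ (h 0) (alt-close n c r (f ∘ suc) (g ∘ suc) 0≤r (h ∘ suc)) ⟩
    c + ι n * c
      ≡⟨ solve 2 (λ c x → c :+ x :* c := (x :+ con 1ℚ) :* c) refl c (ι n) ⟩
    (ι n + 1ℚ) * c
      ≡⟨ cong (_* c) (sym (ι-suc n)) ⟩
    ι (suc n) * c ∎
    where open ≤-Reasoning

  -- w n k is the quotient of the binomial coefficients (2n over n+k) and (2n over n).
  w : ℕ → ℕ → ℚ
  w n zero    = 1ℚ
  w n (suc k) = w n k * frac (n ℕ.∸ k) (n ℕ.+ k)

  w-vanishes : ∀ n k → n ℕ.≤ k → w n (suc k) ≡ 0ℚ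
  w-vanishes n k n≤k = trans (cong (λ a → w n k * frac a (n ℕ.+ k)) (ℕ.m≤n⇒m∸n≡0 n≤k))
    (trans (cong (w n k *_) (trans (frac-≡ {0} {0} {n ℕ.+ k} {0} refl) refl)) (*-zeroʳ (w n k)))

  w-nonNeg : ∀ n k → 0ℚ ≤ w n k
  w-nonNeg n zero    = <⇒≤ 0<1
  w-nonNeg n (suc k) = 0≤* (w-nonNeg n k) (frac-nonNeg (n ℕ.∸ k) (n ℕ.+ k))

  w-step : ∀ n k → k ℕ.≤ n → w n (suc k) * (ι n + ι k + 1ℚ) ≡ w n k * (ι n - ι k)
  w-step n k k≤n = begin
    w n k * f * (ι n + ι k + 1ℚ)
      ≡⟨ cong (λ x → w n k * f * (x + 1ℚ)) (sym (ι-+ n k)) ⟩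
    w n k * f * (ι (n ℕ.+ k) + 1ℚ)
      ≡⟨ cong (w n k * f *_) (sym (ι-suc (n ℕ.+ k))) ⟩
    w n k * f * ι (suc (n ℕ.+ k))
      ≡⟨ *-assoc (w n k) f _ ⟩
    w n k * (f * ι (suc (n ℕ.+ k)))
      ≡⟨ cong (w n k *_) (trans (frac-ι (n ℕ.∸ k) (n ℕ.+ k)) (ι-∸ k≤n)) ⟩
    w n k * (ι n - ι k) ∎
    where
    open ≡-Reasoning
    f : ℚ
    f = frac (n ℕ.∸ k) (n ℕ.+ k)

  w-antitone : ∀ n k → w n (suc k) ≤ w n k
  w-antitone n k = ≤-trans (*-monoˡ (w n k) (w-nonNeg n k) (frac-≤ {n ℕ.∸ k} {1} {n ℕ.+ k} {0} (begin
      (n ℕ.∸ k) ℕ.* 1       ≡⟨ ℕ.*-identityʳ _ ⟩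
      n ℕ.∸ k               ≤⟨ ℕ.m∸n≤m n k ⟩
      n                     ≤⟨ ℕ.m≤m+n n k ⟩
      n ℕ.+ k               ≤⟨ ℕ.n≤1+n _ ⟩
      suc (n ℕ.+ k)         ≡⟨ sym (ℕ.*-identityˡ _) ⟩
      1 ℕ.* suc (n ℕ.+ k) ∎)))
    (≤-reflexive (*-identityʳ (w n k)))
    where open ℕ.≤-Reasoning

  w≤1 : ∀ n k → w n k ≤ 1ℚ
  w≤1 n zero    = ≤-refl
  w≤1 n (suc k) = ≤-trans (w-antitone n k) (w≤1 n k)

  -- In factorials, `w n k` is n!² / ((n-k)! (n+k)!), so neighbouring rows differ by (n+1)² /
  -- ((n+1)² - k²). For k > n + 1 both sides vanish.
  w-shift : ∀ n k → (ι n + 1ℚ - ι k) * (ι n + 1ℚ + ι k) * w (suc n) k ≡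
                    (ι n + 1ℚ) * (ι n + 1ℚ) * w n k
  w-shift n zero = trans (cong (λ z → (ι n + 1ℚ - z) * (ι n + 1ℚ + z) * 1ℚ) ι-0)
    (solve 1 (λ x → (x :+ con 1ℚ :- con 0ℚ) :* (x :+ con 1ℚ :+ con 0ℚ) :* con 1ℚ
                 := (x :+ con 1ℚ) :* (x :+ con 1ℚ) :* con 1ℚ) refl (ι n))
  w-shift n (suc k) with k ℕ.≤? n
  ... | no k≰n = trans (zeroʳ ((ι n + 1ℚ - ι (suc k)) * (ι n + 1ℚ + ι (suc k))) (w-vanishes (suc n) k n<k))
                   (sym (zeroʳ ((ι n + 1ℚ) * (ι n + 1ℚ)) (w-vanishes n k (ℕ.<⇒≤ n<k))))
    where
    n<k : n ℕ.< k
    n<k = ℕ.≰⇒> k≰n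
  ... | yes k≤n = cancel-≡ (ι (suc (n ℕ.+ k))) (ι-pos (n ℕ.+ k)) (begin
    ι (suc (n ℕ.+ k)) * ((x + 1ℚ - ι (suc k)) * (x + 1ℚ + ι (suc k)) * w (suc n) (suc k))
      ≡⟨ cong₂ (λ s z → s * ((x + 1ℚ - z) * (x + 1ℚ + z) * w (suc n) (suc k))) s-eq (ι-suc k) ⟩
    (x + y + 1ℚ) * ((x + 1ℚ - (y + 1ℚ)) * (x + 1ℚ + (y + 1ℚ)) * w (suc n) (suc k))
      ≡⟨ solve 3 (λ x y v → (x :+ y :+ con 1ℚ) :* ((x :+ con 1ℚ :- (y :+ con 1ℚ)) :*
             (x :+ con 1ℚ :+ (y :+ con 1ℚ)) :* v)
           := (x :+ y :+ con 1ℚ) :* (x :- y) :* (v :* (x :+ con 1ℚ :+ y :+ con 1ℚ)))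
           refl x y (w (suc n) (suc k)) ⟩
    (x + y + 1ℚ) * (x - y) * (w (suc n) (suc k) * (x + 1ℚ + y + 1ℚ))
      ≡⟨ cong ((x + y + 1ℚ) * (x - y) *_) (subst
           (λ z → w (suc n) (suc k) * (z + y + 1ℚ) ≡ w (suc n) k * (z - y)) (ι-suc n)
           (w-step (suc n) k (ℕ.m≤n⇒m≤1+n k≤n))) ⟩
    (x + y + 1ℚ) * (x - y) * (w (suc n) k * (x + 1ℚ - y))
      ≡⟨ solve 3 (λ x y v → (x :+ y :+ con 1ℚ) :* (x :- y) :* (v :* (x :+ con 1ℚ :- y))
           := (x :- y) :* ((x :+ con 1ℚ :- y) :* (x :+ con 1ℚ :+ y) :* v)) refl x y (w (suc n) k) ⟩
    (x - y) * ((x + 1ℚ - y) * (x + 1ℚ + y) * w (suc n) k)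
      ≡⟨ cong ((x - y) *_) (w-shift n k) ⟩
    (x - y) * ((x + 1ℚ) * (x + 1ℚ) * w n k)
      ≡⟨ solve 3 (λ x y v → (x :- y) :* ((x :+ con 1ℚ) :* (x :+ con 1ℚ) :* v)
           := (x :+ con 1ℚ) :* (x :+ con 1ℚ) :* (v :* (x :- y))) refl x y (w n k) ⟩
    (x + 1ℚ) * (x + 1ℚ) * (w n k * (x - y))
      ≡⟨ cong ((x + 1ℚ) * (x + 1ℚ) *_) (sym (w-step n k k≤n)) ⟩
    (x + 1ℚ) * (x + 1ℚ) * (w n (suc k) * (x + y + 1ℚ))
      ≡⟨ solve 3 (λ a v s → a :* (v :* s) := s :* (a :* v)) refl
           ((x + 1ℚ) * (x + 1ℚ)) (w n (suc k)) (x + y + 1ℚ) ⟩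
    (x + y + 1ℚ) * ((x + 1ℚ) * (x + 1ℚ) * w n (suc k))
      ≡⟨ cong (_* ((x + 1ℚ) * (x + 1ℚ) * w n (suc k))) (sym s-eq) ⟩
    ι (suc (n ℕ.+ k)) * ((x + 1ℚ) * (x + 1ℚ) * w n (suc k)) ∎)
    where
    open ≡-Reasoning
    x y : ℚ
    x = ι n
    y = ι k
    s-eq : ι (suc (n ℕ.+ k)) ≡ x + y + 1ℚ
    s-eq = trans (ι-suc (n ℕ.+ k)) (cong (_+ 1ℚ) (ι-+ n k))

  -- The alternating sum of the tail of a row of binomial coefficients telescopes.
  alt-w : ∀ n k d → n ℕ.< k ℕ.+ d → (ι n + ι n) * alt (λ j → w n (k ℕ.+ j)) d ≡ w n k * (ι n + ι k)
  alt-w n zero    zero    ()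
  alt-w n (suc k) zero    n<k = trans (*-zeroʳ (ι n + ι n)) (sym (zeroˡ (ι n + ι (suc k))
    (w-vanishes n k (ℕ.≤-pred (subst (n ℕ.<_) (ℕ.+-identityʳ (suc k)) n<k)))))
  alt-w n k (suc d) n<k+d = begin
    (x + x) * (w n (k ℕ.+ 0) - alt (λ j → w n (k ℕ.+ suc j)) d)
      ≡⟨ cong₂ (λ i t → (x + x) * (w n i - t)) (ℕ.+-identityʳ k)
           (alt-cong d λ j → cong (w n) (ℕ.+-suc k j)) ⟩
    (x + x) * (w n k - alt (λ j → w n (suc k ℕ.+ j)) d)
      ≡⟨ solve 3 (λ x v t → (x :+ x) :* (v :- t) := (x :+ x) :* v :- (x :+ x) :* t) refl x (w n k) _ ⟩
    (x + x) * w n k - (x + x) * alt (λ j → w n (suc k ℕ.+ j)) d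
      ≡⟨ cong (_-_ ((x + x) * w n k)) (trans (alt-w n (suc k) d (subst (n ℕ.<_) (ℕ.+-suc k d) n<k+d)) next) ⟩
    (x + x) * w n k - w n k * (x - y)
      ≡⟨ solve 3 (λ x y v → (x :+ x) :* v :- v :* (x :- y) := v :* (x :+ y)) refl x y (w n k) ⟩
    w n k * (x + y) ∎
    where
    open ≡-Reasoning
    x y : ℚ
    x = ι n
    y = ι k
    vanishes : ∀ k → n ℕ.< k → w n k ≡ 0ℚ
    vanishes (suc k) n<k = w-vanishes n k (ℕ.≤-pred n<k)
    next : w n (suc k) * (x + ι (suc k)) ≡ w n k * (x - y)
    next with k ℕ.≤? n
    ... | yes k≤n = trans (cong (w n (suc k) *_) (trans (cong (x +_) (ι-suc k)) (sym (+-assoc x y 1ℚ))))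
                      (w-step n k k≤n)
    ... | no k≰n  = trans (zeroˡ (x + ι (suc k)) (w-vanishes n k (ℕ.<⇒≤ n<k)))
                      (sym (zeroˡ (x - y) (vanishes k n<k)))
      where
      n<k : n ℕ.< k
      n<k = ℕ.≰⇒> k≰n

  -- The alternating sum of the entire row, k from -(n+1) to n+1, is 0; by symmetry each half
  -- cancels half of the central term 1.
  alt-w-row : ∀ n d → n ℕ.< d → alt (w (suc n) ∘ suc) d ≡ ½
  alt-w-row n d n<d = cancel-≡ (ι (suc n) + ι (suc n)) (+-mono-< (ι-pos n) (ι-pos n)) (begin
    (x + x) * alt (w (suc n) ∘ suc) d
      ≡⟨ alt-w (suc n) 1 d (ℕ.s≤s n<d) ⟩
    w (suc n) 1 * (x + ι 1)
      ≡⟨ cong (w (suc n) 1 *_) (solve 2 (λ x y → x :+ y := x :+ con 0ℚ :+ y) refl x (ι 1)) ⟩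
    w (suc n) 1 * (x + 0ℚ + ι 1)
      ≡⟨ cong₂ (λ u v → w (suc n) 1 * (x + u + v)) (sym ι-0) ι-1 ⟩
    w (suc n) 1 * (x + ι 0 + 1ℚ)
      ≡⟨ w-step (suc n) 0 ℕ.z≤n ⟩
    1ℚ * (x - ι 0)
      ≡⟨ cong (λ u → 1ℚ * (x - u)) ι-0 ⟩
    1ℚ * (x - 0ℚ)
      ≡⟨ solve 1 (λ x → con 1ℚ :* (x :- con 0ℚ) := (x :+ x) :* con ½) refl x ⟩
    (x + x) * ½ ∎)
    where
    open ≡-Reasoning
    x : ℚ
    x = ι (suc n)

-- Wallis' formula and two-sided bounds for π.

module WallisLimit where

  open import Data.Nat.Base as ℕ using (ℕ; zero; suc)
  import Data.Nat.Properties as ℕ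
  open import Data.Nat.Tactic.RingSolver using (solve-∀)
  open import Data.Product.Base using (_×_; _,_; proj₁; proj₂)
  open import Data.Rational.Base
  open import Data.Rational.Properties
  open import Data.Rational.Solver using (module +-*-Solver)
  open import Function.Base using (_∘_)
  open import Relation.Binary.PropositionalEquality
  open import Relation.Nullary using (yes; no)
  open import Defs using (module Rational; Eventually)
  open +-*-Solver
  open Rational
  open RationalArithmetic
  open Wallis

  2ℚ 4ℚ : ℚ
  2ℚ = 1ℚ + 1ℚ
  4ℚ = 2ℚ + 2ℚ

  -- 2/(4k²-1) for k = j+1
  ℓ : ℕ → ℚ
  ℓ j = frac 2 (4 ℕ.* (j ℕ.* j) ℕ.+ 8 ℕ.* j ℕ.+ 2)

  ℓ-eq : ∀ j → ℓ j * ((ι j + ι j + 1ℚ) * (ι j + ι j + 1ℚ + 2ℚ)) ≡ 2ℚ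
  ℓ-eq j = trans (cong (ℓ j *_) (sym denominator)) (trans (frac-ι 2 (4 ℕ.* (j ℕ.* j) ℕ.+ 8 ℕ.* j ℕ.+ 2)) ι-2)
    where
    open ≡-Reasoning
    lem : ∀ j → suc (4 ℕ.* (j ℕ.* j) ℕ.+ 8 ℕ.* j ℕ.+ 2) ≡ suc (2 ℕ.* j) ℕ.* (suc (2 ℕ.* j) ℕ.+ 2)
    lem = solve-∀
    odd : ι (suc (2 ℕ.* j)) ≡ ι j + ι j + 1ℚ
    odd = trans (ι-suc (2 ℕ.* j)) (cong (_+ 1ℚ) (ι-double j))
    denominator : ι (suc (4 ℕ.* (j ℕ.* j) ℕ.+ 8 ℕ.* j ℕ.+ 2)) ≡ (ι j + ι j + 1ℚ) * (ι j + ι j + 1ℚ + 2ℚ)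
    denominator = begin
      ι (suc (4 ℕ.* (j ℕ.* j) ℕ.+ 8 ℕ.* j ℕ.+ 2))
        ≡⟨ trans (cong ι (lem j)) (ι-* (suc (2 ℕ.* j)) _) ⟩
      ι (suc (2 ℕ.* j)) * ι (suc (2 ℕ.* j) ℕ.+ 2)
        ≡⟨ cong₂ _*_ odd (trans (ι-+ (suc (2 ℕ.* j)) 2) (cong₂ _+_ odd ι-2)) ⟩
      (ι j + ι j + 1ℚ) * (ι j + ι j + 1ℚ + 2ℚ) ∎

  ℓ-nonNeg : ∀ j → 0ℚ ≤ ℓ j
  ℓ-nonNeg j = frac-nonNeg 2 (4 ℕ.* (j ℕ.* j) ℕ.+ 8 ℕ.* j ℕ.+ 2)

  ℓ-antitone : ∀ j → ℓ (suc j) ≤ ℓ j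
  ℓ-antitone j = frac-≤ {2} {2} {4 ℕ.* (suc j ℕ.* suc j) ℕ.+ 8 ℕ.* suc j ℕ.+ 2} {4 ℕ.* (j ℕ.* j) ℕ.+ 8 ℕ.* j ℕ.+ 2}
    (ℕ.*-monoʳ-≤ 2 (ℕ.s≤s (ℕ.+-monoˡ-≤ 2 (ℕ.+-mono-≤
      (ℕ.*-monoʳ-≤ 4 (ℕ.*-mono-≤ (ℕ.n≤1+n j) (ℕ.n≤1+n j))) (ℕ.*-monoʳ-≤ 8 (ℕ.n≤1+n j))))))

  ℓ≤frac : ∀ j → ℓ j ≤ frac 1 j
  ℓ≤frac j = frac-≤ {2} {1} {4 ℕ.* (j ℕ.* j) ℕ.+ 8 ℕ.* j ℕ.+ 2} {j}
    (ℕ.≤-trans (ℕ.m≤m+n _ (4 ℕ.* (j ℕ.* j) ℕ.+ 6 ℕ.* j ℕ.+ 1)) (ℕ.≤-reflexive (lem j)))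
    where
    lem : ∀ j → 2 ℕ.* suc j ℕ.+ (4 ℕ.* (j ℕ.* j) ℕ.+ 6 ℕ.* j ℕ.+ 1)
              ≡ 1 ℕ.* suc (4 ℕ.* (j ℕ.* j) ℕ.+ 8 ℕ.* j ℕ.+ 2)
    lem = solve-∀

  leibniz-eq : ∀ j → leibniz j * (ι j + ι j + 1ℚ) ≡ 4ℚ
  leibniz-eq j = trans (cong (leibniz j *_) (sym (trans (ι-suc (2 ℕ.* j)) (cong (_+ 1ℚ) (ι-double j)))))
    (trans (frac-ι 4 (2 ℕ.* j)) (trans (ι-double 2) (cong₂ _+_ ι-2 ι-2)))

  leibniz-difference : ∀ j → 4ℚ * ℓ j ≡ leibniz j - leibniz (suc j)
  leibniz-difference j = cancel-≡ (a * b) (0<* 0<a 0<b) (begin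
    a * b * (4ℚ * ℓ j)
      ≡⟨ solve 3 (λ a b l → a :* b :* (con 4ℚ :* l) := con 4ℚ :* (l :* (a :* b))) refl a b (ℓ j) ⟩
    4ℚ * (ℓ j * (a * b))
      ≡⟨ cong (4ℚ *_) (ℓ-eq j) ⟩
    4ℚ * 2ℚ
      ≡⟨ solve 1 (λ a → con 4ℚ :* con 2ℚ := con 4ℚ :* (a :+ con 2ℚ) :- con 4ℚ :* a) refl a ⟩
    4ℚ * b - 4ℚ * a
      ≡⟨ cong₂ (λ u v → u * b - v * a) (sym (leibniz-eq j)) (sym next) ⟩
    leibniz j * a * b - leibniz (suc j) * b * a
      ≡⟨ solve 4 (λ a b u v → u :* a :* b :- v :* b :* a := a :* b :* (u :- v)) refl
           a b (leibniz j) (leibniz (suc j)) ⟩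
    a * b * (leibniz j - leibniz (suc j)) ∎)
    where
    open ≡-Reasoning
    a b : ℚ
    a = ι j + ι j + 1ℚ
    b = a + 2ℚ
    next : leibniz (suc j) * b ≡ 4ℚ
    next = trans (cong (leibniz (suc j) *_) (trans
      (solve 1 (λ y → y :+ y :+ con 1ℚ :+ con 2ℚ := y :+ con 1ℚ :+ (y :+ con 1ℚ) :+ con 1ℚ) refl (ι j))
      (cong (λ z → z + z + 1ℚ) (sym (ι-suc j))))) (leibniz-eq (suc j))
    0<a : 0ℚ < a
    0<a = subst (0ℚ <_) (trans (ι-suc (2 ℕ.* j)) (cong (_+ 1ℚ) (ι-double j))) (ι-pos (2 ℕ.* j))
    0<b : 0ℚ < b
    0<b = <-≤-trans 0<a (p≤p+q (<⇒≤ (positive⁻¹ 2ℚ)))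

  -- As `w n k` tends to 1 for fixed k, `ℓ` is the limit of `a n`. The sum 1 + `alt ℓ` is thus
  -- identified as π/2, through two consecutive partial sums of the Leibniz series.
  alt-ℓ : ∀ d → 4ℚ * (1ℚ + alt ℓ d) ≡ alt leibniz d + alt leibniz (suc d)
  alt-ℓ d = begin
    4ℚ * (1ℚ + alt ℓ d)
      ≡⟨ solve 1 (λ e → con 4ℚ :* (con 1ℚ :+ e) := con 4ℚ :+ con 4ℚ :* e) refl (alt ℓ d) ⟩
    4ℚ + 4ℚ * alt ℓ d
      ≡⟨ cong (4ℚ +_) (sym (alt-scale d 4ℚ ℓ)) ⟩
    4ℚ + alt (λ j → 4ℚ * ℓ j) d
      ≡⟨ cong (4ℚ +_) (alt-cong d λ j → trans (leibniz-difference j)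
           (solve 2 (λ u v → u :- v := con (- 1ℚ) :* v :+ u) refl (leibniz j) (leibniz (suc j)))) ⟩
    4ℚ + alt (λ j → - 1ℚ * leibniz (suc j) + leibniz j) d
      ≡⟨ cong (4ℚ +_) (alt-linear d (- 1ℚ) (leibniz ∘ suc) leibniz) ⟩
    4ℚ + (- 1ℚ * alt (leibniz ∘ suc) d + alt leibniz d)
      ≡⟨ solve 2 (λ s p → con 4ℚ :+ (con (- 1ℚ) :* s :+ p) := p :+ (con 4ℚ :- s)) refl
           (alt (leibniz ∘ suc) d) (alt leibniz d) ⟩
    alt leibniz d + (4ℚ - alt (leibniz ∘ suc) d) ∎
    where open ≡-Reasoning

  -- Collecting the terms of ±k, one finds that 1 + a n 0 - a n 1 + … is the sum of
  -- (-1)ᵏ w n |k| / (2k+1) over all integers k, which is a product by partial fractions.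
  a : ℕ → ℕ → ℚ
  a n j = w n (suc j) * ℓ j

  -- For k = j + 1, split (2n+1)(2n+3) = 4((n+1)² - k²) + (4k² - 1). The first part is absorbed by
  -- `w-shift`, the second cancels the denominator of `ℓ j`.
  a-shift : ∀ n j → (ι n + ι n + 1ℚ) * (ι n + ι n + 1ℚ + 2ℚ) * a (suc n) j ≡
    (ι n + ι n + 2ℚ) * (ι n + ι n + 2ℚ) * a n j + 2ℚ * w (suc n) (suc j)
  a-shift n j = sym (begin
    (x + x + 2ℚ) * (x + x + 2ℚ) * (w n (suc j) * l) + 2ℚ * w′
      ≡⟨ solve 4 (λ x v l w′ → (x :+ x :+ con 2ℚ) :* (x :+ x :+ con 2ℚ) :* (v :* l) :+ con 2ℚ :* w′
           := con 4ℚ :* l :* ((x :+ con 1ℚ) :* (x :+ con 1ℚ) :* v) :+ con 2ℚ :* w′) refl x (w n (suc j)) l w′ ⟩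
    4ℚ * l * ((x + 1ℚ) * (x + 1ℚ) * w n (suc j)) + 2ℚ * w′
      ≡⟨ cong₂ (λ u v → 4ℚ * l * u + v * w′) (sym (subst
           (λ z → (x + 1ℚ - z) * (x + 1ℚ + z) * w′ ≡ (x + 1ℚ) * (x + 1ℚ) * w n (suc j)) (ι-suc j) (w-shift n (suc j))))
           (sym (ℓ-eq j)) ⟩
    4ℚ * l * ((x + 1ℚ - (y + 1ℚ)) * (x + 1ℚ + (y + 1ℚ)) * w′) + l * ((y + y + 1ℚ) * (y + y + 1ℚ + 2ℚ)) * w′
      ≡⟨ solve 4 (λ x y l w′ → con 4ℚ :* l :* ((x :+ con 1ℚ :- (y :+ con 1ℚ)) :* (x :+ con 1ℚ :+ (y :+ con 1ℚ)) :* w′)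
             :+ l :* ((y :+ y :+ con 1ℚ) :* (y :+ y :+ con 1ℚ :+ con 2ℚ)) :* w′
           := (x :+ x :+ con 1ℚ) :* (x :+ x :+ con 1ℚ :+ con 2ℚ) :* (w′ :* l)) refl x y l w′ ⟩
    (x + x + 1ℚ) * (x + x + 1ℚ + 2ℚ) * (w′ * l) ∎)
    where
    open ≡-Reasoning
    x y l w′ : ℚ
    x = ι n
    y = ι j
    l = ℓ j
    w′ = w (suc n) (suc j)

  -- The inhomogeneous terms of `a-shift` sum to 1, which is exactly (2n+2)² - (2n+1)(2n+3); hence
  -- the recurrence of 1 + `alt (a n)` is homogeneous.
  alt-a-shift : ∀ n d → n ℕ.< d → (ι n + ι n + 1ℚ) * (ι n + ι n + 1ℚ + 2ℚ) * (1ℚ + alt (a (suc n)) d) ≡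
    (ι n + ι n + 2ℚ) * (ι n + ι n + 2ℚ) * (1ℚ + alt (a n) d)
  alt-a-shift n d n<d = begin
    A * (1ℚ + alt (a (suc n)) d)
      ≡⟨ solve 2 (λ A e → A :* (con 1ℚ :+ e) := A :+ A :* e) refl A (alt (a (suc n)) d) ⟩
    A + A * alt (a (suc n)) d
      ≡⟨ cong (A +_) (begin
           A * alt (a (suc n)) d
             ≡⟨ sym (alt-scale d A (a (suc n))) ⟩
           alt (λ j → A * a (suc n) j) d
             ≡⟨ alt-cong d (a-shift n) ⟩
           alt (λ j → C * a n j + 2ℚ * w (suc n) (suc j)) d
             ≡⟨ alt-linear d C (a n) (λ j → 2ℚ * w (suc n) (suc j)) ⟩
           C * alt (a n) d + alt (λ j → 2ℚ * w (suc n) (suc j)) d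
             ≡⟨ cong (C * alt (a n) d +_) (trans (alt-scale d 2ℚ (w (suc n) ∘ suc))
                  (cong (2ℚ *_) (alt-w-row n d n<d))) ⟩
           C * alt (a n) d + 1ℚ ∎) ⟩
    A + (C * alt (a n) d + 1ℚ)
      ≡⟨ solve 2 (λ x e → (x :+ x :+ con 1ℚ) :* (x :+ x :+ con 1ℚ :+ con 2ℚ) :+
             ((x :+ x :+ con 2ℚ) :* (x :+ x :+ con 2ℚ) :* e :+ con 1ℚ)
           := (x :+ x :+ con 2ℚ) :* (x :+ x :+ con 2ℚ) :* (con 1ℚ :+ e)) refl (ι n) (alt (a n) d) ⟩
    C * (1ℚ + alt (a n) d) ∎
    where
    open ≡-Reasoning
    A C : ℚ
    A = (ι n + ι n + 1ℚ) * (ι n + ι n + 1ℚ + 2ℚ)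
    C = (ι n + ι n + 2ℚ) * (ι n + ι n + 2ℚ)

  -- The central binomial coefficient (2n over n), divided by 4ⁿ.
  β : ℕ → ℚ
  β zero    = 1ℚ
  β (suc n) = β n * frac (2 ℕ.* n ℕ.+ 1) (2 ℕ.* n ℕ.+ 1)

  β-step : ∀ n → β (suc n) * (ι n + ι n + 2ℚ) ≡ β n * (ι n + ι n + 1ℚ)
  β-step n = trans (*-assoc (β n) ρ (ι n + ι n + 2ℚ)) (cong (β n *_) (trans
      (cong (ρ *_) (trans
        (solve 1 (λ x → x :+ x :+ con 2ℚ := x :+ x :+ con 1ℚ :+ con 1ℚ) refl (ι n))
        (trans (cong (_+ 1ℚ) (sym odd)) (sym (ι-suc (2 ℕ.* n ℕ.+ 1))))))
      (trans (frac-ι (2 ℕ.* n ℕ.+ 1) (2 ℕ.* n ℕ.+ 1)) odd)))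
    where
    ρ : ℚ
    ρ = frac (2 ℕ.* n ℕ.+ 1) (2 ℕ.* n ℕ.+ 1)
    odd : ι (2 ℕ.* n ℕ.+ 1) ≡ ι n + ι n + 1ℚ
    odd = trans (ι-+ (2 ℕ.* n) 1) (cong₂ _+_ (ι-double n) ι-1)

  β-nonNeg : ∀ n → 0ℚ ≤ β n
  β-nonNeg zero    = <⇒≤ 0<1
  β-nonNeg (suc n) = 0≤* (β-nonNeg n) (frac-nonNeg (2 ℕ.* n ℕ.+ 1) (2 ℕ.* n ℕ.+ 1))

  -- Both tend to 2/π, `c` from above and `c⁻` from below.
  c c⁻ : ℕ → ℚ
  c  n = β n * β n * (ι n + ι n + 1ℚ)
  c⁻ n = β n * β n * (ι n + ι n)

  private
    0≤2n : ∀ n → 0ℚ ≤ ι n + ι n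
    0≤2n n = 0≤+ (ι-nonNeg n) (ι-nonNeg n)

    0<2n+2 : ∀ n → 0ℚ < ι n + ι n + 2ℚ
    0<2n+2 n = <-≤-trans (positive⁻¹ 2ℚ) (subst (2ℚ ≤_) (+-comm 2ℚ (ι n + ι n)) (p≤p+q (0≤2n n)))

    β²-step : ∀ n y → (ι n + ι n + 2ℚ) * (ι n + ι n + 2ℚ) * (β (suc n) * β (suc n) * y) ≡
              β n * β n * ((ι n + ι n + 1ℚ) * (ι n + ι n + 1ℚ) * y)
    β²-step n y = begin
      t * t * (β′ * β′ * y)
        ≡⟨ solve 3 (λ t b y → t :* t :* (b :* b :* y) := (b :* t) :* (b :* t) :* y) refl t β′ y ⟩
      (β′ * t) * (β′ * t) * y
        ≡⟨ cong (λ u → u * u * y) (β-step n) ⟩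
      (β n * s) * (β n * s) * y
        ≡⟨ solve 3 (λ b s y → (b :* s) :* (b :* s) :* y := b :* b :* (s :* s :* y)) refl (β n) s y ⟩
      β n * β n * (s * s * y) ∎
      where
      open ≡-Reasoning
      t s β′ : ℚ
      t = ι n + ι n + 2ℚ
      s = ι n + ι n + 1ℚ
      β′ = β (suc n)

  -- The recurrence `alt-a-shift` is inverse to that of `c`. The terms of `a n` vanish from index n
  -- on, so any d ≥ n gives the full sum and d stays fixed in the induction.
  wallis : ∀ n d → n ℕ.≤ d → (1ℚ + alt (a n) d) * c n ≡ 1ℚ
  wallis zero d _ = trans
    (cong₂ (λ e z → (1ℚ + e) * (1ℚ * 1ℚ * (z + z + 1ℚ))) (alt-zero d a-zero) ι-0) refl
    where
    a-zero : ∀ j → a 0 j ≡ 0ℚ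
    a-zero j = zeroˡ (ℓ j) (w-vanishes 0 j ℕ.z≤n)
  wallis (suc n) d n<d = cancel-≡ (t * t) (0<* (0<2n+2 n) (0<2n+2 n)) (begin
    t * t * (V′ * (β (suc n) * β (suc n) * (ι (suc n) + ι (suc n) + 1ℚ)))
      ≡⟨ cong (λ z → t * t * (V′ * (β (suc n) * β (suc n) * (z + z + 1ℚ)))) (ι-suc n) ⟩
    t * t * (V′ * (β (suc n) * β (suc n) * (x + 1ℚ + (x + 1ℚ) + 1ℚ)))
      ≡⟨ solve 4 (λ T V b y → T :* (V :* (b :* y)) := V :* (T :* (b :* y))) refl
           (t * t) V′ (β (suc n) * β (suc n)) (x + 1ℚ + (x + 1ℚ) + 1ℚ) ⟩
    V′ * (t * t * (β (suc n) * β (suc n) * (x + 1ℚ + (x + 1ℚ) + 1ℚ)))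
      ≡⟨ cong (V′ *_) (β²-step n (x + 1ℚ + (x + 1ℚ) + 1ℚ)) ⟩
    V′ * (β n * β n * (s * s * (x + 1ℚ + (x + 1ℚ) + 1ℚ)))
      ≡⟨ solve 3 (λ V b x → V :* (b :* b :* ((x :+ x :+ con 1ℚ) :* (x :+ x :+ con 1ℚ) :*
             (x :+ con 1ℚ :+ (x :+ con 1ℚ) :+ con 1ℚ)))
           := b :* b :* (x :+ x :+ con 1ℚ) :* ((x :+ x :+ con 1ℚ) :* (x :+ x :+ con 1ℚ :+ con 2ℚ) :* V))
           refl V′ (β n) x ⟩
    c n * (s * (s + 2ℚ) * V′)
      ≡⟨ cong (c n *_) (alt-a-shift n d n<d) ⟩
    c n * (t * t * V)
      ≡⟨ solve 3 (λ c T V → c :* (T :* V) := T :* (V :* c)) refl (c n) (t * t) V ⟩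
    t * t * (V * c n)
      ≡⟨ cong (t * t *_) (wallis n d (ℕ.<⇒≤ n<d)) ⟩
    t * t * 1ℚ ∎)
    where
    open ≡-Reasoning
    x t s V V′ : ℚ
    x = ι n
    t = x + x + 2ℚ
    s = x + x + 1ℚ
    V = 1ℚ + alt (a n) d
    V′ = 1ℚ + alt (a (suc n)) d

  c-antitone : ∀ n → c (suc n) ≤ c n
  c-antitone n = cancel-≤ (t * t) (0<* (0<2n+2 n) (0<2n+2 n)) (0≤-diff
    (0≤* (0≤* (β-nonNeg n) (β-nonNeg n)) (0≤+ (0≤2n n) (<⇒≤ 0<1))) (begin
      t * t * (β (suc n) * β (suc n) * (ι (suc n) + ι (suc n) + 1ℚ)) + c n
        ≡⟨ cong (_+ c n) (trans (cong (λ z → t * t * (β (suc n) * β (suc n) * (z + z + 1ℚ))) (ι-suc n))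
             (β²-step n (ι n + 1ℚ + (ι n + 1ℚ) + 1ℚ))) ⟩
      β n * β n * ((x + x + 1ℚ) * (x + x + 1ℚ) * (x + 1ℚ + (x + 1ℚ) + 1ℚ)) + c n
        ≡⟨ solve 2 (λ b x → b :* b :* ((x :+ x :+ con 1ℚ) :* (x :+ x :+ con 1ℚ) :*
               (x :+ con 1ℚ :+ (x :+ con 1ℚ) :+ con 1ℚ)) :+ b :* b :* (x :+ x :+ con 1ℚ)
             := (x :+ x :+ con 2ℚ) :* (x :+ x :+ con 2ℚ) :* (b :* b :* (x :+ x :+ con 1ℚ))) refl (β n) x ⟩
      t * t * c n ∎))
    where
    open ≡-Reasoning
    x t : ℚ
    x = ι n
    t = x + x + 2ℚ

  c⁻-monotone : ∀ n → c⁻ n ≤ c⁻ (suc n)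
  c⁻-monotone n = cancel-≤ (t * t) (0<* (0<2n+2 n) (0<2n+2 n)) (0≤-diff
    (0≤* (0≤* (β-nonNeg n) (β-nonNeg n)) (<⇒≤ (0<2n+2 n))) (begin
      t * t * c⁻ n + β n * β n * t
        ≡⟨ solve 2 (λ b x → (x :+ x :+ con 2ℚ) :* (x :+ x :+ con 2ℚ) :* (b :* b :* (x :+ x)) :+ b :* b :* (x :+ x :+ con 2ℚ)
             := b :* b :* ((x :+ x :+ con 1ℚ) :* (x :+ x :+ con 1ℚ) :* (x :+ con 1ℚ :+ (x :+ con 1ℚ)))) refl (β n) x ⟩
      β n * β n * ((x + x + 1ℚ) * (x + x + 1ℚ) * (x + 1ℚ + (x + 1ℚ)))
        ≡⟨ sym (trans (cong (λ z → t * t * (β (suc n) * β (suc n) * (z + z))) (ι-suc n))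
             (β²-step n (ι n + 1ℚ + (ι n + 1ℚ)))) ⟩
      t * t * c⁻ (suc n) ∎))
    where
    open ≡-Reasoning
    x t : ℚ
    x = ι n
    t = x + x + 2ℚ

  private
    iterate : (f : ℕ → ℚ) → (∀ n → f (suc n) ≤ f n) → ∀ {m n} → m ℕ.≤ n → f n ≤ f m
    iterate f h {m} m≤n = go (ℕ.≤⇒≤′ m≤n)
      where
      go : ∀ {n} → m ℕ.≤′ n → f n ≤ f m
      go (ℕ.≤′-reflexive refl) = ≤-refl
      go (ℕ.≤′-step m≤n)       = ≤-trans (h _) (go m≤n)

  c-≤ : ∀ {m n} → m ℕ.≤ n → c n ≤ c m
  c-≤ = iterate c c-antitone

  c⁻-≤ : ∀ {m n} → m ℕ.≤ n → c⁻ m ≤ c⁻ n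
  c⁻-≤ {m} {n} m≤n = subst₂ _≤_ (neg-involutive (c⁻ m)) (neg-involutive (c⁻ n))
    (neg-antimono-≤ (iterate (λ k → - c⁻ k) (λ k → neg-antimono-≤ (c⁻-monotone k)) m≤n))
    where
    neg-involutive : ∀ p → - (- p) ≡ p
    neg-involutive = solve 1 (λ p → :- (:- p) := p) refl

  c⁻≤c : ∀ n → c⁻ n ≤ c n
  c⁻≤c n = *-monoˡ (β n * β n) (0≤* (β-nonNeg n) (β-nonNeg n)) (p≤p+q (<⇒≤ 0<1))

  c-nonNeg : ∀ n → 0ℚ ≤ c n
  c-nonNeg n = 0≤* (0≤* (β-nonNeg n) (β-nonNeg n)) (0≤+ (0≤2n n) (<⇒≤ 0<1))

  c≤1 : ∀ n → c n ≤ 1ℚ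
  c≤1 n = ≤-trans (c-≤ {0} {n} ℕ.z≤n) (≤-reflexive (cong (λ z → 1ℚ * 1ℚ * (z + z + 1ℚ)) ι-0))

  -- `w n k` resembles exp(-k²/n). Passing from k to k + 1 loses at most (2k+1)/n, and the odd
  -- numbers add up to a square.
  1-w : ∀ n k → ι n * (1ℚ - w n k) ≤ ι k * ι k
  1-w n zero = ≤-reflexive (trans (*-zeroʳ (ι n)) (sym (cong (λ z → z * z) ι-0)))
  1-w n (suc k) with k ℕ.≤? n
  ... | yes k≤n = begin
    x * (1ℚ - w′)
      ≡⟨ solve 3 (λ x v v′ → x :* (con 1ℚ :- v′) := x :* (con 1ℚ :- v) :+ x :* (v :- v′)) refl x v w′ ⟩
    x * (1ℚ - v) + x * (v - w′)
      ≤⟨ +-mono-≤ (1-w n k) (0≤-diff (0≤* (0≤+ (ι-nonNeg k) (<⇒≤ 0<1)) 0≤v-w′)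
           (solve 3 (λ x y d → x :* d :+ (y :+ con 1ℚ) :* d := (x :+ y :+ con 1ℚ) :* d) refl x y (v - w′))) ⟩
    y * y + (x + y + 1ℚ) * (v - w′)
      ≡⟨ cong (y * y +_) (begin-equality
           (x + y + 1ℚ) * (v - w′)
             ≡⟨ solve 3 (λ t v v′ → t :* (v :- v′) := t :* v :- v′ :* t) refl (x + y + 1ℚ) v w′ ⟩
           (x + y + 1ℚ) * v - w′ * (x + y + 1ℚ)
             ≡⟨ cong (_-_ ((x + y + 1ℚ) * v)) (w-step n k k≤n) ⟩
           (x + y + 1ℚ) * v - v * (x - y)
             ≡⟨ solve 3 (λ x y v → (x :+ y :+ con 1ℚ) :* v :- v :* (x :- y) := (y :+ y :+ con 1ℚ) :* v) refl x y v ⟩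
           (y + y + 1ℚ) * v ∎) ⟩
    y * y + (y + y + 1ℚ) * v
      ≤⟨ +-monoʳ-≤ (y * y) (*-monoˡ (y + y + 1ℚ) (0≤+ (0≤2n k) (<⇒≤ 0<1)) (w≤1 n k)) ⟩
    y * y + (y + y + 1ℚ) * 1ℚ
      ≡⟨ solve 1 (λ y → y :* y :+ (y :+ y :+ con 1ℚ) :* con 1ℚ := (y :+ con 1ℚ) :* (y :+ con 1ℚ)) refl y ⟩
    (y + 1ℚ) * (y + 1ℚ)
      ≡⟨ cong (λ z → z * z) (sym (ι-suc k)) ⟩
    ι (suc k) * ι (suc k) ∎
    where
    open ≤-Reasoning
    x y v w′ : ℚ
    x = ι n
    y = ι k
    v = w n k
    w′ = w n (suc k)
    0≤v-w′ : 0ℚ ≤ v - w′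
    0≤v-w′ = subst (_≤ v - w′) (+-inverseʳ w′) (+-monoˡ-≤ (- w′) (w-antitone n k))
  ... | no k≰n = begin
    ι n * (1ℚ - w n (suc k))
      ≤⟨ *-monoˡ (ι n) (ι-nonNeg n) (0≤-diff (w-nonNeg n (suc k))
           (solve 1 (λ v → con 1ℚ :- v :+ v := con 1ℚ) refl (w n (suc k)))) ⟩
    ι n * 1ℚ
      ≤⟨ *-mono (ι-nonNeg n) (ι-nonNeg (suc k))
           (ι-mono (ℕ.m≤n⇒m≤1+n (ℕ.<⇒≤ (ℕ.≰⇒> k≰n)))) (subst (_≤ ι (suc k)) ι-1 (ι-mono (ℕ.s≤s ℕ.z≤n))) ⟩
    ι (suc k) * ι (suc k) ∎
    where open ≤-Reasoning

  ℓ-k² : ∀ j → ℓ j * (ι (suc j) * ι (suc j)) ≤ 1ℚ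
  ℓ-k² j = cancel-≤ 2ℚ (positive⁻¹ 2ℚ) (begin
    2ℚ * (ℓ j * (ι (suc j) * ι (suc j)))
      ≡⟨ cong (λ z → 2ℚ * (ℓ j * (z * z))) (ι-suc j) ⟩
    2ℚ * (ℓ j * ((y + 1ℚ) * (y + 1ℚ)))
      ≤⟨ 0≤-diff (0≤* (ℓ-nonNeg j) (0≤+ (0≤* (0≤2n j) (0≤+ (ι-nonNeg j) (<⇒≤ (positive⁻¹ 2ℚ)))) (<⇒≤ 0<1)))
           (solve 2 (λ l y → con 2ℚ :* (l :* ((y :+ con 1ℚ) :* (y :+ con 1ℚ))) :+ l :* ((y :+ y) :* (y :+ con 2ℚ) :+ con 1ℚ)
             := l :* ((y :+ y :+ con 1ℚ) :* (y :+ y :+ con 1ℚ :+ con 2ℚ))) refl (ℓ j) y) ⟩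
    ℓ j * ((y + y + 1ℚ) * (y + y + 1ℚ + 2ℚ))
      ≡⟨ ℓ-eq j ⟩
    2ℚ * 1ℚ ∎)
    where
    open ≤-Reasoning
    y : ℚ
    y = ι j

  -- The k² of `1-w` cancels against the quadratic decay of `ℓ`, so the error 1/n is uniform in j.
  a-close : ∀ n j → ι n * ∣ a n j - ℓ j ∣ ≤ 1ℚ
  a-close n j = begin
    ι n * ∣ w n (suc j) * ℓ j - ℓ j ∣
      ≡⟨ cong (ι n *_) (trans (cong ∣_∣ (solve 2 (λ v l → v :* l :- l := :- ((con 1ℚ :- v) :* l)) refl (w n (suc j)) (ℓ j)))
           (trans (∣-p∣≡∣p∣ ((1ℚ - w n (suc j)) * ℓ j)) (0≤p⇒∣p∣≡p (0≤* 0≤1-w (ℓ-nonNeg j))))) ⟩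
    ι n * ((1ℚ - w n (suc j)) * ℓ j)
      ≡⟨ sym (*-assoc (ι n) _ _) ⟩
    ι n * (1ℚ - w n (suc j)) * ℓ j
      ≤⟨ *-monoʳ (ℓ j) (ℓ-nonNeg j) (1-w n (suc j)) ⟩
    ι (suc j) * ι (suc j) * ℓ j
      ≡⟨ *-comm _ (ℓ j) ⟩
    ℓ j * (ι (suc j) * ι (suc j))
      ≤⟨ ℓ-k² j ⟩
    1ℚ ∎
    where
    open ≤-Reasoning
    0≤1-w : 0ℚ ≤ 1ℚ - w n (suc j)
    0≤1-w = subst (_≤ 1ℚ - w n (suc j)) (+-inverseʳ (w n (suc j))) (+-monoˡ-≤ (- w n (suc j)) (w≤1 n (suc j)))

  a-nonNeg : ∀ n j → 0ℚ ≤ a n j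
  a-nonNeg n j = 0≤* (w-nonNeg n (suc j)) (ℓ-nonNeg j)

  a-antitone : ∀ n j → a n (suc j) ≤ a n j
  a-antitone n j = *-mono (w-nonNeg n (suc (suc j))) (ℓ-nonNeg j) (w-antitone n (suc j)) (ℓ-antitone j)

  a≤ℓ : ∀ n j → a n j ≤ ℓ j
  a≤ℓ n j = ≤-trans (*-monoʳ (ℓ j) (ℓ-nonNeg j) (w≤1 n (suc j))) (≤-reflexive (*-identityˡ (ℓ j)))

  -- The first K+1 terms are close because every term is, the remaining ones because both tails are small.
  alt-a-close : ∀ K n → suc K ℕ.* suc K ℕ.≤ n → ∣ alt ℓ n - alt (a n) n ∣ ≤ frac 1 K + (frac 1 K + frac 1 K)
  alt-a-close K n K²≤n = begin
    ∣ alt ℓ n - alt (a n) n ∣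
      ≡⟨ cong ∣_∣ (solve 4 (λ x x′ y y′ → x :- y := (x :- x′) :+ (:- (y′ :- x′) :+ :- (y :- y′))) refl
           (alt ℓ n) (alt ℓ k) (alt (a n) n) (alt (a n) k)) ⟩
    ∣ (alt ℓ n - alt ℓ k) + (- (alt (a n) k - alt ℓ k) + - (alt (a n) n - alt (a n) k)) ∣
      ≤⟨ ≤-trans (∣p+q∣≤∣p∣+∣q∣ (alt ℓ n - alt ℓ k) (- (alt (a n) k - alt ℓ k) + - (alt (a n) n - alt (a n) k)))
           (+-monoʳ-≤ ∣ alt ℓ n - alt ℓ k ∣
             (∣p+q∣≤∣p∣+∣q∣ (- (alt (a n) k - alt ℓ k)) (- (alt (a n) n - alt (a n) k)))) ⟩
    ∣ alt ℓ n - alt ℓ k ∣ + (∣ - (alt (a n) k - alt ℓ k) ∣ + ∣ - (alt (a n) n - alt (a n) k) ∣)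
      ≡⟨ cong₂ (λ u v → ∣ alt ℓ n - alt ℓ k ∣ + (u + v))
           (∣-p∣≡∣p∣ (alt (a n) k - alt ℓ k)) (∣-p∣≡∣p∣ (alt (a n) n - alt (a n) k)) ⟩
    ∣ alt ℓ n - alt ℓ k ∣ + (∣ alt (a n) k - alt ℓ k ∣ + ∣ alt (a n) n - alt (a n) k ∣)
      ≤⟨ +-mono-≤ (≤-trans (tail ℓ ℓ-nonNeg ℓ-antitone) ℓk) (+-mono-≤ head
           (≤-trans (tail (a n) (a-nonNeg n) (a-antitone n)) (≤-trans (a≤ℓ n k) ℓk))) ⟩
    frac 1 K + (frac 1 K + frac 1 K) ∎
    where
    open ≤-Reasoning
    k : ℕ
    k = suc K
    k≤n : k ℕ.≤ n
    k≤n = ℕ.≤-trans (ℕ.m≤m*n k k) K²≤n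
    tail : ∀ f → (∀ i → 0ℚ ≤ f i) → (∀ i → f (suc i) ≤ f i) → ∣ alt f n - alt f k ∣ ≤ f k
    tail f 0≤f anti = subst (λ z → ∣ alt f z - alt f k ∣ ≤ f k) (ℕ.m+[n∸m]≡n k≤n)
      (alt-tail f 0≤f anti k (n ℕ.∸ k))
    ℓk : ℓ k ≤ frac 1 K
    ℓk = ≤-trans (ℓ-antitone K) (ℓ≤frac K)
    0<n : 0ℚ < ι n
    0<n = <-≤-trans (ι-pos K) (ι-mono k≤n)
    -- k terms with error 1/n each; k² ≤ n makes this at most 1/k.
    head : ∣ alt (a n) k - alt ℓ k ∣ ≤ frac 1 K
    head = cancel-≤ (ι n) 0<n (begin
      ι n * ∣ alt (a n) k - alt ℓ k ∣
        ≤⟨ alt-close k 1ℚ (ι n) (a n) ℓ (ι-nonNeg n) (a-close n) ⟩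
      ι k * 1ℚ
        ≡⟨ cong (ι k *_) (sym (trans (frac-ι 1 K) ι-1)) ⟩
      ι k * (frac 1 K * ι k)
        ≡⟨ solve 2 (λ k f → k :* (f :* k) := k :* k :* f) refl (ι k) (frac 1 K) ⟩
      ι k * ι k * frac 1 K
        ≡⟨ cong (_* frac 1 K) (sym (ι-* k k)) ⟩
      ι (k ℕ.* k) * frac 1 K
        ≤⟨ *-monoʳ (frac 1 K) (frac-nonNeg 1 K) (ι-mono K²≤n) ⟩
      ι n * frac 1 K ∎)

  leibniz-close : ∀ K n → suc K ℕ.* suc K ℕ.≤ n →
    ∣ 2ℚ * alt leibniz n - 4ℚ * (1ℚ + alt (a n) n) ∣ ≤ (4ℚ * 4ℚ) * frac 1 K
  leibniz-close K n K²≤n = begin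
    ∣ 2ℚ * p - 4ℚ * (1ℚ + alt (a n) n) ∣
      ≡⟨ cong ∣_∣ (solve 3 (λ p l e → con 2ℚ :* p :- con 4ℚ :* (con 1ℚ :+ e)
           := (con 2ℚ :* p :- con 4ℚ :* (con 1ℚ :+ l)) :+ con 4ℚ :* (l :- e)) refl p (alt ℓ n) (alt (a n) n)) ⟩
    ∣ (2ℚ * p - 4ℚ * (1ℚ + alt ℓ n)) + 4ℚ * (alt ℓ n - alt (a n) n) ∣
      ≡⟨ cong (λ z → ∣ (2ℚ * p - z) + 4ℚ * (alt ℓ n - alt (a n) n) ∣) (alt-ℓ n) ⟩
    ∣ (2ℚ * p - (p + p′)) + 4ℚ * (alt ℓ n - alt (a n) n) ∣
      ≤⟨ ∣p+q∣≤∣p∣+∣q∣ (2ℚ * p - (p + p′)) (4ℚ * (alt ℓ n - alt (a n) n)) ⟩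
    ∣ 2ℚ * p - (p + p′) ∣ + ∣ 4ℚ * (alt ℓ n - alt (a n) n) ∣
      ≡⟨ cong₂ _+_
           (trans (cong ∣_∣ (solve 2 (λ p q → con 2ℚ :* p :- (p :+ q) := :- (q :- p)) refl p p′)) (∣-p∣≡∣p∣ (p′ - p)))
           (∣p*q∣≡∣p∣*∣q∣ 4ℚ (alt ℓ n - alt (a n) n)) ⟩
    ∣ p′ - p ∣ + 4ℚ * ∣ alt ℓ n - alt (a n) n ∣
      ≤⟨ +-mono-≤ (≤-trans step (≤-trans (leibniz-small n) (*-monoˡ 4ℚ (<⇒≤ (positive⁻¹ 4ℚ))
             (frac-≤ {1} {1} {n} {K} (ℕ.*-monoʳ-≤ 1 (ℕ.s≤s (ℕ.≤-trans (ℕ.n≤1+n K) (ℕ.≤-trans (ℕ.m≤m*n (suc K) (suc K)) K²≤n))))))))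
           (*-monoˡ 4ℚ (<⇒≤ (positive⁻¹ 4ℚ)) (alt-a-close K n K²≤n)) ⟩
    4ℚ * frac 1 K + 4ℚ * (frac 1 K + (frac 1 K + frac 1 K))
      ≡⟨ solve 1 (λ f → con 4ℚ :* f :+ con 4ℚ :* (f :+ (f :+ f)) := (con 4ℚ :* con 4ℚ) :* f) refl (frac 1 K) ⟩
    (4ℚ * 4ℚ) * frac 1 K ∎
    where
    open ≤-Reasoning
    p p′ : ℚ
    p = alt leibniz n
    p′ = alt leibniz (suc n)
    step : ∣ p′ - p ∣ ≤ leibniz n
    step = subst (λ z → ∣ alt leibniz z - p ∣ ≤ leibniz n) (ℕ.+-comm n 1)
      (alt-tail leibniz leibniz-nonNeg leibniz-anti n 1)

  -- Wallis' formula is applied at the large index i of the approximant, and the monotonicity of `c`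
  -- and `c⁻` carries it back to the fixed P. Here δ absorbs the error of the approximant of π.
  π-bounds : ∀ P δ → 0ℚ < δ → Eventually λ i →
    2ℚ ≤ alt leibniz i * c P + δ × alt leibniz i * c⁻ P ≤ 2ℚ + δ
  π-bounds P δ 0<δ = suc K ℕ.* suc K ℕ.⊔ P , λ i i≥ →
    let K²≤i = ℕ.m⊔n≤o⇒m≤o (suc K ℕ.* suc K) P i≥
        P≤i  = ℕ.m⊔n≤o⇒n≤o (suc K ℕ.* suc K) P i≥
        p    = alt leibniz i
        0≤p  = proj₁ (alt-bounds leibniz leibniz-nonNeg leibniz-anti i)
        D    = 2ℚ * p - 4ℚ * (1ℚ + alt (a i) i)
        ∣D∣c : ∣ D ∣ * c i ≤ 2ℚ * δ
        ∣D∣c = begin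
          ∣ D ∣ * c i                      ≤⟨ *-monoˡ ∣ D ∣ (0≤∣p∣ D) (c≤1 i) ⟩
          ∣ D ∣ * 1ℚ                       ≡⟨ *-identityʳ ∣ D ∣ ⟩
          ∣ D ∣                            ≤⟨ leibniz-close K i K²≤i ⟩
          (4ℚ * 4ℚ) * frac 1 K             ≤⟨ *-monoˡ (4ℚ * 4ℚ) (<⇒≤ (positive⁻¹ (4ℚ * 4ℚ))) (small K ℕ.≤-refl) ⟩
          (4ℚ * 4ℚ) * (e * δ)              ≡⟨ sym (*-assoc (4ℚ * 4ℚ) e δ) ⟩
          2ℚ * δ ∎
        Dc : D * c i ≡ 2ℚ * (p * c i) - 4ℚ
        Dc = trans (solve 3 (λ p v c → (con 2ℚ :* p :- con 4ℚ :* v) :* c := con 2ℚ :* (p :* c) :- con 4ℚ :* (v :* c)) refl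
               p (1ℚ + alt (a i) i) (c i))
             (cong (λ z → 2ℚ * (p * c i) - 4ℚ * z) (wallis i i ℕ.≤-refl))
        upper : p * c i ≤ 2ℚ + δ
        upper = cancel-≤ 2ℚ (positive⁻¹ 2ℚ) (≤-trans
          (-≤⇒≤+ {2ℚ * (p * c i)} {4ℚ} (≤-trans (≤-reflexive (sym Dc))
            (≤-trans (*-monoʳ (c i) (c-nonNeg i) (p≤∣p∣ D)) ∣D∣c)))
          (≤-reflexive (sym (*-distribˡ-+ 2ℚ 2ℚ δ))))
        lower : 2ℚ ≤ p * c i + δ
        lower = cancel-≤ 2ℚ (positive⁻¹ 2ℚ) (≤-trans
          (-≤⇒≤+ {4ℚ} {2ℚ * (p * c i)} (≤-trans
            (≤-reflexive (trans (sym (neg-swap (2ℚ * (p * c i)) 4ℚ)) (trans (cong -_ (sym Dc)) (neg-distribˡ-* D (c i)))))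
            (≤-trans (*-monoʳ (c i) (c-nonNeg i) (≤-trans (p≤∣p∣ (- D)) (≤-reflexive (∣-p∣≡∣p∣ D)))) ∣D∣c)))
          (≤-reflexive (sym (*-distribˡ-+ 2ℚ (p * c i) δ))))
    in ≤-trans lower (+-monoˡ-≤ δ (*-monoˡ p 0≤p (c-≤ P≤i)))
     , ≤-trans (*-monoˡ p 0≤p (≤-trans (c⁻-≤ P≤i) (c⁻≤c i))) upper
    where
    open ≤-Reasoning
    e : ℚ
    -- Chosen so that the constant 16 of `leibniz-close` becomes 2.
    e = ½ * (½ * ½)
    arch : Eventually (λ k → frac 1 k ≤ e * δ)
    arch = archimedean (e * δ) (0<* (positive⁻¹ e) 0<δ)
    K : ℕ
    K = proj₁ arch
    small : ∀ k → K ℕ.≤ k → frac 1 k ≤ e * δ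
    small = proj₂ arch

-- The functional equation of the logarithm for Riemann sums.

module Logarithm where

  open import Data.Nat.Base as ℕ using (ℕ; zero; suc)
  import Data.Nat.Properties as ℕ
  open import Data.Nat.Tactic.RingSolver using (solve-∀)
  open import Data.Rational.Base
  open import Data.Rational.Properties
  open import Data.Rational.Solver using (module +-*-Solver)
  open import Relation.Binary.PropositionalEquality
  open import Defs using (module Rational)
  open +-*-Solver
  open Rational
  open RationalArithmetic

  sum<-nonNeg : ∀ n {f} → (∀ i → 0ℚ ≤ f i) → 0ℚ ≤ sum< n f
  sum<-nonNeg zero    h = ≤-refl
  sum<-nonNeg (suc n) h = 0≤+ (sum<-nonNeg n h) (h n)

  sum<-mono : ∀ {m n} f → (∀ i → 0ℚ ≤ f i) → m ℕ.≤ n → sum< m f ≤ sum< n f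
  sum<-mono {m} {n} f h m≤n = subst (λ k → sum< m f ≤ sum< k f) (ℕ.m+[n∸m]≡n m≤n)
    (≤-trans (p≤p+q (sum<-nonNeg (n ℕ.∸ m) (λ i → h (m ℕ.+ i)))) (≤-reflexive (sym (sum<-+ m (n ℕ.∸ m) f))))

  logSum-≤ : ∀ {k l} n → k ℕ.≤ l → logSum k n ≤ logSum l n
  logSum-≤ n k≤l = sum<-mono _ (λ j → frac-nonNeg 1 (n ℕ.+ suc j)) (ℕ.*-monoˡ-≤ (suc n) (ℕ.pred-mono-≤ k≤l))

  -- Right Riemann sums of a decreasing function lie below the integral; here they increase as the
  -- mesh shrinks, and by `logSum-mesh-bound` in total by no more than the initial mesh.
  logSum-mesh : ∀ k {m n} → m ℕ.≤ n → logSum (suc k) m ≤ logSum (suc k) n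
  logSum-mesh k {m} m≤n = go (ℕ.≤⇒≤′ m≤n)
    where
    go : ∀ {n} → m ℕ.≤′ n → logSum (suc k) m ≤ logSum (suc k) n
    go (ℕ.≤′-reflexive refl)   = ≤-refl
    go {suc n} (ℕ.≤′-step m≤n) = ≤-trans (go m≤n) (logSum-mono k n)

  logSum-mesh-bound : ∀ k {m n} → m ℕ.≤ n → logSum (suc k) n ≤ logSum (suc k) m + frac 1 m
  logSum-mesh-bound k {m} {n} m≤n = ≤-trans (p≤p+q (frac-nonNeg 1 n)) (go (ℕ.≤⇒≤′ m≤n))
    where
    go : ∀ {n} → m ℕ.≤′ n → logSum (suc k) n + frac 1 n ≤ logSum (suc k) m + frac 1 m
    go (ℕ.≤′-reflexive refl)   = ≤-refl
    go {suc n} (ℕ.≤′-step m≤n) = ≤-trans (logSum-anti k n) (go m≤n)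

  -- Substituting t = (q+1)u on the second part of the interval divides the mesh by q+1 and leaves
  -- the Riemann sum of 1/t unchanged, so the identity is exact.
  logSum-* : ∀ p q n → logSum (suc p ℕ.* suc q) n ≡ logSum (suc q) n + logSum (suc p) (n ℕ.+ q ℕ.* suc n)
  logSum-* p q n = begin
    sum< ((q ℕ.+ p ℕ.* suc q) ℕ.* suc n) f
      ≡⟨ cong (λ k → sum< k f) (lem p q n) ⟩
    sum< (q ℕ.* suc n ℕ.+ p ℕ.* suc (n ℕ.+ q ℕ.* suc n)) f
      ≡⟨ sum<-+ (q ℕ.* suc n) (p ℕ.* suc (n ℕ.+ q ℕ.* suc n)) f ⟩
    logSum (suc q) n + sum< (p ℕ.* suc (n ℕ.+ q ℕ.* suc n)) (λ j → f (q ℕ.* suc n ℕ.+ j))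
      ≡⟨ cong (logSum (suc q) n +_) (sum<-cong (p ℕ.* suc (n ℕ.+ q ℕ.* suc n))
           λ j → cong (frac 1) (lem′ n (q ℕ.* suc n) j)) ⟩
    logSum (suc q) n + logSum (suc p) (n ℕ.+ q ℕ.* suc n) ∎
    where
    open ≡-Reasoning
    f : ℕ → ℚ
    f j = frac 1 (n ℕ.+ suc j)
    lem : ∀ p q n → (q ℕ.+ p ℕ.* suc q) ℕ.* suc n ≡ q ℕ.* suc n ℕ.+ p ℕ.* suc (n ℕ.+ q ℕ.* suc n)
    lem = solve-∀
    lem′ : ∀ n m j → n ℕ.+ suc (m ℕ.+ j) ≡ n ℕ.+ m ℕ.+ suc j
    lem′ = solve-∀

  private
    *-suc-ℚ : ∀ P x → ι (suc P) * x ≡ ι P * x + x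
    *-suc-ℚ P x = trans (cong (_* x) (ι-suc P)) (solve 2 (λ p x → (p :+ con 1ℚ) :* x := p :* x :+ x) refl (ι P) x)

    suc-pred-^ : ∀ p P → suc (ℕ.pred (suc p ℕ.^ P)) ≡ suc p ℕ.^ P
    suc-pred-^ p P = ℕ.suc-pred (suc p ℕ.^ P) {{ℕ.m^n≢0 (suc p) P}}

    logSum-^-suc : ∀ p P n → logSum (suc p ℕ.^ suc P) n ≡
      logSum (suc p ℕ.^ P) n + logSum (suc p) (n ℕ.+ ℕ.pred (suc p ℕ.^ P) ℕ.* suc n)
    logSum-^-suc p P n = subst (λ k → logSum (suc p ℕ.* k) n ≡
      logSum k n + logSum (suc p) (n ℕ.+ ℕ.pred (suc p ℕ.^ P) ℕ.* suc n)) (suc-pred-^ p P)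
      (logSum-* p (ℕ.pred (suc p ℕ.^ P)) n)

  logSum-^-≥ : ∀ p P n → ι P * logSum (suc p) n ≤ logSum (suc p ℕ.^ P) n
  logSum-^-≥ p zero    n = ≤-reflexive (zeroˡ (logSum (suc p) n) ι-0)
  logSum-^-≥ p (suc P) n = begin
    ι (suc P) * logSum (suc p) n
      ≡⟨ *-suc-ℚ P (logSum (suc p) n) ⟩
    ι P * logSum (suc p) n + logSum (suc p) n
      ≤⟨ +-mono-≤ (logSum-^-≥ p P n) (logSum-mesh p (ℕ.m≤m+n n (ℕ.pred (suc p ℕ.^ P) ℕ.* suc n))) ⟩
    logSum (suc p ℕ.^ P) n + logSum (suc p) (n ℕ.+ ℕ.pred (suc p ℕ.^ P) ℕ.* suc n)
      ≡⟨ sym (logSum-^-suc p P n) ⟩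
    logSum (suc p ℕ.^ suc P) n ∎
    where open ≤-Reasoning

  logSum-^-≤ : ∀ p P n → logSum (suc p ℕ.^ P) n ≤ ι P * (logSum (suc p) n + frac 1 n)
  logSum-^-≤ p zero    n = ≤-reflexive (sym (zeroˡ (logSum (suc p) n + frac 1 n) ι-0))
  logSum-^-≤ p (suc P) n = begin
    logSum (suc p ℕ.^ suc P) n
      ≡⟨ logSum-^-suc p P n ⟩
    logSum (suc p ℕ.^ P) n + logSum (suc p) (n ℕ.+ ℕ.pred (suc p ℕ.^ P) ℕ.* suc n)
      ≤⟨ +-mono-≤ (logSum-^-≤ p P n) (logSum-mesh-bound p (ℕ.m≤m+n n (ℕ.pred (suc p ℕ.^ P) ℕ.* suc n))) ⟩
    ι P * (logSum (suc p) n + frac 1 n) + (logSum (suc p) n + frac 1 n)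
      ≡⟨ sym (*-suc-ℚ P (logSum (suc p) n + frac 1 n)) ⟩
    ι (suc P) * (logSum (suc p) n + frac 1 n) ∎
    where open ≤-Reasoning

  logSum-bound : ∀ p n → logSum (suc p) n ≤ ι p
  logSum-bound p n = begin
    logSum (suc p) n
      ≤⟨ sum<-≤ (p ℕ.* suc n) (λ j _ → frac-≤ {1} {1} {n ℕ.+ suc j} {n} (ℕ.*-monoʳ-≤ 1 (ℕ.s≤s (ℕ.m≤m+n n (suc j))))) ⟩
    frac (p ℕ.* suc n) 0 * frac 1 n
      ≡⟨ cong (_* frac 1 n) (trans (sym (ι-def (p ℕ.* suc n))) (ι-* p (suc n))) ⟩
    ι p * ι (suc n) * frac 1 n
      ≡⟨ solve 3 (λ p s f → p :* s :* f := p :* (f :* s)) refl (ι p) (ι (suc n)) (frac 1 n) ⟩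
    ι p * (frac 1 n * ι (suc n))
      ≡⟨ cong (ι p *_) (trans (frac-ι 1 n) ι-1) ⟩
    ι p * 1ℚ
      ≡⟨ *-identityʳ (ι p) ⟩
    ι p ∎
    where open ≤-Reasoning

-- Calculus of relative errors.

module RelativeCloseness where

  open import Data.Empty using (⊥-elim)
  open import Data.Product.Base using (_,_)
  open import Data.Rational.Base
  open import Data.Rational.Properties
  open import Data.Rational.Solver using (module +-*-Solver)
  open import Data.Sum.Base using (inj₁; inj₂)
  open import Relation.Binary.PropositionalEquality
  open import Relation.Nullary using (yes; no)
  open import Defs using (module Rational)
  open +-*-Solver
  open Rational
  open RationalArithmetic

  square-cancel : ∀ {x y} → 0ℚ ≤ x → 0ℚ ≤ y → x * x ≤ y * y → x ≤ y
  square-cancel {x} {y} 0≤x 0≤y h with x ≤? y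
  ... | yes x≤y = x≤y
  ... | no x≰y  = ⊥-elim (<-irrefl refl (<-≤-trans (≤-<-trans (*-monoˡ y 0≤y (<⇒≤ y<x))
                    (*-monoˡ-<-pos x {{positive (≤-<-trans 0≤y y<x)}} y<x)) h))
    where
    y<x : y < x
    y<x = ≰⇒> x≰y

  sqrtℚ-≥ : ∀ i x θ → 0ℚ < θ → θ * θ ≤ x → frac 1 i ≤ ½ * θ → ½ * θ ≤ sqrtℚ i x
  sqrtℚ-≥ i x θ 0<θ θ²≤x f≤ = begin
    ½ * θ                      ≡⟨ solve 1 (λ t → con ½ :* t := t :- con ½ :* t) refl θ ⟩
    θ - ½ * θ                  ≤⟨ ≤+⇒-≤ {θ} {½ * θ} (≤-trans
                                    (square-cancel (<⇒≤ 0<θ) (0≤+ (sqrtℚ-nonNeg i x) (frac-nonNeg 1 i))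
                                      (≤-trans θ²≤x (sqrtℚ-upper i x)))
                                    (≤-trans (+-monoʳ-≤ (sqrtℚ i x) f≤) (≤-reflexive (+-comm (sqrtℚ i x) (½ * θ))))) ⟩
    sqrtℚ i x ∎
    where open ≤-Reasoning

  3ℚ : ℚ
  3ℚ = 1ℚ + 1ℚ + 1ℚ

  infixl 6 _⊕_
  -- That is (1+k)(1+l) - 1. Since d ≤ 1, it bounds the error constant of a product of the factors 1
  -- + kd and 1 + ld.
  _⊕_ : ℚ → ℚ → ℚ
  k ⊕ l = k + l + k * l

  -- The entries follow the replacements in `close-main`: E twice, the root of ln n, ln n itself,
  -- Wallis' formula, the root in κ.
  errorBound : ℚ → ℚ
  errorBound e = e ⊕ e ⊕ (1ℚ ⊕ 1ℚ) ⊕ (1ℚ ⊕ 1ℚ) ⊕ 1ℚ ⊕ (1ℚ ⊕ 1ℚ)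

  ⊕-nonNeg : ∀ {k l} → 0ℚ ≤ k → 0ℚ ≤ l → 0ℚ ≤ k ⊕ l
  ⊕-nonNeg 0≤k 0≤l = 0≤+ (0≤+ 0≤k 0≤l) (0≤* 0≤k 0≤l)

  errorBound-nonNeg : ∀ {e} → 0ℚ ≤ e → 0ℚ ≤ errorBound e
  errorBound-nonNeg 0≤e = ⊕-nonNeg (⊕-nonNeg (⊕-nonNeg (⊕-nonNeg (⊕-nonNeg 0≤e 0≤e) 0≤3) 0≤3) (<⇒≤ 0<1)) 0≤3
    where
    0≤3 : 0ℚ ≤ 1ℚ ⊕ 1ℚ
    0≤3 = <⇒≤ (positive⁻¹ (1ℚ ⊕ 1ℚ))

  module _ (d : ℚ) (0≤d : 0ℚ ≤ d) (d≤1 : d ≤ 1ℚ) where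

    -- Closeness up to a factor, in both directions, so that it is symmetric and compatible with
    -- products. In the application d is 1/P.
    record Close (k a b : ℚ) : Set where
      constructor close
      field
        0≤k   : 0ℚ ≤ k
        upper : a ≤ (1ℚ + k * d) * b
        lower : b ≤ (1ℚ + k * d) * a

    open Close

    factor-nonNeg : ∀ {k} → 0ℚ ≤ k → 0ℚ ≤ 1ℚ + k * d
    factor-nonNeg 0≤k = 0≤+ (<⇒≤ 0<1) (0≤* 0≤k 0≤d)

    factor-⊕ : ∀ {k l} → 0ℚ ≤ k → 0ℚ ≤ l → (1ℚ + k * d) * (1ℚ + l * d) ≤ 1ℚ + (k ⊕ l) * d
    factor-⊕ {k} {l} 0≤k 0≤l = begin
      (1ℚ + k * d) * (1ℚ + l * d)
        ≡⟨ solve 3 (λ k l d → (con 1ℚ :+ k :* d) :* (con 1ℚ :+ l :* d)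
             := con 1ℚ :+ (k :+ l) :* d :+ k :* l :* (d :* d)) refl k l d ⟩
      1ℚ + (k + l) * d + k * l * (d * d)
        ≤⟨ +-monoʳ-≤ (1ℚ + (k + l) * d) (*-monoˡ (k * l) (0≤* 0≤k 0≤l) (*-monoˡ d 0≤d d≤1)) ⟩
      1ℚ + (k + l) * d + k * l * (d * 1ℚ)
        ≡⟨ solve 3 (λ k l d → con 1ℚ :+ (k :+ l) :* d :+ k :* l :* (d :* con 1ℚ)
             := con 1ℚ :+ (k :+ l :+ k :* l) :* d) refl k l d ⟩
      1ℚ + (k ⊕ l) * d ∎
      where open ≤-Reasoning

    close-sym : ∀ {k a b} → Close k a b → Close k b a
    close-sym (close 0≤k u l) = close 0≤k l u

    private
      chain : ∀ {k l} a b c → 0ℚ ≤ k → 0ℚ ≤ l → 0ℚ ≤ c →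
              a ≤ (1ℚ + k * d) * b → b ≤ (1ℚ + l * d) * c → a ≤ (1ℚ + (k ⊕ l) * d) * c
      chain {k} {l} a b c 0≤k 0≤l 0≤c a≤ b≤ = begin
        a                                     ≤⟨ a≤ ⟩
        (1ℚ + k * d) * b                      ≤⟨ *-monoˡ (1ℚ + k * d) (factor-nonNeg 0≤k) b≤ ⟩
        (1ℚ + k * d) * ((1ℚ + l * d) * c)     ≡⟨ sym (*-assoc (1ℚ + k * d) (1ℚ + l * d) c) ⟩
        (1ℚ + k * d) * (1ℚ + l * d) * c       ≤⟨ *-monoʳ c 0≤c (factor-⊕ 0≤k 0≤l) ⟩
        (1ℚ + (k ⊕ l) * d) * c ∎
        where open ≤-Reasoning

      ⊕-comm : ∀ k l → k ⊕ l ≡ l ⊕ k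
      ⊕-comm = solve 2 (λ k l → k :+ l :+ k :* l := l :+ k :+ l :* k) refl

    close-trans : ∀ {k l a b c} → 0ℚ ≤ a → 0ℚ ≤ c → Close k a b → Close l b c → Close (k ⊕ l) a c
    close-trans {k} {l} {a} {b} {c} 0≤a 0≤c p q = close (⊕-nonNeg (0≤k p) (0≤k q))
      (chain a b c (0≤k p) (0≤k q) 0≤c (upper p) (upper q))
      (subst (λ j → c ≤ (1ℚ + j * d) * a) (⊕-comm l k) (chain c b a (0≤k q) (0≤k p) 0≤a (lower q) (lower p)))

    close-scale : ∀ {k a b} r → 0ℚ ≤ r → Close k a b → Close k (r * a) (r * b)
    close-scale {k} {a} {b} r 0≤r (close 0≤k u l) = close 0≤k (side a b u) (side b a l)
      where
      side : ∀ a b → a ≤ (1ℚ + k * d) * b → r * a ≤ (1ℚ + k * d) * (r * b)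
      side a b h = ≤-trans (*-monoˡ r 0≤r h)
        (≤-reflexive (solve 3 (λ r f b → r :* (f :* b) := f :* (r :* b)) refl r (1ℚ + k * d) b))

    close-cancel : ∀ {k} r a b → 0ℚ < r → Close k (r * a) (r * b) → Close k a b
    close-cancel {k} r a b 0<r (close 0≤k u l) = close 0≤k (side a b u) (side b a l)
      where
      side : ∀ a b → r * a ≤ (1ℚ + k * d) * (r * b) → a ≤ (1ℚ + k * d) * b
      side a b h = cancel-≤ r 0<r (≤-trans h
        (≤-reflexive (solve 3 (λ r f b → f :* (r :* b) := r :* (f :* b)) refl r (1ℚ + k * d) b)))

    close-* : ∀ {k l a b a′ b′} → 0ℚ ≤ a → 0ℚ ≤ b → 0ℚ ≤ a′ → 0ℚ ≤ b′ →
              Close k a b → Close l a′ b′ → Close (k ⊕ l) (a * a′) (b * b′)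
    close-* {k} {l} {a} {b} {a′} {b′} 0≤a 0≤b 0≤a′ 0≤b′ p q =
      close-trans {b = b * a′} (0≤* 0≤a 0≤a′) (0≤* 0≤b 0≤b′)
        (subst₂ (Close k) (*-comm a′ a) (*-comm a′ b) (close-scale a′ 0≤a′ p)) (close-scale b 0≤b q)

    -- The constant is not halved: the factor f ≥ 1 is simply replaced by f² before taking roots.
    close-root : ∀ {k} a b → 0ℚ ≤ a → 0ℚ ≤ b → Close k (a * a) (b * b) → Close k a b
    close-root {k} a b 0≤a 0≤b (close 0≤k u l) = close 0≤k (side a b 0≤a 0≤b u) (side b a 0≤b 0≤a l)
      where
      side : ∀ a b → 0ℚ ≤ a → 0ℚ ≤ b → a * a ≤ (1ℚ + k * d) * (b * b) → a ≤ (1ℚ + k * d) * b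
      side a b 0≤a 0≤b h = square-cancel 0≤a (0≤* (factor-nonNeg 0≤k) 0≤b) (begin
        a * a                            ≤⟨ h ⟩
        f * (b * b)                      ≡⟨ sym (*-identityˡ (f * (b * b))) ⟩
        1ℚ * (f * (b * b))
          ≤⟨ *-monoʳ (f * (b * b)) (0≤* (factor-nonNeg 0≤k) (0≤* 0≤b 0≤b)) (p≤p+q {1ℚ} (0≤* 0≤k 0≤d)) ⟩
        f * (f * (b * b))                ≡⟨ solve 2 (λ f b → f :* (f :* (b :* b)) := f :* b :* (f :* b)) refl f b ⟩
        f * b * (f * b) ∎)
        where
        open ≤-Reasoning
        f : ℚ
        f = 1ℚ + k * d

    close⇒quotient : ∀ {k a b} → 0ℚ ≤ a → 0ℚ < b → Close k a b → ∣ a * inv b - 1ℚ ∣ ≤ k * d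
    close⇒quotient {k} {a} {b} 0≤a 0<b (close 0≤k u l) = ∣-∣≤ x≤ 1≤
      where
      open ≤-Reasoning
      x : ℚ
      x = a * inv b
      0≤inv : 0ℚ ≤ inv b
      0≤inv = <⇒≤ (inv-pos b 0<b)
      x≤ : x ≤ 1ℚ + k * d
      x≤ = begin
        a * inv b                       ≤⟨ *-monoʳ (inv b) 0≤inv u ⟩
        (1ℚ + k * d) * b * inv b        ≡⟨ *-assoc (1ℚ + k * d) b (inv b) ⟩
        (1ℚ + k * d) * (b * inv b)      ≡⟨ cong ((1ℚ + k * d) *_) (*-inv b 0<b) ⟩
        (1ℚ + k * d) * 1ℚ               ≡⟨ *-identityʳ (1ℚ + k * d) ⟩
        1ℚ + k * d ∎
      1≤′ : 1ℚ ≤ x + k * d * x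
      1≤′ = begin
        1ℚ                              ≡⟨ sym (*-inv b 0<b) ⟩
        b * inv b                       ≤⟨ *-monoʳ (inv b) 0≤inv l ⟩
        (1ℚ + k * d) * a * inv b        ≡⟨ solve 3 (λ e a i → (con 1ℚ :+ e) :* a :* i := a :* i :+ e :* (a :* i)) refl (k * d) a (inv b) ⟩
        x + k * d * x ∎
      -- The available bound has error kd x, which is at most kd if x ≤ 1; for x ≥ 1 the claim is
      -- trivial.
      1≤ : 1ℚ ≤ x + k * d
      1≤ with ≤-total x 1ℚ
      ... | inj₁ x≤1 = ≤-trans 1≤′ (+-monoʳ-≤ x (≤-trans (*-monoˡ (k * d) (0≤* 0≤k 0≤d) x≤1)
                         (≤-reflexive (*-identityʳ (k * d)))))
      ... | inj₂ 1≤x = ≤-trans 1≤x (p≤p+q (0≤* 0≤k 0≤d))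

    -- The lower bound θ² for x turns the absolute error 1/(i+1) of the root into a relative one.
    close-sqrt : ∀ i x θ → 0ℚ < θ → θ * θ ≤ x → frac 1 i ≤ d * (½ * θ) →
                 Close (1ℚ ⊕ 1ℚ) (sqrtℚ i x * sqrtℚ i x) x
    close-sqrt i x θ 0<θ θ²≤x f≤ = close (⊕-nonNeg (<⇒≤ 0<1) (<⇒≤ 0<1)) up low
      where
      open ≤-Reasoning
      s f : ℚ
      s = sqrtℚ i x
      f = frac 1 i
      0≤s : 0ℚ ≤ s
      0≤s = sqrtℚ-nonNeg i x
      0≤x : 0ℚ ≤ x
      0≤x = ≤-trans (0≤* (<⇒≤ 0<θ) (<⇒≤ 0<θ)) θ²≤x
      0≤½θ : 0ℚ ≤ ½ * θ
      0≤½θ = 0≤* (<⇒≤ 0<½) (<⇒≤ 0<θ)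
      s²≤x : s * s ≤ x
      s²≤x with sqrtℚ-lower i x
      ... | inj₁ s≡0 = ≤-trans (≤-reflexive (zeroˡ s s≡0)) 0≤x
      ... | inj₂ h   = h
      ½θ≤s : ½ * θ ≤ s
      ½θ≤s = sqrtℚ-≥ i x θ 0<θ θ²≤x (≤-trans f≤
        (≤-trans (*-monoʳ (½ * θ) 0≤½θ d≤1) (≤-reflexive (*-identityˡ (½ * θ)))))
      s+f≤ : s + f ≤ (1ℚ + 1ℚ * d) * s
      s+f≤ = begin
        s + f                    ≤⟨ +-monoʳ-≤ s (≤-trans f≤ (*-monoˡ d 0≤d ½θ≤s)) ⟩
        s + d * s                ≡⟨ solve 2 (λ s d → s :+ d :* s := (con 1ℚ :+ con 1ℚ :* d) :* s) refl s d ⟩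
        (1ℚ + 1ℚ * d) * s ∎
      low : x ≤ (1ℚ + (1ℚ ⊕ 1ℚ) * d) * (s * s)
      low = begin
        x                                               ≤⟨ sqrtℚ-upper i x ⟩
        (s + f) * (s + f)                               ≤⟨ *-mono (0≤+ 0≤s (frac-nonNeg 1 i))
                                                             (0≤* (factor-nonNeg (<⇒≤ 0<1)) 0≤s) s+f≤ s+f≤ ⟩
        (1ℚ + 1ℚ * d) * s * ((1ℚ + 1ℚ * d) * s)         ≡⟨ solve 2 (λ f s → f :* s :* (f :* s) := f :* f :* (s :* s)) refl
                                                             (1ℚ + 1ℚ * d) s ⟩
        (1ℚ + 1ℚ * d) * (1ℚ + 1ℚ * d) * (s * s)         ≤⟨ *-monoʳ (s * s) (0≤* 0≤s 0≤s)
                                                             (factor-⊕ (<⇒≤ 0<1) (<⇒≤ 0<1)) ⟩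
        (1ℚ + (1ℚ ⊕ 1ℚ) * d) * (s * s) ∎
      up : s * s ≤ (1ℚ + (1ℚ ⊕ 1ℚ) * d) * x
      up = ≤-trans s²≤x (≤-trans (≤-reflexive (sym (*-identityˡ x)))
        (*-monoʳ x 0≤x (p≤p+q {1ℚ} (0≤* (⊕-nonNeg (<⇒≤ 0<1) (<⇒≤ 0<1)) 0≤d))))

    -- Both sides are compared after squaring and multiplication by ϖ.
    close-main : ∀ e E n β P μ Λ ϖ s r → 0ℚ ≤ E → 0ℚ < n → 0ℚ ≤ β → 0ℚ ≤ P → 0ℚ ≤ μ → 0ℚ ≤ Λ → 0ℚ < ϖ →
      0ℚ < s → 0ℚ ≤ r →
      Close e E (3ℚ * n * β) → Close 1ℚ (ϖ * (β * β) * P) 1ℚ → Close (1ℚ ⊕ 1ℚ) Λ (P * μ) →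
      Close (1ℚ ⊕ 1ℚ) (s * s) Λ → Close (1ℚ ⊕ 1ℚ) (r * r) (μ * inv ϖ) →
      Close (errorBound e) E (3ℚ * r * (n * inv s))
    close-main e E n β P μ Λ ϖ s r 0≤E 0<n 0≤β 0≤P 0≤μ 0≤Λ 0<ϖ 0<s 0≤r hE hπ hΛ hs hr =
      subst₂ (Close (errorBound e))
        (trans (solve 3 (λ i E s → i :* (E :* s) := E :* (s :* i)) refl (inv s) E s)
          (trans (cong (E *_) (*-inv s 0<s)) (*-identityʳ E)))
        (solve 3 (λ i n r → i :* (con 3ℚ :* n :* r) := con 3ℚ :* r :* (n :* i)) refl (inv s) n r)
        (close-scale (inv s) (<⇒≤ (inv-pos s 0<s)) roots)
      where
      T : ℚ
      T = 3ℚ * n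
      0≤T : 0ℚ ≤ T
      0≤T = 0≤* (<⇒≤ (positive⁻¹ 3ℚ)) (<⇒≤ 0<n)
      0≤ϖ 0≤Tβ 0≤s 0≤TTμ : _
      0≤ϖ = <⇒≤ 0<ϖ
      0≤Tβ = 0≤* 0≤T 0≤β
      0≤s = <⇒≤ 0<s
      0≤TTμ = 0≤* (0≤* 0≤T 0≤T) 0≤μ
      x₁ : Close (e ⊕ e) (E * E) (T * β * (T * β))
      x₁ = close-* 0≤E 0≤Tβ 0≤E 0≤Tβ hE hE
      x₂ : Close (e ⊕ e ⊕ (1ℚ ⊕ 1ℚ)) (E * E * (s * s)) (T * β * (T * β) * Λ)
      x₂ = close-* (0≤* 0≤E 0≤E) (0≤* 0≤Tβ 0≤Tβ) (0≤* 0≤s 0≤s) 0≤Λ x₁ hs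
      x₃ : Close (e ⊕ e ⊕ (1ℚ ⊕ 1ℚ) ⊕ (1ℚ ⊕ 1ℚ)) (E * E * (s * s)) (T * β * (T * β) * (P * μ))
      x₃ = close-trans (0≤* (0≤* 0≤E 0≤E) (0≤* 0≤s 0≤s)) (0≤* (0≤* 0≤Tβ 0≤Tβ) (0≤* 0≤P 0≤μ))
             x₂ (close-scale (T * β * (T * β)) (0≤* 0≤Tβ 0≤Tβ) hΛ)
      0≤lhs : 0ℚ ≤ ϖ * (E * E * (s * s))
      0≤lhs = 0≤* 0≤ϖ (0≤* (0≤* 0≤E 0≤E) (0≤* 0≤s 0≤s))
      -- β² comes from E², P from ln n. Together with ϖ they form the product that `hπ` replaces by
      -- 1.
      x₄ : Close (e ⊕ e ⊕ (1ℚ ⊕ 1ℚ) ⊕ (1ℚ ⊕ 1ℚ) ⊕ 1ℚ) (ϖ * (E * E * (s * s))) (T * T * μ * 1ℚ)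
      x₄ = close-trans 0≤lhs (0≤* 0≤TTμ (<⇒≤ 0<1))
             (subst (Close (e ⊕ e ⊕ (1ℚ ⊕ 1ℚ) ⊕ (1ℚ ⊕ 1ℚ)) (ϖ * (E * E * (s * s))))
               (solve 5 (λ w T b P m → w :* (T :* b :* (T :* b) :* (P :* m)) := T :* T :* m :* (w :* (b :* b) :* P)) refl
                 ϖ T β P μ)
               (close-scale ϖ 0≤ϖ x₃))
             (close-scale (T * T * μ) 0≤TTμ hπ)
      x₅ : Close (1ℚ ⊕ 1ℚ) (T * T * μ * 1ℚ) (ϖ * (T * T) * (r * r))
      x₅ = close-sym (subst (Close (1ℚ ⊕ 1ℚ) (ϖ * (T * T) * (r * r)))
             (trans (solve 4 (λ w T m i → w :* (T :* T) :* (m :* i) := T :* T :* m :* (w :* i)) refl ϖ T μ (inv ϖ))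
               (cong (T * T * μ *_) (*-inv ϖ 0<ϖ)))
             (close-scale (ϖ * (T * T)) (0≤* 0≤ϖ (0≤* 0≤T 0≤T)) hr))
      roots : Close (errorBound e) (E * s) (T * r)
      roots = close-root (E * s) (T * r) (0≤* 0≤E 0≤s) (0≤* 0≤T 0≤r)
        (close-cancel ϖ (E * s * (E * s)) (T * r * (T * r)) 0<ϖ
          (subst₂ (Close (errorBound e))
            (solve 3 (λ w E s → w :* (E :* E :* (s :* s)) := w :* (E :* s :* (E :* s))) refl ϖ E s)
            (solve 3 (λ w T r → w :* (T :* T) :* (r :* r) := w :* (T :* r :* (T :* r))) refl ϖ T r)
            (close-trans 0≤lhs (0≤* (0≤* 0≤ϖ (0≤* 0≤T 0≤T)) (0≤* 0≤r 0≤r)) x₄ x₅)))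

-- The relative error of the approximants.

module RationalEstimate where

  open import Data.Empty using (⊥-elim)
  import Data.Integer.Base as ℤ
  open import Data.List.Base using (length)
  open import Data.Nat.Base as ℕ using (ℕ; zero; suc)
  import Data.Nat.Properties as ℕ
  open import Data.Product.Base using (_×_; _,_; proj₁; proj₂; ∃-syntax)
  open import Data.Rational.Base
  open import Data.Rational.Properties
  open import Data.Rational.Solver using (module +-*-Solver)
  open import Relation.Binary.PropositionalEquality hiding (J)
  open import Relation.Nullary using (yes; no)
  open import Relation.Nullary.Decidable using (toWitness)
  open import Defs using (module Rational; Eventually; avgDagEdges; trees)
  open +-*-Solver
  open Rational
  open RationalArithmetic
  open WallisLimit
  open Logarithm
  open RelativeCloseness

  log-floor : ∀ Z → 2 ℕ.≤ Z → ∀ n → ∃[ P ] Z ℕ.^ P ℕ.≤ suc n × suc n ℕ.< Z ℕ.^ suc P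
  log-floor Z 2≤Z zero = 0 , ℕ.≤-refl , ℕ.≤-trans 2≤Z (ℕ.≤-reflexive (sym (ℕ.*-identityʳ Z)))
  log-floor Z 2≤Z (suc n) with log-floor Z 2≤Z n
  ... | P , Z^P≤n , n<Z^P⁺ with suc (suc n) ℕ.<? Z ℕ.^ suc P
  ...   | yes n⁺<Z^P⁺ = P , ℕ.m≤n⇒m≤1+n Z^P≤n , n⁺<Z^P⁺
  ...   | no n⁺≮Z^P⁺ = suc P , ℕ.≮⇒≥ n⁺≮Z^P⁺ , ℕ.≤-<-trans n<Z^P⁺ (ℕ.^-monoʳ-< Z 2≤Z (ℕ.n<1+n (suc P)))

  cutoff : ∀ Z e n → 4 ℕ.≤ Z → 1 ℕ.≤ e → Z ℕ.^ e ℕ.≤ n →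
    ∃[ s ] ∃[ M ] s ℕ.+ M ≡ n × Z ℕ.^ suc s ℕ.≤ n × n ℕ.< Z ℕ.^ suc (suc s) × e ℕ.≤ suc s
  cutoff Z@(suc _) e zero    4≤Z 1≤e Z^e≤n = ⊥-elim (ℕ.<⇒≱ (ℕ.m^n>0 Z e) Z^e≤n)
  cutoff Z@(suc _) e (suc k) 4≤Z 1≤e Z^e≤n
    with log-floor Z (ℕ.≤-trans (ℕ.s≤s (ℕ.s≤s ℕ.z≤n)) 4≤Z) k
  -- P = 0 is excluded by Z ≤ Z^e ≤ n, so that s = P - 1 exists.
  ... | zero  , _     , n<Z     = ⊥-elim (ℕ.<⇒≱ n<Z (ℕ.≤-trans (ℕ.^-monoʳ-≤ Z 1≤e) Z^e≤n))
  ... | suc s , Z^P≤n , n<Z^P⁺ = s , suc k ℕ.∸ s , ℕ.m+[n∸m]≡n s≤n , Z^P≤n , n<Z^P⁺ ,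
    ℕ.≮⇒≥ (λ P<e → ℕ.<⇒≱ n<Z^P⁺ (ℕ.≤-trans (ℕ.^-monoʳ-≤ Z P<e) Z^e≤n))
    where
    s≤n : s ℕ.≤ suc k
    s≤n = ℕ.≤-trans (ℕ.≤-trans (ℕ.n≤1+n s) (ℕ.≤-trans (ℕ.m≤m*n (suc s) (suc s))
      (ℕ.≤-trans (Counting.^-square (suc s)) (ℕ.^-monoˡ-≤ (suc s) 4≤Z)))) Z^P≤n

  module _ (m′ : ℕ) where

    private
      m Z p : ℕ
      m = suc m′
      Z = 4 ℕ.* m
      p = ℕ.pred Z

      instance
        p≢0 : ℕ.NonZero p
        p≢0 = ℕ.>-nonZero (ℕ.≤-trans (ℕ.s≤s ℕ.z≤n) (ℕ.m≤n+m (3 ℕ.* m) m′))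

    open DagEdges.Bounds m using (S; G; G-zero; G-ratio)
    open TreeSum using (B; length-trees)

    -- The recurrences `β-step` and `G-ratio` agree after scaling by Z^P; this links tree counting
    -- to Wallis' formula.
    β-G : ∀ P → β P * ι (Z ℕ.^ P) ≡ ι (G P)
    β-G zero    = trans (*-identityˡ (ι 1)) (cong ι (sym G-zero))
    β-G (suc P) = cancel-≡ (ι (suc P)) (ι-pos P) (begin
      ι (suc P) * (β (suc P) * ι (Z ℕ.* Z ℕ.^ P))
        ≡⟨ cong₂ (λ u v → u * (β (suc P) * v)) (ι-suc P) (trans (ι-* Z (Z ℕ.^ P)) (cong (_* z) (ι-* 4 m))) ⟩
      (x + 1ℚ) * (β (suc P) * (ι 4 * ι m * z))
        ≡⟨ cong (λ q → (x + 1ℚ) * (β (suc P) * (q * ι m * z))) ι-4 ⟩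
      (x + 1ℚ) * (β (suc P) * (4ℚ * ι m * z))
        ≡⟨ solve 4 (λ x b m z → (x :+ con 1ℚ) :* (b :* (con 4ℚ :* m :* z)) := con 2ℚ :* m :* z :* (b :* (x :+ x :+ con 2ℚ))) refl
             x (β (suc P)) (ι m) z ⟩
      2ℚ * ι m * z * (β (suc P) * (x + x + 2ℚ))
        ≡⟨ cong (2ℚ * ι m * z *_) (β-step P) ⟩
      2ℚ * ι m * z * (β P * (x + x + 1ℚ))
        ≡⟨ solve 4 (λ x b m z → con 2ℚ :* m :* z :* (b :* (x :+ x :+ con 1ℚ)) := m :* (con 4ℚ :* x :+ con 2ℚ) :* (b :* z)) refl
             x (β P) (ι m) z ⟩
      ι m * (4ℚ * x + 2ℚ) * (β P * z)
        ≡⟨ cong₂ (λ u v → ι m * u * v) (sym (trans (ι-+ (4 ℕ.* P) 2) (cong₂ _+_ (trans (ι-* 4 P) (cong (_* x) ι-4)) ι-2))) (β-G P) ⟩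
      ι m * ι (4 ℕ.* P ℕ.+ 2) * ι (G P)
        ≡⟨ cong (_* ι (G P)) (sym (ι-* m (4 ℕ.* P ℕ.+ 2))) ⟩
      ι (m ℕ.* (4 ℕ.* P ℕ.+ 2)) * ι (G P)
        ≡⟨ sym (ι-* (m ℕ.* (4 ℕ.* P ℕ.+ 2)) (G P)) ⟩
      ι (m ℕ.* (4 ℕ.* P ℕ.+ 2) ℕ.* G P)
        ≡⟨ cong ι (sym (G-ratio P)) ⟩
      ι (suc P ℕ.* G (suc P))
        ≡⟨ ι-* (suc P) (G (suc P)) ⟩
      ι (suc P) * ι (G (suc P)) ∎)
      where
      open ≡-Reasoning
      x z : ℚ
      x = ι P
      z = ι (Z ℕ.^ P)
      ι-4 : ι 4 ≡ 4ℚ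
      ι-4 = trans (ι-double 2) (cong₂ _+_ ι-2 ι-2)

    avg-eq : ∀ n → avgDagEdges m n * ι (B m (suc n)) ≡ ι (S n)
    avg-eq n = trans (cong (λ k → avgDagEdges m n * ι k) (sym (length-trees m n)))
      (quotient (S n) (length (trees m n)) {{Defs.trees-nonEmpty m n}})
      where
      quotient : ∀ a b .{{_ : ℕ.NonZero b}} → (ℤ.+ a / b) * ι b ≡ ι a
      quotient a (suc b) = frac-ι a b

    -- The second factor converts 1/P into 1 / ln n, through ln n ≤ 4 P ln Z and ln Z ≤ Z - 1 = p.
    errorConstant : ℚ
    errorConstant = errorBound (ι (Counting.error m)) * (4ℚ * ι p)

    errorConstant-nonNeg : 0ℚ ≤ errorConstant
    errorConstant-nonNeg = 0≤* (errorBound-nonNeg (ι-nonNeg (Counting.error m))) (0≤* (<⇒≤ (positive⁻¹ 4ℚ)) (ι-nonNeg p))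

    -- The `i`-th approximant of 3 κ n / √(ln n).
    main : ℕ → ℕ → ℚ
    main n i = 3ℚ * sqrtℚ i (logSum Z i * inv (alt leibniz i)) * (ι n * inv (sqrtℚ i (logSum n i)))

    module _ (s M : ℕ) (Z^P≤n : Z ℕ.^ suc s ℕ.≤ s ℕ.+ M) (n<Z^P⁺ : s ℕ.+ M ℕ.< Z ℕ.^ suc (suc s))
             (large : Counting.error m ℕ.≤ suc s) where

      private
        P n : ℕ
        P = suc s
        n = s ℕ.+ M

        d E e : ℚ
        d = frac 1 s
        E = avgDagEdges m n
        e = ι (Counting.error m)

        dP : d * ι P ≡ 1ℚ
        dP = trans (frac-ι 1 s) ι-1

        0<d : 0ℚ < d
        0<d = frac-pos 0 s

        0≤d : 0ℚ ≤ d
        0≤d = <⇒≤ 0<d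

        d≤1 : d ≤ 1ℚ
        d≤1 = frac-≤ {1} {1} {s} {0} (ℕ.s≤s ℕ.z≤n)

        _≈[_]_ : ℚ → ℚ → ℚ → Set
        a ≈[ k ] b = Close d 0≤d d≤1 k a b

        0<B : 0 ℕ.< B m (suc n)
        0<B = subst (0 ℕ.<_) (length-trees m n) (ℕ.>-nonZero⁻¹ _ {{Defs.trees-nonEmpty m n}})

        ι-pos′ : ∀ {k} → 0 ℕ.< k → 0ℚ < ι k
        ι-pos′ {suc k} _ = ι-pos k

        0≤E : 0ℚ ≤ E
        0≤E = cancel-≤ (ι (B m (suc n))) (ι-pos′ 0<B) (begin
          ι (B m (suc n)) * 0ℚ       ≡⟨ *-zeroʳ (ι (B m (suc n))) ⟩
          0ℚ                         ≤⟨ ι-nonNeg (S n) ⟩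
          ι (S n)                    ≡⟨ sym (avg-eq n) ⟩
          E * ι (B m (suc n))        ≡⟨ *-comm E (ι (B m (suc n))) ⟩
          ι (B m (suc n)) * E ∎)
          where open ≤-Reasoning

        E-close : E ≈[ e ] (3ℚ * ι n * β P)
        E-close = close-cancel d 0≤d d≤1 (z * b) E (3ℚ * ι n * β P)
          (0<* (ι-pos′ (ℕ.m^n>0 Z P)) (ι-pos′ 0<B))
          (subst₂ _≈[ e ]_ lhs rhs (close (ι-nonNeg _)
            (ratio (Z ℕ.^ P ℕ.* S n) _ (proj₁ counting)) (ratio _ (Z ℕ.^ P ℕ.* S n) (proj₂ counting))))
          where
          z b : ℚ
          z = ι (Z ℕ.^ P)
          b = ι (B m (suc n))
          counting = Counting.S-asymptotics m s M Z^P≤n n<Z^P⁺ large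
          lhs : ι (Z ℕ.^ P ℕ.* S n) ≡ z * b * E
          lhs = trans (ι-* (Z ℕ.^ P) (S n)) (trans (cong (z *_) (trans (sym (avg-eq n)) (*-comm E b)))
            (sym (*-assoc z b E)))
          rhs : ι (3 ℕ.* (n ℕ.* (B m (suc n) ℕ.* G P))) ≡ z * b * (3ℚ * ι n * β P)
          rhs = begin
            ι (3 ℕ.* (n ℕ.* (B m (suc n) ℕ.* G P)))
              ≡⟨ trans (ι-* 3 _) (cong₂ _*_ (trans (ι-suc 2) (cong (_+ 1ℚ) ι-2))
                   (trans (ι-* n _) (cong (ι n *_) (ι-* (B m (suc n)) (G P))))) ⟩
            3ℚ * (ι n * (b * ι (G P)))
              ≡⟨ cong (λ g → 3ℚ * (ι n * (b * g))) (sym (β-G P)) ⟩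
            3ℚ * (ι n * (b * (β P * z)))
              ≡⟨ solve 4 (λ n b β z → con 3ℚ :* (n :* (b :* (β :* z))) := z :* b :* (con 3ℚ :* n :* β)) refl
                   (ι n) b (β P) z ⟩
            z * b * (3ℚ * ι n * β P) ∎
            where open ≡-Reasoning
          ratio : ∀ x y → P ℕ.* x ℕ.≤ (P ℕ.+ Counting.error m) ℕ.* y → ι x ≤ (1ℚ + e * d) * ι y
          ratio x y h = cancel-≤ (ι P) (ι-pos s) (begin
            ι P * ι x
              ≡⟨ sym (ι-* P x) ⟩
            ι (P ℕ.* x)
              ≤⟨ ι-mono h ⟩
            ι ((P ℕ.+ Counting.error m) ℕ.* y)
              ≡⟨ trans (ι-* (P ℕ.+ Counting.error m) y) (cong (_* ι y) (ι-+ P (Counting.error m))) ⟩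
            (ι P + e) * ι y
              ≡⟨ cong (λ u → (ι P + u) * ι y) (trans (sym (*-identityʳ e)) (cong (e *_) (sym dP))) ⟩
            (ι P + e * (d * ι P)) * ι y
              ≡⟨ solve 4 (λ P e d y → (P :+ e :* (d :* P)) :* y := P :* ((con 1ℚ :+ e :* d) :* y)) refl (ι P) e d (ι y) ⟩
            ι P * ((1ℚ + e * d) * ι y) ∎)
            where open ≤-Reasoning

        -- With y = ϖ β² P, `c⁻` yields 2y and `c` yields 2y + dy, so the gap between the two Wallis
        -- bounds is itself a relative error 1/P.
        π-close : ∀ ϖ → 0ℚ ≤ ϖ → 2ℚ ≤ ϖ * c P + ½ * d → ϖ * c⁻ P ≤ 2ℚ + ½ * d →
                  (ϖ * (β P * β P) * ι P) ≈[ 1ℚ ] 1ℚ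
        π-close ϖ 0≤ϖ lo hi = close (<⇒≤ 0<1) upper lower
          where
          open ≤-Reasoning
          y : ℚ
          y = ϖ * (β P * β P) * ι P
          0≤y : 0ℚ ≤ y
          0≤y = 0≤* (0≤* 0≤ϖ (0≤* (β-nonNeg P) (β-nonNeg P))) (ι-nonNeg P)
          upper : y ≤ (1ℚ + 1ℚ * d) * 1ℚ
          upper = cancel-≤ 2ℚ (positive⁻¹ 2ℚ) (begin
            2ℚ * y
              ≡⟨ solve 3 (λ w b P → con 2ℚ :* (w :* (b :* b) :* P) := w :* (b :* b :* (P :+ P))) refl ϖ (β P) (ι P) ⟩
            ϖ * c⁻ P
              ≤⟨ hi ⟩
            2ℚ + ½ * d
              ≤⟨ 0≤-diff (0≤* (<⇒≤ (positive⁻¹ (1ℚ + ½))) 0≤d)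
                   (solve 1 (λ d → con 2ℚ :+ con ½ :* d :+ con (1ℚ + ½) :* d := con 2ℚ :* ((con 1ℚ :+ con 1ℚ :* d) :* con 1ℚ)) refl d) ⟩
            2ℚ * ((1ℚ + 1ℚ * d) * 1ℚ) ∎)
          2≤ : 2ℚ ≤ y + y + d * y + ½ * d
          2≤ = begin
            2ℚ
              ≤⟨ lo ⟩
            ϖ * c P + ½ * d
              ≡⟨ solve 4 (λ w b P h → w :* (b :* b :* (P :+ P :+ con 1ℚ)) :+ h
                   := w :* (b :* b) :* P :+ w :* (b :* b) :* P :+ w :* (b :* b) :* con 1ℚ :+ h) refl ϖ (β P) (ι P) (½ * d) ⟩
            y + y + ϖ * (β P * β P) * 1ℚ + ½ * d
              ≡⟨ cong (λ u → y + y + ϖ * (β P * β P) * u + ½ * d) (sym dP) ⟩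
            y + y + ϖ * (β P * β P) * (d * ι P) + ½ * d
              ≡⟨ solve 5 (λ y w d P h → y :+ y :+ w :* (d :* P) :+ h := y :+ y :+ d :* (w :* P) :+ h) refl
                   y (ϖ * (β P * β P)) d (ι P) (½ * d) ⟩
            y + y + d * y + ½ * d ∎
          -- This preliminary bound turns the additive slack ½ d into the multiple d y.
          ½≤y : ½ ≤ y
          ½≤y = cancel-≤ 3ℚ (positive⁻¹ 3ℚ) (begin
            3ℚ * ½
              ≡⟨⟩
            2ℚ - ½
              ≤⟨ ≤+⇒-≤ {2ℚ} {½} (≤-trans 2≤ (≤-trans (+-mono-≤
                   (+-monoʳ-≤ (y + y) (*-monoʳ y 0≤y d≤1)) (*-monoˡ ½ (<⇒≤ 0<½) d≤1))
                   (≤-reflexive (solve 1 (λ y → y :+ y :+ con 1ℚ :* y :+ con ½ :* con 1ℚ := con ½ :+ con 3ℚ :* y) refl y)))) ⟩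
            3ℚ * y ∎)
          lower : 1ℚ ≤ (1ℚ + 1ℚ * d) * y
          lower = cancel-≤ 2ℚ (positive⁻¹ 2ℚ) (begin
            2ℚ * 1ℚ
              ≤⟨ 2≤ ⟩
            y + y + d * y + ½ * d
              ≤⟨ +-monoʳ-≤ (y + y + d * y) (*-monoʳ d 0≤d ½≤y) ⟩
            y + y + d * y + y * d
              ≡⟨ solve 2 (λ y d → y :+ y :+ d :* y :+ y :* d := con 2ℚ :* ((con 1ℚ :+ con 1ℚ :* d) :* y)) refl y d ⟩
            2ℚ * ((1ℚ + 1ℚ * d) * y) ∎)

        -- One factor 1 + d comes from Z^P ≤ n < Z^(P+1), the other from the mesh of the Riemann
        -- sum, which is at most d μ because μ ≥ ½.
        Λ-close : ∀ i → frac 1 i ≤ d * ½ → logSum n i ≈[ 1ℚ ⊕ 1ℚ ] (ι P * logSum Z i)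
        Λ-close i f≤ = close (<⇒≤ (positive⁻¹ (1ℚ ⊕ 1ℚ))) upper lower
          where
          open ≤-Reasoning
          μ : ℚ
          μ = logSum Z i
          ½≤μ : ½ ≤ μ
          ½≤μ = riemann-lower p i
          0≤μ : 0ℚ ≤ μ
          0≤μ = ≤-trans (<⇒≤ 0<½) ½≤μ
          upper : logSum n i ≤ (1ℚ + (1ℚ ⊕ 1ℚ) * d) * (ι P * μ)
          upper = begin
            logSum n i
              ≤⟨ logSum-≤ i (ℕ.<⇒≤ n<Z^P⁺) ⟩
            logSum (Z ℕ.^ suc P) i
              ≤⟨ logSum-^-≤ p (suc P) i ⟩
            ι (suc P) * (μ + frac 1 i)
              ≤⟨ *-monoˡ (ι (suc P)) (ι-nonNeg (suc P)) (+-monoʳ-≤ μ (≤-trans f≤ (*-monoˡ d 0≤d ½≤μ))) ⟩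
            ι (suc P) * (μ + d * μ)
              ≡⟨ cong (_* (μ + d * μ)) (trans (ι-suc P) (cong (ι P +_) (sym dP))) ⟩
            (ι P + d * ι P) * (μ + d * μ)
              ≡⟨ solve 3 (λ P d μ → (P :+ d :* P) :* (μ :+ d :* μ) := (con 1ℚ :+ con 1ℚ :* d) :* (con 1ℚ :+ con 1ℚ :* d) :* (P :* μ)) refl
                   (ι P) d μ ⟩
            (1ℚ + 1ℚ * d) * (1ℚ + 1ℚ * d) * (ι P * μ)
              ≤⟨ *-monoʳ (ι P * μ) (0≤* (ι-nonNeg P) 0≤μ) (factor-⊕ d 0≤d d≤1 (<⇒≤ 0<1) (<⇒≤ 0<1)) ⟩
            (1ℚ + (1ℚ ⊕ 1ℚ) * d) * (ι P * μ) ∎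
          Pμ≤Λ : ι P * μ ≤ logSum n i
          Pμ≤Λ = ≤-trans (logSum-^-≥ p P i) (logSum-≤ i Z^P≤n)
          lower : ι P * μ ≤ (1ℚ + (1ℚ ⊕ 1ℚ) * d) * logSum n i
          lower = ≤-trans Pμ≤Λ (≤-trans (≤-reflexive (sym (*-identityˡ (logSum n i))))
            (*-monoʳ (logSum n i) (≤-trans (0≤* (ι-nonNeg P) 0≤μ) Pμ≤Λ)
              (p≤p+q {1ℚ} (0≤* (<⇒≤ (positive⁻¹ (1ℚ ⊕ 1ℚ))) 0≤d))))

        estimate : ∀ i → frac 1 i ≤ d * (½ * (½ * ½)) → 1ℚ ≤ alt leibniz i →
          2ℚ ≤ alt leibniz i * c P + ½ * d → alt leibniz i * c⁻ P ≤ 2ℚ + ½ * d →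
          ∣ E * inv (main n i) - 1ℚ ∣ ≤ errorConstant * inv (logSum n i)
        estimate i f≤ 1≤ϖ lo hi = begin
          ∣ E * inv (main n i) - 1ℚ ∣
            ≤⟨ close⇒quotient d 0≤d d≤1 0≤E 0<main (close-main d 0≤d d≤1 e E (ι n) (β P) (ι P) μ Λ ϖ σ r
                 0≤E 0<n (β-nonNeg P) (ι-nonNeg P) (<⇒≤ 0<μ) (<⇒≤ 0<Λ) 0<ϖ 0<σ (<⇒≤ 0<r)
                 E-close (π-close ϖ (<⇒≤ 0<ϖ) lo hi) (Λ-close i f≤½)
                 (close-sqrt d 0≤d d≤1 i Λ θ 0<θ θ²≤Λ f≤) (close-sqrt d 0≤d d≤1 i (μ * inv ϖ) θ 0<θ θ²≤μ/ϖ f≤)) ⟩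
          K * d
            ≤⟨ *-monoˡ K 0≤K d≤ ⟩
          K * (4ℚ * ι p * inv Λ)
            ≡⟨ sym (*-assoc K (4ℚ * ι p) (inv Λ)) ⟩
          errorConstant * inv Λ ∎
          where
          open ≤-Reasoning
          K θ μ Λ ϖ σ r : ℚ
          K = errorBound e
          -- Its square 1/16 lies below both radicands: ln n is at least ½, and μ / ϖ is at least
          -- 1/8 because ϖ ≤ 4.
          θ = ½ * ½
          μ = logSum Z i
          Λ = logSum n i
          ϖ = alt leibniz i
          σ = sqrtℚ i Λ
          r = sqrtℚ i (μ * inv ϖ)
          0<θ : 0ℚ < θ
          0<θ = positive⁻¹ θ
          0<ϖ : 0ℚ < ϖ
          0<ϖ = <-≤-trans 0<1 1≤ϖ
          ½≤μ : ½ ≤ μ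
          ½≤μ = riemann-lower p i
          0<μ : 0ℚ < μ
          0<μ = <-≤-trans 0<½ ½≤μ
          Z≤Z^P : Z ℕ.≤ Z ℕ.^ P
          Z≤Z^P = ℕ.≤-trans (ℕ.≤-reflexive (sym (ℕ.*-identityʳ Z))) (ℕ.*-monoʳ-≤ Z (ℕ.m^n>0 Z s))
          ½≤Λ : ½ ≤ Λ
          ½≤Λ = ≤-trans ½≤μ (logSum-≤ i (ℕ.≤-trans Z≤Z^P Z^P≤n))
          0<Λ : 0ℚ < Λ
          0<Λ = <-≤-trans 0<½ ½≤Λ
          0<n : 0ℚ < ι n
          0<n = ι-pos′ (ℕ.≤-trans (ℕ.m^n>0 Z P) Z^P≤n)
          f≤½ : frac 1 i ≤ d * ½
          f≤½ = ≤-trans f≤ (*-monoˡ d 0≤d (toWitness {a? = ½ * θ ≤? ½} _))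
          f≤½θ : frac 1 i ≤ ½ * θ
          f≤½θ = ≤-trans f≤ (≤-trans (*-monoʳ (½ * θ) (<⇒≤ (positive⁻¹ (½ * θ))) d≤1) (≤-reflexive (*-identityˡ (½ * θ))))
          θ²≤Λ : θ * θ ≤ Λ
          θ²≤Λ = ≤-trans (toWitness {a? = θ * θ ≤? ½} _) ½≤Λ
          ϖ≤4 : ϖ ≤ 4ℚ
          ϖ≤4 = proj₂ (alt-bounds leibniz leibniz-nonNeg leibniz-anti i)
          θ²≤μ/ϖ : θ * θ ≤ μ * inv ϖ
          θ²≤μ/ϖ = ≤-trans (toWitness {a? = θ * θ ≤? ½ * θ} _) (*-mono (<⇒≤ 0<½) (<⇒≤ (inv-pos ϖ 0<ϖ)) ½≤μ (inv-antitone 0<ϖ ϖ≤4))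
          0<σ : 0ℚ < σ
          0<σ = <-≤-trans (positive⁻¹ (½ * θ)) (sqrtℚ-≥ i Λ θ 0<θ θ²≤Λ f≤½θ)
          0<r : 0ℚ < r
          0<r = <-≤-trans (positive⁻¹ (½ * θ)) (sqrtℚ-≥ i (μ * inv ϖ) θ 0<θ θ²≤μ/ϖ f≤½θ)
          0<main : 0ℚ < 3ℚ * r * (ι n * inv σ)
          0<main = 0<* (0<* (positive⁻¹ 3ℚ) 0<r) (0<* 0<n (inv-pos σ 0<σ))
          0≤K : 0ℚ ≤ K
          0≤K = errorBound-nonNeg (ι-nonNeg (Counting.error m))
          d≤ : d ≤ 4ℚ * ι p * inv Λ
          d≤ = begin
            d
              ≡⟨ trans (sym (*-identityʳ d)) (cong (d *_) (sym (*-inv Λ 0<Λ))) ⟩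
            d * (Λ * inv Λ)
              ≡⟨ sym (*-assoc d Λ (inv Λ)) ⟩
            d * Λ * inv Λ
              ≤⟨ *-monoʳ (inv Λ) (<⇒≤ (inv-pos Λ 0<Λ)) (begin
                   d * Λ
                     ≤⟨ *-monoˡ d 0≤d (Close.upper (Λ-close i f≤½)) ⟩
                   d * ((1ℚ + (1ℚ ⊕ 1ℚ) * d) * (ι P * μ))
                     ≤⟨ *-monoˡ d 0≤d (*-mono (factor-nonNeg d 0≤d d≤1 (<⇒≤ (positive⁻¹ (1ℚ ⊕ 1ℚ))))
                          (0≤* (ι-nonNeg P) (ι-nonNeg p))
                          (+-monoʳ-≤ 1ℚ (*-monoˡ (1ℚ ⊕ 1ℚ) (<⇒≤ (positive⁻¹ (1ℚ ⊕ 1ℚ))) d≤1))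
                          (*-monoˡ (ι P) (ι-nonNeg P) (logSum-bound p i))) ⟩
                   d * (4ℚ * (ι P * ι p))
                     ≡⟨ solve 3 (λ d P p → d :* (con 4ℚ :* (P :* p)) := con 4ℚ :* p :* (d :* P)) refl d (ι P) (ι p) ⟩
                   4ℚ * ι p * (d * ι P)
                     ≡⟨ trans (cong (4ℚ * ι p *_) dP) (*-identityʳ (4ℚ * ι p)) ⟩
                   4ℚ * ι p ∎) ⟩
            4ℚ * ι p * inv Λ ∎

      -- The index from which this holds depends on n through d, while `errorConstant` depends on m
      -- only.
      eventually-close : Eventually λ i → ∣ E * inv (main n i) - 1ℚ ∣ ≤ errorConstant * inv (logSum n i)
      eventually-close =
        let δ = d * (½ * (½ * ½))
            I , h = both (both (archimedean δ (0<* 0<d (positive⁻¹ (½ * (½ * ½))))) leibniz-lower)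
                         (π-bounds P (½ * d) (0<* 0<½ 0<d))
        in I , λ i I≤i → let (f≤ , 1≤ϖ) , lo , hi = h i I≤i in estimate i f≤ 1≤ϖ lo hi

    relative-error : ∀ n → Z ℕ.^ Counting.error m ℕ.≤ n →
      Eventually λ i → ∣ avgDagEdges m n * inv (main n i) - 1ℚ ∣ ≤ errorConstant * inv (logSum n i)
    relative-error n N≤n = at-cutoff
      (cutoff Z (Counting.error m) n (ℕ.*-monoʳ-≤ 4 (ℕ.s≤s ℕ.z≤n)) (Counting.1≤error m) N≤n)
      where
      at-cutoff : ∀ {n} →
        ∃[ s ] ∃[ M ] s ℕ.+ M ≡ n × Z ℕ.^ suc s ℕ.≤ n × n ℕ.< Z ℕ.^ suc (suc s) × Counting.error m ℕ.≤ suc s →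
        Eventually λ i → ∣ avgDagEdges m n * inv (main n i) - 1ℚ ∣ ≤ errorConstant * inv (logSum n i)
      at-cutoff (s , M , refl , Z^P≤n , n<Z^P⁺ , large) = eventually-close s M Z^P≤n n<Z^P⁺ large

-- Passage to the real numbers.

open import Defs
open import Data.Nat.Base using (ℕ; zero; suc; NonZero; NonTrivial; ≢-nonZero⁻¹)
open import Data.Product.Base using (Σ-syntax; _×_; _,_)
open import Data.Empty using (⊥-elim)
open import Relation.Binary.PropositionalEquality using (refl)

module RealEstimate where

  import Data.Nat.Base as ℕ
  import Data.Nat.Properties as ℕ
  open import Data.Rational.Base as ℚ using (ℚ; 1ℚ)
  import Data.Rational.Properties as ℚ
  open import Data.Rational.Solver using (module +-*-Solver)
  open import Relation.Binary.PropositionalEquality using (sym; trans; cong; subst)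
  open +-*-Solver using (solve; con; _:+_; _:*_; _:=_)
  open Rational
  open RationalArithmetic using (ι-def; ι-pos; *-monoˡ)
  open RationalEstimate using (errorConstant; errorConstant-nonNeg; relative-error)
  open Positive

  fromℕ-positive : ∀ n → .{{NonZero n}} → Positive (fromℕ n)
  fromℕ-positive (suc n) = record { bound-pos = frac-pos n 0 ; bound≤ = 0 , λ _ _ → ℚ.≤-refl }

  *-positive : ∀ {x y} → Positive x → Positive y → Positive (x * y)
  *-positive p q = record
    { bound-pos = 0<* (p .bound-pos) (q .bound-pos)
    ; bound≤    = let I , h = both (p .bound≤) (q .bound≤) in I , λ i I≤i →
        let p≤ , q≤ = h i I≤i
        in *-mono (ℚ.<⇒≤ (p .bound-pos)) (ℚ.≤-trans (ℚ.<⇒≤ (q .bound-pos)) q≤) p≤ q≤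
    }

  ÷-positive : ∀ {x y} → Positive x → (q : Positive y) → Positive ((x ÷ y) {{q}})
  ÷-positive {x} {y} p q =
    let b , 0<b , y≤b = bounded (seq y) (cauchy y) in record
    { bound-pos = 0<* (p .bound-pos) (inv-pos b 0<b)
    ; bound≤    = let I , h = both (p .bound≤) (both (q .bound≤) y≤b) in I , λ i I≤i →
        let p≤ , q≤ , ∣y∣≤b = h i I≤i
            0<y = ℚ.<-≤-trans (q .bound-pos) q≤
        in *-mono (ℚ.<⇒≤ (p .bound-pos)) (ℚ.<⇒≤ (inv-pos (seq y i) 0<y)) p≤
             (inv-antitone 0<y (ℚ.≤-trans (p≤∣p∣ (seq y i)) ∣y∣≤b))
    }

  module _ (m′ : ℕ) where

    private
      m : ℕ
      m = suc m′

    main : Sequence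
    main n = fromℕ 3 * κ m * (fromℕ n ÷ √ ln n)

    main-positive : ∀ n → .{{_ : NonTrivial n}} → Positive (main n)
    main-positive n {{n>1}} = *-positive
      (*-positive (fromℕ-positive 3) (√-positive {{÷-positive (ln-positive {4 ℕ.* m} {{4m>1}}) π-positive}}))
      (÷-positive (fromℕ-positive n {{ℕ.nonTrivial⇒nonZero n}}) √-positive)
      where
      4m>1 : NonTrivial (4 ℕ.* m)
      4m>1 = ℕ.n>1⇒nonTrivial (ℕ.≤-trans (ℕ.s≤s (ℕ.s≤s ℕ.z≤n)) (ℕ.*-monoʳ-≤ 4 (ℕ.s≤s ℕ.z≤n)))

    -- The quotient minus 1. Division demands a proof that the main term is bounded away from 0,
    -- hence `main-positive`.
    relativeError : Sequence
    relativeError n = (Ē m n ÷ main n) {{main-positive n}} + fromℚ (ℚ.- 1ℚ)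

    relativeError-O : relativeError =O (λ n → fromℕ 1 ÷ ln n)
    -- The threshold (4m)^error guarantees error ≤ P at the cutoff.
    relativeError-O = fromℚ (errorConstant m′) , (4 ℕ.* m) ℕ.^ Counting.error m , λ n {{n>1}} N≤n e 0<e →
      let I , h = relative-error m′ n N≤n in I , λ i I≤i →
      let v = inv (logSum n i) in ℚ.≤-trans
        (subst (λ x → ℚ.∣ avgDagEdges m n ℚ.* inv (seq (fromℕ 3 * κ m * (fromℚ x ÷ √ ln n)) i) ℚ.- 1ℚ ∣ ℚ.≤ errorConstant m′ ℚ.* v) (ι-def n) (h i I≤i))
        (ℚ.≤-trans (*-monoˡ (errorConstant m′) (errorConstant-nonNeg m′)
            (ℚ.≤-trans (p≤∣p∣ v) (ℚ.≤-reflexive (cong ℚ.∣_∣ (sym (ℚ.*-identityˡ v))))))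
          (p≤p+q (ℚ.<⇒≤ 0<e)))

    relativeError-≃ : ∀ n → .{{_ : NonTrivial n}} → Ē m n ≃ main n * (fromℕ 1 + relativeError n)
    relativeError-≃ n e 0<e = let I , h = main-positive n .bound≤ in I , λ i I≤i →
      let x = avgDagEdges m n
          y = seq (main n) i
          cancels = trans (solve 3 (λ x y v → y :* (con 1ℚ :+ (x :* v :+ con (ℚ.- 1ℚ))) := x :* (y :* v)) refl x y (inv y))
            (trans (cong (x ℚ.*_) (*-inv y (ℚ.<-≤-trans (main-positive n .bound-pos) (h i I≤i)))) (ℚ.*-identityʳ x))
      in ℚ.≤-trans (ℚ.≤-reflexive (cong ℚ.∣_∣ (trans (cong (ℚ._-_ x) cancels) (ℚ.+-inverseʳ x)))) (ℚ.<⇒≤ 0<e)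

theorem8 : (m : ℕ) .{{_ : NonZero m}} →
    Σ[ ε ∈ Sequence ]
    ε =O (λ n → fromℕ 1 ÷ ln n) ×
    ((n : ℕ) .{{_ : NonTrivial n}} →
    Ē m n ≃ fromℕ 3 * κ m * (fromℕ n ÷ √ ln n) * (fromℕ 1 + ε n))
theorem8 zero {{m≢0}} = ⊥-elim (≢-nonZero⁻¹ 0 {{m≢0}} refl)
theorem8 (suc m) = relativeError m , relativeError-O m , relativeError-≃ m
  where open RealEstimate
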